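{- Let $G$ be a connected unweighted graph of order $n\ge2$, and let $H$ be a connected spanning subgraph of $G$ obtained by deleting $r\le n-1$ edges. If $\mu_1\ge\cdots\ge\mu_n=0$ and $\theta_1\ge\cdots\ge\theta_n=0$ are the eigenvalues of the normalized Laplacian matrices $\mathcal L_G$ and $\mathcal L_H$, respectively, then $$\frac{r}{\mu_1}+\sum_{j=1}^{n-r-1}\frac{1}{\theta_j}\ \le\ K(G)\ \le\ \sum_{j=r+1}^{n-1}\frac{1}{\theta_j}+\frac{r}{\mu_{n-1}}.$$
   Context: Graphs are finite, simple, connected and undirected, with $n$ vertices; unweighted means all edge weights are $1$. For a graph $G$ with adjacency matrix $A$ and diagonal degree matrix $D$, the normalized Laplacian is $\mathcal L_G=I-D^{ -1/2}AD^{ -1/2}$; for connected $G$ its eigenvalue $0$ is simple. (The normalized Laplacian of $H$ uses the degrees in $H$.) Empty sums are $0$. Kemeny's constant is $K(G)=\sum_i\pi_i m_{ji}-1$ for the random walk with transition matrix $D^{ -1}A$, where $\pi$ is the stationary distribution and $m_{ji}$ the mean first passage time from $j$ to $i$ (with $m_{jj}$ the mean first return time); this does not depend on $j$, and it is known that $K(G)=\sum_{j=1}^{n-1}\frac{1}{\mu_j}$, where $\mu_1\ge\cdots\ge\mu_{n-1}>\mu_n=0$ are the eigenvalues of $\mathcal L_G$. -}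

module Defs where

open import Level using (0ℓ)
open import Algebra.Bundles using (CommutativeRing)
open import Data.Bool.Base using (Bool; false; not; T; _∧_; if_then_else_)
open import Data.Fin.Base using (Fin; zero; suc; toℕ; punchIn; inject₁; fromℕ)
open import Data.Fin.Properties using (_≟_)
open import Data.List.Base using (List; length; filterᵇ; cartesianProduct; allFin)
open import Data.Nat.Base as ℕ using (ℕ; zero; suc)
open import Data.Product.Base using (∃; _×_; _,_; proj₁)
open import Data.Sum.Base using (inj₁; inj₂)
open import Data.Vec.Functional using (Vector)
open import Relation.Binary.Core using (Rel)
open import Relation.Binary.Structures using (IsDecTotalOrder)
open import Relation.Binary.Construct.Closure.ReflexiveTransitive using (Star)
open import Relation.Binary.PropositionalEquality.Core using (_≡_)
open import Relation.Nullary using (¬_; does; yes; no)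
open import Relation.Nullary.Negation using (contradiction)
open import Relation.Unary using (Pred)

record Graph (n : ℕ) : Set where
  field
    adj       : Fin n → Fin n → Bool
    symmetric : ∀ u v → adj u v ≡ adj v u
    loopless  : ∀ v → adj v v ≡ false

  _~_ : Rel (Fin n) 0ℓ
  u ~ v = T (adj u v)

  Connected : Set
  Connected = ∀ u v → Star _~_ u v

open Graph using (adj; Connected)

SpanningSubgraph : ∀ {n} → Graph n → Graph n → Set
SpanningSubgraph H G = ∀ u v → T (adj H u v) → T (adj G u v)

-- An undirected edge {u , v} is listed once, as the pair with u < v.
deletedEdges : ∀ {n} → Graph n → Graph n → List (Fin n × Fin n)
deletedEdges {n} G H =
  filterᵇ (λ (u , v) → (toℕ u ℕ.<ᵇ toℕ v) ∧ adj G u v ∧ not (adj H u v))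
          (cartesianProduct (allFin n) (allFin n))

record ObtainedByDeleting {n} (r : ℕ) (G H : Graph n) : Set where
  field
    subgraph : SpanningSubgraph H G
    count    : length (deletedEdges G H) ≡ r

-- The real numbers, characterised (classically, up to isomorphism) as a
-- Dedekind-complete ordered field.  The decidable order and the existence
-- of suprema of arbitrary predicates express the classical reading of ℝ.

record RealNumbers : Set₁ where
  infix 4 _≤_
  field
    commutativeRing : CommutativeRing 0ℓ 0ℓ

  open CommutativeRing commutativeRing public

  field
    _≤_             : Rel Carrier 0ℓ
    isDecTotalOrder : IsDecTotalOrder _≈_ _≤_
    0≉1             : ¬ 0# ≈ 1#
    inverse         : ∀ x → ¬ x ≈ 0# → ∃ λ y → x * y ≈ 1#
    +-monoʳ-≤       : ∀ x {y z} → y ≤ z → x + y ≤ x + z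
    *-nonneg        : ∀ {x y} → 0# ≤ x → 0# ≤ y → 0# ≤ x * y

  UpperBound : Pred Carrier 0ℓ → Pred Carrier 0ℓ
  UpperBound P b = ∀ x → P x → x ≤ b

  LeastUpperBound : Pred Carrier 0ℓ → Pred Carrier 0ℓ
  LeastUpperBound P s = UpperBound P s × (∀ b → UpperBound P b → s ≤ b)

  field
    supremum : (P : Pred Carrier 0ℓ) → ∃ P → ∃ (UpperBound P) → ∃ (LeastUpperBound P)

module OverReals (ℛ : RealNumbers) where

  open RealNumbers ℛ public
    renaming (Carrier to ℝ; refl to ≈-refl; sym to ≈-sym; trans to ≈-trans;
              reflexive to ≈-reflexive; zero to *-zero)
  open IsDecTotalOrder isDecTotalOrder public
    using (_≤?_; total; antisym; ≤-respˡ-≈; ≤-respʳ-≈)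
    renaming (_≟_ to _≈?_; refl to ≤-refl; reflexive to ≤-reflexive;
              trans to ≤-trans)
  open import Relation.Binary.Construct.NonStrictToStrict _≈_ _≤_ public using (_<_)
  open import Algebra.Properties.CommutativeMonoid.Sum +-commutativeMonoid public
    using (sum; sum-syntax)
  open import Algebra.Definitions.RawMonoid +-rawMonoid public
    using () renaming (_×_ to _·_)
  open import Algebra.Properties.CommutativeMonoid.Sum *-commutativeMonoid public
    using () renaming (sum to product)
  open import Algebra.Properties.Semiring.Exp semiring public using (_^_)

  infix 9 _⁻¹

  -- Totalised by 0⁻¹ = 0.
  _⁻¹ : ℝ → ℝ
  x ⁻¹ with x ≈? 0#
  ... | yes _  = 0#
  ... | no x≉0 = proj₁ (inverse x x≉0)

  +-monoˡ-≤ : ∀ {x y z} → y ≤ z → y + x ≤ z + x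
  +-monoˡ-≤ {x} {y} {z} y≤z =
    ≤-respˡ-≈ (+-comm x y) (≤-respʳ-≈ (+-comm x z) (+-monoʳ-≤ x y≤z))

  x≤y⇒0≤y-x : ∀ {x y} → x ≤ y → 0# ≤ y - x
  x≤y⇒0≤y-x {x} x≤y = ≤-respˡ-≈ (-‿inverseʳ x) (+-monoˡ-≤ x≤y)

  0≤y-x⇒x≤y : ∀ {x y} → 0# ≤ y - x → x ≤ y
  0≤y-x⇒x≤y {x} {y} p = ≤-respˡ-≈ (+-identityˡ x) (≤-respʳ-≈
    (≈-trans (+-assoc y (- x) x)
      (≈-trans (+-congˡ (-‿inverseˡ x)) (+-identityʳ y)))
    (+-monoˡ-≤ p))

  open import Algebra.Properties.Ring ring
    using (-‿distribˡ-*; -‿involutive)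

  *-monoˡ-≤ : ∀ {x y z} → 0# ≤ x → y ≤ z → y * x ≤ z * x
  *-monoˡ-≤ {x} {y} {z} 0≤x y≤z = 0≤y-x⇒x≤y (≤-respʳ-≈
    (≈-trans (distribʳ x z (- y)) (+-congˡ (≈-sym (-‿distribˡ-* y x))))
    (*-nonneg (x≤y⇒0≤y-x y≤z) 0≤x))

  0≤1 : 0# ≤ 1#
  0≤1 with total 0# 1#
  ... | inj₁ p = p
  ... | inj₂ p = ≤-respʳ-≈ -1*-1≈1 (*-nonneg 0≤-1 0≤-1)
    where
    0≤-1 : 0# ≤ - 1#
    0≤-1 = ≤-respʳ-≈ (+-identityˡ (- 1#)) (x≤y⇒0≤y-x p)
    -1*-1≈1 : - 1# * - 1# ≈ 1#
    -1*-1≈1 = ≈-trans (≈-sym (-‿distribˡ-* 1# (- 1#)))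
      (≈-trans (-‿cong (*-identityˡ (- 1#))) (-‿involutive 1#))

  square-bound : ∀ {a} → 0# ≤ a → ∀ x → x * x ≤ a → x ≤ 1# + a
  square-bound {a} 0≤a x x²≤a with total x (1# + a)
  ... | inj₁ x≤1+a = x≤1+a
  ... | inj₂ 1+a≤x = contradiction (antisym 0≤1 1≤0) 0≉1
    where
    1≤1+a : 1# ≤ 1# + a
    1≤1+a = ≤-respˡ-≈ (+-identityʳ 1#) (+-monoʳ-≤ 1# 0≤a)
    1≤x : 1# ≤ x
    1≤x = ≤-trans 1≤1+a 1+a≤x
    x≤x² : x ≤ x * x
    x≤x² = ≤-respˡ-≈ (*-identityˡ x) (*-monoˡ-≤ (≤-trans 0≤1 1≤x) 1≤x)
    1+a≤a : 1# + a ≤ a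
    1+a≤a = ≤-trans 1+a≤x (≤-trans x≤x² x²≤a)
    1≤0 : 1# ≤ 0#
    1≤0 = ≤-respˡ-≈
      (≈-trans (+-assoc 1# a (- a))
        (≈-trans (+-congˡ (-‿inverseʳ a)) (+-identityʳ 1#)))
      (≤-respʳ-≈ (-‿inverseʳ a) (+-monoˡ-≤ 1+a≤a))

  -- √ a = sup { x | x² ≤ a } for a ≥ 0; negative arguments are sent to 0.
  √ : ℝ → ℝ
  √ a with 0# ≤? a
  ... | no  _   = 0#
  ... | yes 0≤a = proj₁ (supremum (λ x → x * x ≤ a)
      (0# , ≤-respˡ-≈ (≈-sym (zeroˡ 0#)) 0≤a)
      (1# + a , square-bound 0≤a))

  -- f_a + ⋯ + f_b, where the entries of f are numbered from 1 to n.
  ∑[_⋯_] : ∀ {n} → ℕ → ℕ → Vector ℝ n → ℝ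
  ∑[ a ⋯ b ] f = sum λ j →
    if (a ℕ.≤ᵇ suc (toℕ j)) ∧ (suc (toℕ j) ℕ.≤ᵇ b) then f j else 0#

  ConvergesTo : (ℕ → ℝ) → ℝ → Set
  ConvergesTo s l = ∀ ε → 0# < ε →
    ∃ λ N → ∀ k → N ℕ.≤ k → (l - ε < s k) × (s k < l + ε)

  Matrix : ℕ → Set
  Matrix n = Fin n → Fin n → ℝ

  I : ∀ {n} → Matrix n
  I i j = if does (i ≟ j) then 1# else 0#

  -- Laplace expansion along the first row.
  det : ∀ {n} → Matrix n → ℝ
  det {zero}  M = 1#
  det {suc n} M = ∑[ j < suc n ]
    ((- 1#) ^ toℕ j * M zero j * det (λ a b → M (suc a) (punchIn j b)))

  -- The eigenvalues, repeated according to multiplicity, are the roots of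
  -- the characteristic polynomial: det (x I - M) = ∏ⱼ (x - λⱼ).  Since ℝ is
  -- infinite, equality at every x is equality of polynomials.
  AreEigenvalues : ∀ {n} → Matrix n → Vector ℝ n → Set
  AreEigenvalues M λs =
    ∀ x → det (λ i j → x * I i j - M i j) ≈ product (λ j → x - λs j)

  Decreasing : ∀ {n} → Vector ℝ n → Set
  Decreasing λs = ∀ i j → toℕ i ℕ.≤ toℕ j → λs j ≤ λs i

  -- For order n = k + 2 ≥ 2, the entries numbered 1, n - 1 and n.
  first penultimate final : ∀ {k} → Vector ℝ (suc (suc k)) → ℝ
  first       λs = λs zero
  penultimate λs = λs (inject₁ (fromℕ _))
  final       λs = λs (fromℕ _)

  adjacency : ∀ {n} → Graph n → Matrix n
  adjacency G i j = if adj G i j then 1# else 0#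

  degree : ∀ {n} → Graph n → Vector ℝ n
  degree {n} G i = ∑[ j < n ] adjacency G i j

  normalizedLaplacian : ∀ {n} → Graph n → Matrix n
  normalizedLaplacian G i j =
    I i j - (√ (degree G i)) ⁻¹ * adjacency G i j * (√ (degree G j)) ⁻¹

  transition : ∀ {n} → Graph n → Matrix n
  transition G i j = (degree G i) ⁻¹ * adjacency G i j

  record IsStationary {n} (G : Graph n) (π : Vector ℝ n) : Set where
    field
      nonneg     : ∀ i → 0# ≤ π i
      total-mass : sum π ≈ 1#
      invariant  : ∀ j → ∑[ i < n ] (π i * transition G i j) ≈ π j

  -- firstPassage G i t j is the probability that the walk (Xₛ) started at j
  -- satisfies X₁ ≠ i , … , Xₜ ≠ i and Xₜ₊₁ = i, so the first passage time
  -- (the first return time when j = i) equals t + 1.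
  firstPassage : ∀ {n} → Graph n → Fin n → ℕ → Fin n → ℝ
  firstPassage     G i zero    j = transition G j i
  firstPassage {n} G i (suc t) j = ∑[ k < n ]
    (if does (k ≟ i) then 0# else transition G j k * firstPassage G i t k)

  -- m j i is the expected first passage time from j to i, that is, the sum
  -- of the series of (t + 1) · Pr (first passage time = t + 1) over t ≥ 0.
  AreMeanFirstPassageTimes : ∀ {n} → Graph n → Matrix n → Set
  AreMeanFirstPassageTimes G m = ∀ j i → ConvergesTo
    (λ N → ∑[ t < N ] (suc (toℕ t) · firstPassage G i (toℕ t) j)) (m j i)

  -- Independence of the starting vertex is not presupposed.
  record IsKemenyConstant {n} (G : Graph n) (κ : ℝ) : Set where
    field
      π          : Vector ℝ n
      stationary : IsStationary G π
      m          : Matrix n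
      passage    : AreMeanFirstPassageTimes G m
      start      : Fin n
      value      : κ ≈ ∑[ i < n ] (π i * m start i) - 1#

{-# OPTIONS --safe #-}
module Submission where

-- The eigenvalues of 𝓛 = I - D^(-1/2) A D^(-1/2) are those of the pencil L f = λ D f with
-- L = D - A, which is diagonalised by a D-orthonormal basis.  Hence Courant–Fischer applies
-- to the quotients L(f,f) / D(f,f) of G and H.  On the subspace where f u = f v for each of
-- the r deleted edges uv, both graphs have the same numerator and G has the larger
-- denominator; this gives μ_{j+r} ≤ θ_j.  On the subspace where f u = - f v, passing from H
-- to G adds 2s to the numerator and s ≥ 0 to the denominator, which does not decrease a
-- quotient that is at most 2; this gives θ_{j+r} ≤ μ_j.
--
-- First-step analysis shows that the passage times h to i satisfy L h = d - vol(G) e_i.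
-- Expanding h in the eigenbasis and averaging over the stationary distribution d / vol(G)
-- yields K(G) = Σ 1/μ_j over the nonzero eigenvalues, and the bounds follow term by term.

open import Defs
open import Data.Nat.Base using (ℕ; suc; _∸_) renaming (_≤_ to _≤ℕ_; _+_ to _+ℕ_)
open import Data.Product.Base using (_×_)
open import Data.Vec.Functional using (Vector)

open import Level using (0ℓ)
open import Algebra.Bundles using (RawRing)
import Algebra.Solver.Ring as RingSolver
import Algebra.Solver.Ring.AlmostCommutativeRing as ACR
open import Data.Bool.Base using (Bool; true; false; T; if_then_else_; _∧_; not)
open import Data.Bool.Properties using (T-∧)
open import Data.Fin.Base
  using (Fin; zero; suc; toℕ; fromℕ; fromℕ<; inject₁; inject≤; punchIn; punchOut; splitAt; _↑ˡ_; _↑ʳ_)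
import Data.Fin.Induction as Fin
import Data.Fin.Properties as Fin
open import Data.Fin.Properties using (_≟_)
import Data.Integer.Base as ℤ
import Data.Integer.Properties as ℤ
open import Data.List.Base using (List; length; lookup)
open import Data.List.Membership.Propositional using (_∈_)
open import Data.List.Membership.Propositional.Properties using (∈-filter⁺; ∈-cartesianProduct⁺; ∈-allFin)
open import Data.List.Relation.Unary.Any using (index)
open import Data.List.Relation.Unary.Any.Properties using (lookup-index)
import Data.Maybe.Base as Maybe
open import Data.Nat.Base as ℕ using (zero)
import Data.Nat.Properties as ℕ
open import Data.Product.Base using (∃; _,_; proj₁; proj₂)
open import Data.Sum.Base as Sum using (_⊎_; inj₁; inj₂; [_,_]′)
open import Data.Unit.Base using (tt)
open import Data.Vec.Functional using (_∷_; tail; updateAt)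
open import Data.Vec.Functional.Properties using (updateAt-updates; updateAt-minimal)
open import Function.Base using (_∘_)
open import Function.Bundles using (Equivalence)
open import Relation.Binary.Bundles using (DecTotalOrder)
open import Relation.Binary.Construct.Closure.ReflexiveTransitive using (Star; ε; _◅_)
open import Relation.Binary.Definitions using (tri<; tri≈; tri>)
open import Relation.Binary.PropositionalEquality as ≡ using (_≡_; _≢_)
open import Relation.Nullary using (¬_; Dec; does; yes; no)
open import Relation.Nullary.Decidable using (¬?; decidable-stable)
open import Relation.Nullary.Decidable.Core using (dec⇒maybe)
open import Relation.Nullary.Negation using (contradiction)

-- The eigenvalues are given only as the roots in a factorisation of det (x I - 𝓛), so the
-- eigenbasis has to be extracted from that factorisation. A root p makes the pencil singular, a
-- kernel vector is split off, and the determinant of the complementary pencil must factor over the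
-- remaining roots. Dividing out x - p settles every x other than p; the value at p itself comes
-- from continuity, proved by quadratic estimates that are stable under sums and products.
--
-- For the passage times only the convergence of the series Σ (t + 1) Pr is given, not that the walk
-- reaches i almost surely. The recursion for the partial sums expresses the probability of reaching
-- i as m - Q m, where Q forbids steps into i; its defect from 1 is harmonic off i and therefore
-- zero.
--
-- The equation for L h determines h only up to a constant, which is the component of h along the
-- eigenvector of eigenvalue 0. Taking h s - h i with h i = 0 removes that component. With 0⁻¹ = 0
-- the sum of reciprocals may then run over all n indices.

module Development (ℛ : RealNumbers) where
  open OverReals ℛ public
  open Graph using (adj; Connected)

  -- Order reasoning and a ring solver with integer coefficients

  decTotalOrder : DecTotalOrder _ _ _
  decTotalOrder = record { isDecTotalOrder = isDecTotalOrder }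

  open import Relation.Binary.Reasoning.PartialOrder (DecTotalOrder.poset decTotalOrder) public hiding (start)
  open import Algebra.Properties.Ring ring public
    using (-‿distribˡ-*; -‿distribʳ-*; -‿involutive; -1*x≈-x; -0#≈0#; -‿+-comm)
  open import Algebra.Properties.CommutativeMonoid.Sum +-commutativeMonoid public
    using (sum-cong-≋; ∑-distrib-+; ∑-comm; sum-remove; sum-replicate-zero)
  open import Algebra.Properties.Semiring.Sum semiring public
    using (*-distribˡ-sum; *-distribʳ-sum)

  -- fromNat 1 is 1# on the nose, so that the constants of solver goals match.
  fromNat : ℕ → ℝ
  fromNat zero          = 0#
  fromNat (suc zero)    = 1#
  fromNat (suc (suc n)) = 1# + fromNat (suc n)

  fromNat-suc : ∀ n → fromNat (suc n) ≈ 1# + fromNat n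
  fromNat-suc zero    = ≈-sym (+-identityʳ 1#)
  fromNat-suc (suc n) = ≈-refl

  fromNat-+ : ∀ m n → fromNat (m ℕ.+ n) ≈ fromNat m + fromNat n
  fromNat-+ zero    n = ≈-sym (+-identityˡ _)
  fromNat-+ (suc m) n = begin-equality
    fromNat (suc (m ℕ.+ n))        ≈⟨ fromNat-suc (m ℕ.+ n) ⟩
    1# + fromNat (m ℕ.+ n)         ≈⟨ +-congˡ (fromNat-+ m n) ⟩
    1# + (fromNat m + fromNat n)   ≈⟨ +-assoc _ _ _ ⟨
    1# + fromNat m + fromNat n     ≈⟨ +-congʳ (fromNat-suc m) ⟨
    fromNat (suc m) + fromNat n    ∎

  fromNat-* : ∀ m n → fromNat (m ℕ.* n) ≈ fromNat m * fromNat n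
  fromNat-* zero    n = ≈-sym (zeroˡ _)
  fromNat-* (suc m) n = begin-equality
    fromNat (n ℕ.+ m ℕ.* n)                  ≈⟨ fromNat-+ n (m ℕ.* n) ⟩
    fromNat n + fromNat (m ℕ.* n)            ≈⟨ +-cong (≈-sym (*-identityˡ _)) (fromNat-* m n) ⟩
    1# * fromNat n + fromNat m * fromNat n   ≈⟨ distribʳ _ _ _ ⟨
    (1# + fromNat m) * fromNat n             ≈⟨ *-congʳ (fromNat-suc m) ⟨
    fromNat (suc m) * fromNat n              ∎

  fromInt : ℤ.ℤ → ℝ
  fromInt (ℤ.+ n)    = fromNat n
  fromInt ℤ.-[1+ n ] = - fromNat (suc n)

  x+y-[x+z] : ∀ x y z → (x + y) - (x + z) ≈ y - z
  x+y-[x+z] x y z = begin-equality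
    (x + y) + - (x + z)      ≈⟨ +-congˡ (≈-sym (-‿+-comm x z)) ⟩
    (x + y) + (- x + - z)    ≈⟨ +-assoc _ _ _ ⟩
    x + (y + (- x + - z))    ≈⟨ +-congˡ (≈-sym (+-assoc _ _ _)) ⟩
    x + (y + - x + - z)      ≈⟨ +-congˡ (+-congʳ (+-comm _ _)) ⟩
    x + (- x + y + - z)      ≈⟨ +-congˡ (+-assoc _ _ _) ⟩
    x + (- x + (y + - z))    ≈⟨ +-assoc _ _ _ ⟨
    (x + - x) + (y + - z)    ≈⟨ +-congʳ (-‿inverseʳ x) ⟩
    0# + (y + - z)           ≈⟨ +-identityˡ _ ⟩
    y - z                    ∎

  fromInt-⊖ : ∀ m n → fromInt (m ℤ.⊖ n) ≈ fromNat m - fromNat n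
  fromInt-⊖ m zero = ≈-sym (≈-trans (+-congˡ -0#≈0#) (+-identityʳ _))
  fromInt-⊖ zero (suc n) = ≈-sym (+-identityˡ _)
  fromInt-⊖ (suc m) (suc n) = begin-equality
    fromInt (suc m ℤ.⊖ suc n)               ≈⟨ ≈-reflexive (≡.cong fromInt (ℤ.[1+m]⊖[1+n]≡m⊖n m n)) ⟩
    fromInt (m ℤ.⊖ n)                       ≈⟨ fromInt-⊖ m n ⟩
    fromNat m - fromNat n                   ≈⟨ x+y-[x+z] 1# _ _ ⟨
    (1# + fromNat m) - (1# + fromNat n)     ≈⟨ +-cong (fromNat-suc m) (-‿cong (fromNat-suc n)) ⟨
    fromNat (suc m) - fromNat (suc n)       ∎

  fromInt-+ : ∀ i j → fromInt (i ℤ.+ j) ≈ fromInt i + fromInt j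
  fromInt-+ (ℤ.+ m)    (ℤ.+ n)    = fromNat-+ m n
  fromInt-+ (ℤ.+ m)    ℤ.-[1+ n ] = fromInt-⊖ m (suc n)
  fromInt-+ ℤ.-[1+ m ] (ℤ.+ n)    = ≈-trans (fromInt-⊖ n (suc m)) (+-comm _ _)
  fromInt-+ ℤ.-[1+ m ] ℤ.-[1+ n ] = ≈-trans
    (-‿cong (≈-trans (≈-trans (fromNat-suc (suc m ℕ.+ n)) (≈-trans (+-congˡ (fromNat-+ (suc m) n)) (≈-trans (≈-sym (+-assoc _ _ _)) (≈-trans (+-congʳ (+-comm _ _)) (+-assoc _ _ _))))) (+-congˡ (≈-sym (fromNat-suc n)))))
    (≈-sym (-‿+-comm _ _))

  fromInt-neg : ∀ i → fromInt (ℤ.- i) ≈ - fromInt i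
  fromInt-neg (ℤ.+ zero)  = ≈-sym -0#≈0#
  fromInt-neg (ℤ.+ suc n) = ≈-refl
  fromInt-neg ℤ.-[1+ n ]  = ≈-sym (-‿involutive _)

  fromInt-* : ∀ i j → fromInt (i ℤ.* j) ≈ fromInt i * fromInt j
  fromInt-* (ℤ.+ m) (ℤ.+ n) =
    ≈-trans (≈-reflexive (≡.cong fromInt (≡.sym (ℤ.pos-* m n)))) (fromNat-* m n)
  fromInt-* (ℤ.+ m) ℤ.-[1+ n ] = begin-equality
    fromInt (ℤ.+ m ℤ.* ℤ.-[1+ n ])           ≈⟨ ≈-reflexive (≡.cong fromInt (≡.sym (ℤ.neg-distribʳ-* (ℤ.+ m) (ℤ.+ suc n)))) ⟩
    fromInt (ℤ.- (ℤ.+ m ℤ.* ℤ.+ suc n))      ≈⟨ fromInt-neg (ℤ.+ m ℤ.* ℤ.+ suc n) ⟩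
    - fromInt (ℤ.+ m ℤ.* ℤ.+ suc n)          ≈⟨ -‿cong (fromInt-* (ℤ.+ m) (ℤ.+ suc n)) ⟩
    - (fromNat m * fromNat (suc n))          ≈⟨ -‿distribʳ-* _ _ ⟩
    fromNat m * - fromNat (suc n)            ∎
  fromInt-* ℤ.-[1+ m ] (ℤ.+ n) = begin-equality
    fromInt (ℤ.-[1+ m ] ℤ.* ℤ.+ n)           ≈⟨ ≈-reflexive (≡.cong fromInt (≡.sym (ℤ.neg-distribˡ-* (ℤ.+ suc m) (ℤ.+ n)))) ⟩
    fromInt (ℤ.- (ℤ.+ suc m ℤ.* ℤ.+ n))      ≈⟨ fromInt-neg (ℤ.+ suc m ℤ.* ℤ.+ n) ⟩
    - fromInt (ℤ.+ suc m ℤ.* ℤ.+ n)          ≈⟨ -‿cong (fromInt-* (ℤ.+ suc m) (ℤ.+ n)) ⟩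
    - (fromNat (suc m) * fromNat n)          ≈⟨ -‿distribˡ-* _ _ ⟩
    - fromNat (suc m) * fromNat n            ∎
  fromInt-* ℤ.-[1+ m ] ℤ.-[1+ n ] = begin-equality
    fromNat (suc m ℕ.* suc n)                ≈⟨ fromNat-* (suc m) (suc n) ⟩
    fromNat (suc m) * fromNat (suc n)        ≈⟨ -‿involutive _ ⟨
    - - (fromNat (suc m) * fromNat (suc n))  ≈⟨ -‿cong (-‿distribʳ-* _ _) ⟩
    - (fromNat (suc m) * - fromNat (suc n))  ≈⟨ -‿distribˡ-* _ _ ⟩
    - fromNat (suc m) * - fromNat (suc n)    ∎

  private
    almostCommutativeRing = ACR.fromCommutativeRing commutativeRing

    -- The coefficients of the solver are integers because their equality test computes during
    -- normalisation, whereas that of the abstract field ℝ is stuck.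
    ℤ-rawRing : RawRing 0ℓ 0ℓ
    ℤ-rawRing = record
      { _≈_ = _≡_ ; _+_ = ℤ._+_ ; _*_ = ℤ._*_ ; -_ = ℤ.-_ ; 0# = ℤ.0ℤ ; 1# = ℤ.1ℤ }

    fromInt-morphism : ℤ-rawRing ACR.-Raw-AlmostCommutative⟶ almostCommutativeRing
    fromInt-morphism = record
      { ⟦_⟧ = fromInt ; +-homo = fromInt-+ ; *-homo = fromInt-* ; -‿homo = fromInt-neg
      ; 0-homo = ≈-refl ; 1-homo = ≈-refl }

    fromInt-≟ : ∀ i j → Maybe.Maybe (fromInt i ≈ fromInt j)
    fromInt-≟ i j = Maybe.map (λ i≡j → ≈-reflexive (≡.cong fromInt i≡j)) (dec⇒maybe (i ℤ.≟ j))

  open RingSolver ℤ-rawRing almostCommutativeRing fromInt-morphism fromInt-≟ public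
    using (solve; con; _:+_; _:*_; _:-_; :-_; _:=_; Polynomial)

  :1 : ∀ {n} → Polynomial n
  :1 = con (ℤ.+ 1)

  :0 : ∀ {n} → Polynomial n
  :0 = con (ℤ.+ 0)

  -- Ordered fields

  +-mono-≤ : ∀ {w x y z} → w ≤ x → y ≤ z → w + y ≤ x + z
  +-mono-≤ w≤x y≤z = ≤-trans (+-monoˡ-≤ w≤x) (+-monoʳ-≤ _ y≤z)

  +-nonneg : ∀ {x y} → 0# ≤ x → 0# ≤ y → 0# ≤ x + y
  +-nonneg 0≤x 0≤y = ≤-respˡ-≈ (+-identityˡ 0#) (+-mono-≤ 0≤x 0≤y)

  *-monoʳ-≤ : ∀ {x y z} → 0# ≤ x → y ≤ z → x * y ≤ x * z
  *-monoʳ-≤ 0≤x y≤z = ≤-respˡ-≈ (*-comm _ _) (≤-respʳ-≈ (*-comm _ _) (*-monoˡ-≤ 0≤x y≤z))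

  *-mono-≤ : ∀ {w x y z} → 0# ≤ x → 0# ≤ y → w ≤ x → y ≤ z → w * y ≤ x * z
  *-mono-≤ 0≤x 0≤y w≤x y≤z = ≤-trans (*-monoˡ-≤ 0≤y w≤x) (*-monoʳ-≤ 0≤x y≤z)

  nonneg-diff : ∀ {x y} d → 0# ≤ d → y - x ≈ d → x ≤ y
  nonneg-diff d 0≤d y-x≈d = 0≤y-x⇒x≤y (≤-respʳ-≈ (≈-sym y-x≈d) 0≤d)

  neg-nonneg : ∀ {x} → x ≤ 0# → 0# ≤ - x
  neg-nonneg {x} x≤0 = ≤-respʳ-≈ (+-identityˡ (- x)) (x≤y⇒0≤y-x x≤0)

  square-nonneg : ∀ x → 0# ≤ x * x
  square-nonneg x with total 0# x
  ... | inj₁ 0≤x = *-nonneg 0≤x 0≤x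
  ... | inj₂ x≤0 = ≤-respʳ-≈ (solve 1 (λ x → :- x :* :- x := x :* x) ≈-refl x)
                     (*-nonneg (neg-nonneg x≤0) (neg-nonneg x≤0))

  1≉0 : ¬ 1# ≈ 0#
  1≉0 1≈0 = 0≉1 (≈-sym 1≈0)

  *-inverseʳ : ∀ {x} → ¬ x ≈ 0# → x * x ⁻¹ ≈ 1#
  *-inverseʳ {x} x≉0 with x ≈? 0#
  ... | yes x≈0 = contradiction x≈0 x≉0
  ... | no  x≉0′ = proj₂ (inverse x x≉0′)

  ⁻¹-zero : ∀ {x} → x ≈ 0# → x ⁻¹ ≈ 0#
  ⁻¹-zero {x} x≈0 with x ≈? 0#
  ... | yes _   = ≈-refl
  ... | no  x≉0 = contradiction x≈0 x≉0

  *-cancelˡ : ∀ {x y z} → ¬ x ≈ 0# → x * y ≈ x * z → y ≈ z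
  *-cancelˡ {x} {y} {z} x≉0 xy≈xz = begin-equality
    y                ≈⟨ unit y ⟨
    x ⁻¹ * (x * y)   ≈⟨ *-congˡ xy≈xz ⟩
    x ⁻¹ * (x * z)   ≈⟨ unit z ⟩
    z                ∎
    where
    unit : ∀ w → x ⁻¹ * (x * w) ≈ w
    unit w = begin-equality
      x ⁻¹ * (x * w)   ≈⟨ solve 3 (λ i x w → i :* (x :* w) := x :* i :* w) ≈-refl (x ⁻¹) x w ⟩
      x * x ⁻¹ * w     ≈⟨ *-congʳ (*-inverseʳ x≉0) ⟩
      1# * w           ≈⟨ *-identityˡ w ⟩
      w                ∎

  product-zero : ∀ {x y} → x * y ≈ 0# → ¬ x ≈ 0# → y ≈ 0#
  product-zero xy≈0 x≉0 = *-cancelˡ x≉0 (≈-trans xy≈0 (≈-sym (zeroʳ _)))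

  *-nonzero : ∀ {x y} → ¬ x ≈ 0# → ¬ y ≈ 0# → ¬ x * y ≈ 0#
  *-nonzero x≉0 y≉0 xy≈0 = y≉0 (product-zero xy≈0 x≉0)

  square-zero : ∀ {x} → x * x ≈ 0# → x ≈ 0#
  square-zero {x} xx≈0 with x ≈? 0#
  ... | yes x≈0 = x≈0
  ... | no  x≉0 = product-zero xx≈0 x≉0

  pos⇒≉0 : ∀ {x} → 0# < x → ¬ x ≈ 0#
  pos⇒≉0 (_ , 0≉x) x≈0 = 0≉x (≈-sym x≈0)

  ≉0⇒pos : ∀ {x} → 0# ≤ x → ¬ x ≈ 0# → 0# < x
  ≉0⇒pos 0≤x x≉0 = 0≤x , λ 0≈x → x≉0 (≈-sym 0≈x)

  ≤0⇒≈0 : ∀ {x} → 0# ≤ x → x ≤ 0# → x ≈ 0#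
  ≤0⇒≈0 0≤x x≤0 = antisym x≤0 0≤x

  pos-≤-trans : ∀ {x y} → 0# < x → x ≤ y → 0# < y
  pos-≤-trans 0<x x≤y = ≉0⇒pos (≤-trans (proj₁ 0<x) x≤y)
    λ y≈0 → pos⇒≉0 0<x (≤0⇒≈0 (proj₁ 0<x) (≤-respʳ-≈ y≈0 x≤y))

  0<1 : 0# < 1#
  0<1 = 0≤1 , 0≉1

  *-pos : ∀ {x y} → 0# < x → 0# < y → 0# < x * y
  *-pos 0<x 0<y = ≉0⇒pos (*-nonneg (proj₁ 0<x) (proj₁ 0<y)) (*-nonzero (pos⇒≉0 0<x) (pos⇒≉0 0<y))

  +-pos : ∀ {x y} → 0# < x → 0# ≤ y → 0# < x + y
  +-pos {x} 0<x 0≤y = pos-≤-trans 0<x (≤-respˡ-≈ (+-identityʳ x) (+-monoʳ-≤ x 0≤y))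

  ⁻¹-pos : ∀ {x} → 0# < x → 0# < x ⁻¹
  ⁻¹-pos {x} 0<x = ≉0⇒pos
    (≤-respʳ-≈ x⁻²x≈x⁻¹ (*-nonneg (square-nonneg (x ⁻¹)) (proj₁ 0<x)))
    λ x⁻¹≈0 → 0≉1 (≈-trans (≈-sym (zeroʳ x)) (≈-trans (*-congˡ (≈-sym x⁻¹≈0)) (*-inverseʳ x≉0)))
    where
    x≉0 = pos⇒≉0 0<x
    x⁻²x≈x⁻¹ : x ⁻¹ * x ⁻¹ * x ≈ x ⁻¹
    x⁻²x≈x⁻¹ = begin-equality
      x ⁻¹ * x ⁻¹ * x     ≈⟨ solve 2 (λ i x → i :* i :* x := i :* (x :* i)) ≈-refl (x ⁻¹) x ⟩
      x ⁻¹ * (x * x ⁻¹)   ≈⟨ *-congˡ (*-inverseʳ x≉0) ⟩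
      x ⁻¹ * 1#           ≈⟨ *-identityʳ _ ⟩
      x ⁻¹                ∎

  *-cancelˡ-≤ : ∀ {x y z} → 0# < x → x * y ≤ x * z → y ≤ z
  *-cancelˡ-≤ {x} {y} {z} 0<x xy≤xz = ≤-respˡ-≈ (unit y) (≤-respʳ-≈ (unit z) (*-monoʳ-≤ (proj₁ (⁻¹-pos 0<x)) xy≤xz))
    where
    unit : ∀ w → x ⁻¹ * (x * w) ≈ w
    unit w = *-cancelˡ (pos⇒≉0 0<x) (begin-equality
      x * (x ⁻¹ * (x * w))   ≈⟨ solve 3 (λ i x w → x :* (i :* (x :* w)) := x :* i :* (x :* w)) ≈-refl (x ⁻¹) x w ⟩
      x * x ⁻¹ * (x * w)     ≈⟨ *-congʳ (*-inverseʳ (pos⇒≉0 0<x)) ⟩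
      1# * (x * w)           ≈⟨ *-identityˡ _ ⟩
      x * w                  ∎)

  ⁻¹-antitone : ∀ {x y} → 0# < x → x ≤ y → y ⁻¹ ≤ x ⁻¹
  ⁻¹-antitone {x} {y} 0<x x≤y = *-cancelˡ-≤ 0<x (≤-respʳ-≈ (≈-sym (*-inverseʳ (pos⇒≉0 0<x)))
    (≤-respʳ-≈ (*-inverseʳ (pos⇒≉0 0<y)) (*-monoˡ-≤ (proj₁ (⁻¹-pos 0<y)) x≤y)))
    where
    0<y = pos-≤-trans 0<x x≤y

  -- Square roots

  square-mono⁻¹ : ∀ {x y} → 0# ≤ y → x * x ≤ y * y → x ≤ y
  square-mono⁻¹ {x} {y} 0≤y xx≤yy with total x y
  ... | inj₁ x≤y = x≤y
  ... | inj₂ y≤x with x ≈? 0#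
  ...   | yes x≈0 = ≤-respˡ-≈ (≈-sym x≈0) 0≤y
  ...   | no  x≉0 = *-cancelˡ-≤ (≉0⇒pos (≤-trans 0≤y y≤x) x≉0) (≤-trans xx≤yy (*-monoˡ-≤ 0≤y y≤x))

  -- With d = a - s², the choice δ = d / (1 + 2 s + d) gives δ ≤ 1 and a - (s + δ)² = δ ((1 - δ) +
  -- d), which is nonnegative. So an s with s² < a is no upper bound in the definition of `√`.
  square-increase : ∀ {s a} → 0# ≤ s → s * s ≤ a → ¬ s * s ≈ a →
                    ∃ λ δ → (0# < δ) × ((s + δ) * (s + δ) ≤ a)
  square-increase {s} {a} 0≤s ss≤a ss≉a = δ , 0<δ ,
    nonneg-diff (δ * ((1# - δ) + d)) (*-nonneg (proj₁ 0<δ) (+-nonneg (x≤y⇒0≤y-x δ≤1) (proj₁ 0<d))) (begin-equality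
      a - (s + δ) * (s + δ)         ≈⟨ solve 3 (λ a s δ → a :- (s :+ δ) :* (s :+ δ) := (a :- s :* s) :- δ :* (s :+ s :+ δ)) ≈-refl a s δ ⟩
      d - δ * (s + s + δ)           ≈⟨ +-congʳ wδ≈d ⟨
      w * δ - δ * (s + s + δ)       ≈⟨ solve 3 (λ d s δ → (:1 :+ (s :+ s :+ d)) :* δ :- δ :* (s :+ s :+ δ) := δ :* ((:1 :- δ) :+ d)) ≈-refl d s δ ⟩
      δ * ((1# - δ) + d)            ∎)
    where
    d w δ : ℝ
    d = a - s * s
    w = 1# + (s + s + d)
    δ = d * w ⁻¹
    0<d : 0# < d
    0<d = ≉0⇒pos (x≤y⇒0≤y-x ss≤a) λ d≈0 → ss≉a (begin-equality
      s * s       ≈⟨ +-identityˡ _ ⟨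
      0# + s * s  ≈⟨ +-congʳ d≈0 ⟨
      d + s * s   ≈⟨ solve 2 (λ a x → (a :- x) :+ x := a) ≈-refl a (s * s) ⟩
      a           ∎)
    0<w : 0# < w
    0<w = +-pos 0<1 (+-nonneg (+-nonneg 0≤s 0≤s) (proj₁ 0<d))
    0<δ : 0# < δ
    0<δ = *-pos 0<d (⁻¹-pos 0<w)
    wδ≈d : w * δ ≈ d
    wδ≈d = begin-equality
      w * (d * w ⁻¹)   ≈⟨ solve 3 (λ w d i → w :* (d :* i) := w :* i :* d) ≈-refl w d (w ⁻¹) ⟩
      w * w ⁻¹ * d     ≈⟨ *-congʳ (*-inverseʳ (pos⇒≉0 0<w)) ⟩
      1# * d           ≈⟨ *-identityˡ d ⟩
      d                ∎
    δ≤1 : δ ≤ 1#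
    δ≤1 = *-cancelˡ-≤ 0<w (≤-respˡ-≈ (≈-sym wδ≈d) (≤-respʳ-≈ (≈-sym (*-identityʳ w))
      (nonneg-diff (1# + (s + s)) (+-nonneg 0≤1 (+-nonneg 0≤s 0≤s))
        (solve 2 (λ t d → (:1 :+ (t :+ d)) :- d := :1 :+ t) ≈-refl (s + s) d))))

  -- One Newton step for x² = a: with δ = (s² - a) / (2 s) the square of s - δ exceeds a by exactly
  -- δ², so s - δ is a smaller upper bound.
  square-decrease : ∀ {s a} → 0# ≤ a → 0# ≤ s → a ≤ s * s → ¬ s * s ≈ a →
                    ∃ λ δ → (0# < δ) × (0# ≤ s - δ) × (a ≤ (s - δ) * (s - δ))
  square-decrease {s} {a} 0≤a 0≤s a≤ss ss≉a = δ , 0<δ , 0≤s-δ ,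
    nonneg-diff (δ * δ) (square-nonneg δ) (begin-equality
      (s - δ) * (s - δ) - a         ≈⟨ solve 3 (λ a s δ → (s :- δ) :* (s :- δ) :- a := (s :* s :- a) :- (s :+ s) :* δ :+ δ :* δ) ≈-refl a s δ ⟩
      e - (s + s) * δ + δ * δ       ≈⟨ +-congʳ (+-congˡ (-‿cong 2sδ≈e)) ⟩
      e - e + δ * δ                 ≈⟨ solve 2 (λ e x → e :- e :+ x := x) ≈-refl e (δ * δ) ⟩
      δ * δ                         ∎)
    where
    e δ : ℝ
    e = s * s - a
    δ = e * (s + s) ⁻¹
    0<e : 0# < e
    0<e = ≉0⇒pos (x≤y⇒0≤y-x a≤ss) λ e≈0 → ss≉a (begin-equality
      s * s   ≈⟨ solve 2 (λ a x → x := (x :- a) :+ a) ≈-refl a (s * s) ⟩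
      e + a   ≈⟨ +-congʳ e≈0 ⟩
      0# + a  ≈⟨ +-identityˡ a ⟩
      a       ∎)
    0<s : 0# < s
    0<s = ≉0⇒pos 0≤s λ s≈0 → ss≉a (antisym
      (≤-respˡ-≈ (≈-sym (≈-trans (*-congʳ s≈0) (zeroˡ s))) 0≤a) a≤ss)
    0<2s : 0# < s + s
    0<2s = +-pos 0<s 0≤s
    0<δ : 0# < δ
    0<δ = *-pos 0<e (⁻¹-pos 0<2s)
    2sδ≈e : (s + s) * δ ≈ e
    2sδ≈e = begin-equality
      (s + s) * (e * (s + s) ⁻¹)   ≈⟨ solve 3 (λ w d i → w :* (d :* i) := w :* i :* d) ≈-refl (s + s) e ((s + s) ⁻¹) ⟩
      (s + s) * (s + s) ⁻¹ * e     ≈⟨ *-congʳ (*-inverseʳ (pos⇒≉0 0<2s)) ⟩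
      1# * e                       ≈⟨ *-identityˡ e ⟩
      e                            ∎
    0≤s-δ : 0# ≤ s - δ
    0≤s-δ = *-cancelˡ-≤ 0<2s (≤-respˡ-≈ (≈-sym (zeroʳ _)) (≤-respʳ-≈ (≈-sym 2s[s-δ]) (+-nonneg (square-nonneg s) 0≤a)))
      where
      2s[s-δ] : (s + s) * (s - δ) ≈ s * s + a
      2s[s-δ] = begin-equality
        (s + s) * (s - δ)           ≈⟨ solve 2 (λ s δ → (s :+ s) :* (s :- δ) := s :* s :+ s :* s :- (s :+ s) :* δ) ≈-refl s δ ⟩
        s * s + s * s - (s + s) * δ ≈⟨ +-congˡ (-‿cong 2sδ≈e) ⟩
        s * s + s * s - e           ≈⟨ solve 2 (λ x a → x :+ x :- (x :- a) := x :+ a) ≈-refl (s * s) a ⟩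
        s * s + a                   ∎

  x+δ≰x : ∀ {x δ} → 0# < δ → ¬ x + δ ≤ x
  x+δ≰x {x} {δ} 0<δ x+δ≤x = pos⇒≉0 0<δ (≤0⇒≈0 (proj₁ 0<δ)
    (≤-respˡ-≈ (solve 2 (λ x δ → :- x :+ (x :+ δ) := δ) ≈-refl x δ) (≤-respʳ-≈ (-‿inverseˡ x) (+-monoʳ-≤ (- x) x+δ≤x))))

  √-square : ∀ {a} → 0# ≤ a → √ a * √ a ≈ a
  √-square {a} 0≤a with 0# ≤? a
  ... | no 0≰a = contradiction 0≤a 0≰a
  ... | yes 0≤a′ = square (supremum _ _ _)
    where
    square : ((s , _) : ∃ (LeastUpperBound (λ x → x * x ≤ a))) → s * s ≈ a
    square (s , upper , least) with s * s ≈? a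
    ... | yes ss≈a = ss≈a
    ... | no  ss≉a = case (total (s * s) a)
      where
      0≤s : 0# ≤ s
      0≤s = upper 0# (≤-respˡ-≈ (≈-sym (zeroˡ 0#)) 0≤a)
      case : s * s ≤ a ⊎ a ≤ s * s → s * s ≈ a
      case (inj₁ ss≤a) = let δ , 0<δ , p = square-increase 0≤s ss≤a ss≉a in
        contradiction (upper (s + δ) p) (x+δ≰x 0<δ)
      case (inj₂ a≤ss) = let δ , 0<δ , 0≤u , p = square-decrease 0≤a 0≤s a≤ss ss≉a in
        contradiction (≤-respˡ-≈ (solve 2 (λ s δ → s := (s :- δ) :+ δ) ≈-refl s δ)
          (least (s - δ) λ x xx≤a → square-mono⁻¹ 0≤u (≤-trans xx≤a p)))
          (x+δ≰x 0<δ)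

  -- If x were positive, δ = x / (1 + M + x) would give x ≤ M δ² ≤ M δ = M x / (1 + M + x) < x.
  vanishing : ∀ {x M} → 0# ≤ x → 0# ≤ M → (∀ δ → 0# < δ → δ ≤ 1# → x ≤ M * (δ * δ)) → x ≈ 0#
  vanishing {x} {M} 0≤x 0≤M bound with x ≈? 0#
  ... | yes x≈0 = x≈0
  ... | no  x≉0 = contradiction (≤-respʳ-≈ Mwδ≈Mx
                    (*-monoʳ-≤ (proj₁ 0<w) (≤-trans (bound δ 0<δ δ≤1) (*-monoʳ-≤ 0≤M (≤-respʳ-≈ (*-identityʳ δ) (*-monoʳ-≤ (proj₁ 0<δ) δ≤1))))))
                    (λ wx≤Mx → x+δ≰x {M * x} (+-pos 0<x (square-nonneg x)) (≤-respˡ-≈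
                      (solve 2 (λ M x → (:1 :+ (M :+ x)) :* x := M :* x :+ (x :+ x :* x)) ≈-refl M x) wx≤Mx))
    where
    w δ : ℝ
    w = 1# + (M + x)
    δ = x * w ⁻¹
    0<x : 0# < x
    0<x = ≉0⇒pos 0≤x x≉0
    0<w : 0# < w
    0<w = +-pos 0<1 (+-nonneg 0≤M 0≤x)
    0<δ : 0# < δ
    0<δ = *-pos 0<x (⁻¹-pos 0<w)
    wδ≈x : w * δ ≈ x
    wδ≈x = begin-equality
      w * (x * w ⁻¹)   ≈⟨ solve 3 (λ w d i → w :* (d :* i) := w :* i :* d) ≈-refl w x (w ⁻¹) ⟩
      w * w ⁻¹ * x     ≈⟨ *-congʳ (*-inverseʳ (pos⇒≉0 0<w)) ⟩
      1# * x           ≈⟨ *-identityˡ x ⟩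
      x                ∎
    δ≤1 : δ ≤ 1#
    δ≤1 = *-cancelˡ-≤ 0<w (≤-respˡ-≈ (≈-sym wδ≈x) (≤-respʳ-≈ (≈-sym (*-identityʳ w))
      (nonneg-diff (1# + M) (+-nonneg 0≤1 0≤M)
        (solve 2 (λ M x → (:1 :+ (M :+ x)) :- x := :1 :+ M) ≈-refl M x))))
    Mwδ≈Mx : w * (M * δ) ≈ M * x
    Mwδ≈Mx = ≈-trans (solve 3 (λ w M δ → w :* (M :* δ) := M :* (w :* δ)) ≈-refl w M δ) (*-congˡ wδ≈x)

  -- Finite sums

  sum-cong : ∀ {n} {f g : Vector ℝ n} → (∀ i → f i ≈ g i) → sum f ≈ sum g
  sum-cong = sum-cong-≋

  sum-zero : ∀ {n} {f : Vector ℝ n} → (∀ i → f i ≈ 0#) → sum f ≈ 0#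
  sum-zero {n} f≈0 = ≈-trans (sum-cong f≈0) (sum-replicate-zero n)

  sum-mono : ∀ {n} {f g : Vector ℝ n} → (∀ i → f i ≤ g i) → sum f ≤ sum g
  sum-mono {zero}  f≤g = ≤-refl
  sum-mono {suc n} f≤g = +-mono-≤ (f≤g zero) (sum-mono (f≤g ∘ suc))

  sum-nonneg : ∀ {n} {f : Vector ℝ n} → (∀ i → 0# ≤ f i) → 0# ≤ sum f
  sum-nonneg {n} 0≤f = ≤-respˡ-≈ (sum-replicate-zero n) (sum-mono 0≤f)

  +-zero-nonneg : ∀ {x y} → 0# ≤ x → 0# ≤ y → x + y ≈ 0# → x ≈ 0#
  +-zero-nonneg {x} 0≤x 0≤y x+y≈0 = ≤0⇒≈0 0≤x (≤-respʳ-≈ x+y≈0 (≤-respˡ-≈ (+-identityʳ x) (+-monoʳ-≤ x 0≤y)))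

  sum-nonneg-zero : ∀ {n} {f : Vector ℝ n} → (∀ i → 0# ≤ f i) → sum f ≈ 0# → ∀ i → f i ≈ 0#
  sum-nonneg-zero 0≤f Σf≈0 zero    = +-zero-nonneg (0≤f zero) (sum-nonneg (0≤f ∘ suc)) Σf≈0
  sum-nonneg-zero 0≤f Σf≈0 (suc i) = sum-nonneg-zero (0≤f ∘ suc)
    (+-zero-nonneg (sum-nonneg (0≤f ∘ suc)) (0≤f zero) (≈-trans (+-comm _ _) Σf≈0)) i

  sum-*ˡ : ∀ {n} x (f : Vector ℝ n) → sum (λ i → x * f i) ≈ x * sum f
  sum-*ˡ x f = ≈-sym (*-distribˡ-sum x f)

  sum-*ʳ : ∀ {n} x (f : Vector ℝ n) → sum (λ i → f i * x) ≈ sum f * x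
  sum-*ʳ x f = ≈-sym (*-distribʳ-sum x f)

  sum-neg : ∀ {n} (f : Vector ℝ n) → sum (λ i → - f i) ≈ - sum f
  sum-neg f = begin-equality
    sum (λ i → - f i)       ≈⟨ sum-cong (λ i → -1*x≈-x (f i)) ⟨
    sum (λ i → - 1# * f i)  ≈⟨ sum-*ˡ (- 1#) f ⟩
    - 1# * sum f            ≈⟨ -1*x≈-x (sum f) ⟩
    - sum f                 ∎

  sum-- : ∀ {n} (f g : Vector ℝ n) → sum (λ i → f i - g i) ≈ sum f - sum g
  sum-- f g = ≈-trans (∑-distrib-+ f (λ i → - g i)) (+-congˡ (sum-neg g))

  I-diag : ∀ {n} (i : Fin n) → I i i ≈ 1#
  I-diag i with i ≟ i
  ... | yes _   = ≈-refl
  ... | no  i≢i = contradiction ≡.refl i≢i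

  I-off : ∀ {n} {i j : Fin n} → ¬ i ≡ j → I i j ≈ 0#
  I-off {i = i} {j} i≢j with i ≟ j
  ... | yes i≡j = contradiction i≡j i≢j
  ... | no  _   = ≈-refl

  I-suc : ∀ {n} (i j : Fin n) → I (suc i) (suc j) ≈ I i j
  I-suc i j with i ≟ j
  ... | yes _ = ≈-refl
  ... | no  _ = ≈-refl

  I-sym : ∀ {n} (i j : Fin n) → I i j ≈ I j i
  I-sym i j with j ≟ i
  ... | yes ≡.refl = I-diag i
  ... | no  j≢i    = I-off (j≢i ∘ ≡.sym)

  sum-Iˡ : ∀ {n} (i : Fin n) (f : Vector ℝ n) → sum (λ j → I i j * f j) ≈ f i
  sum-Iˡ {suc n} zero f = begin-equality
    1# * f zero + sum (λ j → 0# * f (suc j))   ≈⟨ +-cong (*-identityˡ _) (sum-zero λ j → zeroˡ (f (suc j))) ⟩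
    f zero + 0#                                ≈⟨ +-identityʳ _ ⟩
    f zero                                     ∎
  sum-Iˡ {suc n} (suc i) f = begin-equality
    0# * f zero + sum (λ j → I (suc i) (suc j) * f (suc j))   ≈⟨ +-cong (zeroˡ _) (sum-cong λ j → *-congʳ (I-suc i j)) ⟩
    0# + sum (λ j → I i j * f (suc j))                        ≈⟨ +-identityˡ _ ⟩
    sum (λ j → I i j * f (suc j))                             ≈⟨ sum-Iˡ i (f ∘ suc) ⟩
    f (suc i)                                                 ∎

  sum-Iʳ : ∀ {n} (i : Fin n) (f : Vector ℝ n) → sum (λ j → f j * I j i) ≈ f i
  sum-Iʳ i f = ≈-trans (sum-cong λ j → ≈-trans (*-comm _ _) (*-congʳ (I-sym j i))) (sum-Iˡ i f)

  -- Linear systems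

  infix 4 _≐_

  _≐_ : ∀ {n} → Vector ℝ n → Vector ℝ n → Set
  f ≐ g = ∀ i → f i ≈ g i

  Nonzero : ∀ {n} → Vector ℝ n → Set
  Nonzero f = ∃ λ i → ¬ f i ≈ 0#

  dot : ∀ {n} → Vector ℝ n → Vector ℝ n → ℝ
  dot f g = sum λ i → f i * g i

  -- Gaussian elimination on the first column. Without a pivot the first unit vector is a solution;
  -- otherwise the pivot row removes one equation and one unknown.
  homogeneous-system : ∀ m (M : Fin m → Vector ℝ (suc m)) →
                       ∃ λ y → Nonzero y × (∀ i → dot (M i) y ≈ 0#)
  homogeneous-system zero    M = (λ _ → 1#) , (zero , 1≉0) , λ ()
  homogeneous-system (suc m) M with Fin.any? (λ i → ¬? (M i zero ≈? 0#))
  ... | no noPivot = I zero , (zero , 1≉0) , λ i → begin-equality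
    dot (M i) (I zero)   ≈⟨ sum-cong (λ j → *-comm (M i j) (I zero j)) ⟩
    dot (I zero) (M i)   ≈⟨ sum-Iˡ zero (M i) ⟩
    M i zero             ≈⟨ decidable-stable (M i zero ≈? 0#) (λ Mi0≉0 → noPivot (i , Mi0≉0)) ⟩
    0#                   ∎
  ... | yes (p , c≉0) = y , (suc (proj₁ y′≉0) , *-nonzero c≉0 (proj₂ y′≉0)) , solves
    where
    c : ℝ
    c = M p zero
    -- Rows are cross-multiplied instead of divided by the pivot. With `y` = (- s , c y′), row i of
    -- `M` evaluates to c (tail (M i) · y′) - (M i zero) s, which is the reduced row applied to y′
    -- and is 0 on the pivot row.
    reduced : Fin m → Vector ℝ (suc m)
    reduced i j = c * M (punchIn p i) (suc j) - M (punchIn p i) zero * M p (suc j)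
    solution = homogeneous-system m reduced
    y′ = proj₁ solution
    y′≉0 = proj₁ (proj₂ solution)
    s : ℝ
    s = dot (tail (M p)) y′
    y : Vector ℝ (suc (suc m))
    y = (- s) ∷ λ j → c * y′ j
    row : ∀ i → dot (M i) y ≈ c * dot (tail (M i)) y′ - M i zero * s
    row i = begin-equality
      M i zero * - s + dot (tail (M i)) (λ j → c * y′ j)
        ≈⟨ +-congˡ (sum-cong λ j → solve 3 (λ a c y → a :* (c :* y) := c :* (a :* y)) ≈-refl (M i (suc j)) c (y′ j)) ⟩
      M i zero * - s + sum (λ j → c * (M i (suc j) * y′ j))
        ≈⟨ +-congˡ (sum-*ˡ c (λ j → M i (suc j) * y′ j)) ⟩
      M i zero * - s + c * dot (tail (M i)) y′
        ≈⟨ solve 3 (λ a s x → a :* :- s :+ x := x :- a :* s) ≈-refl (M i zero) s (c * dot (tail (M i)) y′) ⟩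
      c * dot (tail (M i)) y′ - M i zero * s   ∎
    solves : ∀ i → dot (M i) y ≈ 0#
    solves i with p ≟ i
    ... | yes ≡.refl = ≈-trans (row p) (-‿inverseʳ _)
    ... | no  p≢i with punchOut p≢i | Fin.punchIn-punchOut p≢i
    ...   | k | ≡.refl = begin-equality
      dot (M i′) y                                    ≈⟨ row i′ ⟩
      c * dot (tail (M i′)) y′ - M i′ zero * s        ≈⟨ +-cong (sum-*ˡ c (λ j → M i′ (suc j) * y′ j)) (-‿cong (sum-*ˡ (M i′ zero) (λ j → M p (suc j) * y′ j))) ⟨
      sum (λ j → c * (M i′ (suc j) * y′ j)) - sum (λ j → M i′ zero * (M p (suc j) * y′ j))
        ≈⟨ sum-- (λ j → c * (M i′ (suc j) * y′ j)) (λ j → M i′ zero * (M p (suc j) * y′ j)) ⟨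
      sum (λ j → c * (M i′ (suc j) * y′ j) - M i′ zero * (M p (suc j) * y′ j))
        ≈⟨ sum-cong (λ j → solve 5 (λ c a b d y → c :* (a :* y) :- b :* (d :* y) := (c :* a :- b :* d) :* y) ≈-refl
             c (M i′ (suc j)) (M i′ zero) (M p (suc j)) (y′ j)) ⟩
      dot (reduced k) y′                              ≈⟨ proj₂ (proj₂ solution) k ⟩
      0#                                              ∎
      where i′ = punchIn p k

  -- Singular and invertible matrices

  infixl 7 _⊗_

  _⊗_ : ∀ {n} → Matrix n → Matrix n → Matrix n
  (M ⊗ N) i j = sum λ k → M i k * N k j

  Kernel : ∀ {n} → Matrix n → Set
  Kernel M = ∃ λ y → Nonzero y × (∀ i → dot (M i) y ≈ 0#)

  RightInverse : ∀ {n} → Matrix n → Set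
  RightInverse M = ∃ λ N → ∀ i j → (M ⊗ N) i j ≈ I i j

  private
    collect : ∀ {n} {A : Set} {B : Fin n → Set} → (∀ j → A ⊎ B j) → A ⊎ (∀ j → B j)
    collect {zero}  f = inj₂ λ ()
    collect {suc n} f with f zero | collect (f ∘ suc)
    ... | inj₁ a | _      = inj₁ a
    ... | inj₂ _ | inj₁ a = inj₁ a
    ... | inj₂ b | inj₂ g = inj₂ λ { zero → b ; (suc j) → g j }

  -- For each j, adjoin - e_j as an extra column and take a nonzero solution (t , y). If t = 0, then
  -- y is a kernel vector of `M`; otherwise y / t solves M x = e_j and serves as column j of the
  -- inverse.
  kernel-or-rightInverse : ∀ {n} (M : Matrix n) → Kernel M ⊎ RightInverse M
  kernel-or-rightInverse {n} M = Sum.map₂ (λ f → (λ k j → proj₁ (f j) k) , λ i j → proj₂ (f j) i) (collect column)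
    where
    column : ∀ j → Kernel M ⊎ ∃ λ x → ∀ i → dot (M i) x ≈ I i j
    column j with homogeneous-system n (λ i → (- I i j) ∷ M i)
    ... | y , y≉0 , solves with y zero ≈? 0#
    ...   | yes t≈0 = inj₁ (tail y , nonzero y≉0 , λ i → begin-equality
      dot (M i) (tail y)                       ≈⟨ +-identityˡ _ ⟨
      0# + dot (M i) (tail y)                  ≈⟨ +-congʳ (≈-trans (*-congˡ t≈0) (zeroʳ _)) ⟨
      - I i j * y zero + dot (M i) (tail y)    ≈⟨ solves i ⟩
      0#                                       ∎)
      where
      nonzero : Nonzero y → Nonzero (tail y)
      nonzero (zero  , t≉0) = contradiction t≈0 t≉0
      nonzero (suc k , yk≉0) = k , yk≉0
    ...   | no t≉0 = inj₂ ((λ k → y (suc k) * t ⁻¹) , λ i → begin-equality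
      sum (λ k → M i k * (y (suc k) * t ⁻¹))   ≈⟨ sum-cong (λ k → *-assoc (M i k) (y (suc k)) (t ⁻¹)) ⟨
      sum (λ k → M i k * y (suc k) * t ⁻¹)     ≈⟨ sum-*ʳ (t ⁻¹) (λ k → M i k * y (suc k)) ⟩
      dot (M i) (tail y) * t ⁻¹                ≈⟨ solve 4 (λ d e t u → d :* u := (:- e :* t :+ d) :* u :+ e :* (t :* u)) ≈-refl
                                                    (dot (M i) (tail y)) (I i j) t (t ⁻¹) ⟩
      (- I i j * t + dot (M i) (tail y)) * t ⁻¹ + I i j * (t * t ⁻¹)
                                               ≈⟨ +-cong (*-congʳ (solves i)) (*-congˡ (*-inverseʳ t≉0)) ⟩
      0# * t ⁻¹ + I i j * 1#                   ≈⟨ +-cong (zeroˡ _) (*-identityʳ _) ⟩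
      0# + I i j                               ≈⟨ +-identityˡ _ ⟩
      I i j                                    ∎)
      where t = y zero

  -- Determinants

  infix 4 _≋_

  _≋_ : ∀ {n} → Matrix n → Matrix n → Set
  M ≋ N = ∀ i → M i ≐ N i

  -- Matrices are functions compared entrywise, so linearity is stated for any `P` whose rows agree
  -- with the prescribed ones, and not for a syntactic row update.
  record Alternating {n} (D : Matrix n → ℝ) : Set where
    field
      cong        : ∀ {M N} → M ≋ N → D M ≈ D N
      linear      : ∀ i c {M N P} → P i ≐ (λ j → c * M i j + N i j) →
                    (∀ k → k ≢ i → M k ≐ P k) → (∀ k → k ≢ i → N k ≐ P k) →
                    D P ≈ c * D M + D N
      alternating : ∀ M {i k} → i ≢ k → M i ≐ M k → D M ≈ 0#

  infixl 6 _[_≔_]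

  _[_≔_] : ∀ {n} → Matrix n → Fin n → Vector ℝ n → Matrix n
  M [ i ≔ v ] = updateAt M i (λ _ → v)

  row-new : ∀ {n} (M : Matrix n) i v → (M [ i ≔ v ]) i ≐ v
  row-new M i v j = ≈-reflexive (≡.cong (λ f → f j) (updateAt-updates i M))

  row-old : ∀ {n} (M : Matrix n) i v k → k ≢ i → (M [ i ≔ v ]) k ≐ M k
  row-old M i v k k≢i j = ≈-reflexive (≡.cong (λ f → f j) (updateAt-minimal k i M k≢i))

  module AlternatingProperties {n} {D : Matrix n → ℝ} (alt : Alternating D) where
    open Alternating alt

    linear-update : ∀ M i c u v → D (M [ i ≔ (λ j → c * u j + v j) ]) ≈ c * D (M [ i ≔ u ]) + D (M [ i ≔ v ])
    linear-update M i c u v = linear i c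
      (λ j → ≈-trans (row-new M i _ j) (+-cong (*-congˡ (≈-sym (row-new M i u j))) (≈-sym (row-new M i v j))))
      (λ k k≢i j → ≈-trans (row-old M i _ k k≢i j) (≈-sym (row-old M i _ k k≢i j)))
      (λ k k≢i j → ≈-trans (row-old M i _ k k≢i j) (≈-sym (row-old M i _ k k≢i j)))

    zero-row : ∀ M i → M i ≐ (λ _ → 0#) → D M ≈ 0#
    zero-row M i Mi≐0 = begin-equality
      D M                ≈⟨ linear i (- 1#) {M} {M} {M} (λ j → begin-equality
                              M i j                   ≈⟨ Mi≐0 j ⟩
                              0#                      ≈⟨ solve 1 (λ x → :0 := :- :1 :* x :+ x) ≈-refl (M i j) ⟩
                              - 1# * M i j + M i j    ∎)
                            (λ _ _ _ → ≈-refl) (λ _ _ _ → ≈-refl) ⟩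
      - 1# * D M + D M   ≈⟨ solve 1 (λ x → :- :1 :* x :+ x := :0) ≈-refl (D M) ⟩
      0#                 ∎

    expand-row : ∀ M i {m} (c : Vector ℝ m) (v : Fin m → Vector ℝ n) →
                 D (M [ i ≔ (λ j → sum λ l → c l * v l j) ]) ≈ sum (λ l → c l * D (M [ i ≔ v l ]))
    expand-row M i {zero}  c v = zero-row _ i (row-new M i _)
    expand-row M i {suc m} c v = ≈-trans (linear-update M i (c zero) (v zero) _)
      (+-congˡ (expand-row M i (c ∘ suc) (v ∘ suc)))

    add-row : ∀ {M N i k} c → k ≢ i → M k ≐ (λ j → c * N i j + N k j) →
              (∀ l → l ≢ k → M l ≐ N l) → D M ≈ D N
    add-row {M} {N} {i} {k} c k≢i Mk Ml = begin-equality
      D M                              ≈⟨ linear k c {N [ k ≔ N i ]} {N} {M}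
                                            (λ j → ≈-trans (Mk j) (+-congʳ (*-congˡ (≈-sym (row-new N k _ j)))))
                                            (λ l l≢k j → ≈-trans (row-old N k _ l l≢k j) (≈-sym (Ml l l≢k j)))
                                            (λ l l≢k j → ≈-sym (Ml l l≢k j)) ⟩
      c * D (N [ k ≔ N i ]) + D N      ≈⟨ +-congʳ (≈-trans (*-congˡ (alternating _ k≢i
                                            (λ j → ≈-trans (row-new N k _ j) (≈-sym (row-old N k _ i (k≢i ∘ ≡.sym) j))))) (zeroʳ c)) ⟩
      0# + D N                         ≈⟨ +-identityˡ _ ⟩
      D N                              ∎

    -- Let R x y be the value of `D` with rows i and k replaced by x and y. Expanding 0 = R (u + v)
    -- (u + v) bilinearly and dropping R u u = R v v = 0 leaves R u v + R v u = 0.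
    swap-rows : ∀ {M N i k} → i ≢ k → N i ≐ M k → N k ≐ M i →
                (∀ l → l ≢ i → l ≢ k → N l ≐ M l) → D N ≈ - D M
    swap-rows {M} {N} {i} {k} i≢k Ni≐Mk Nk≐Mi Nl≐Ml = begin-equality
      D N                       ≈⟨ cong N≋R ⟩
      R v u                     ≈⟨ solve 3 (λ x y z → y := :- x :+ (((:1 :* (:1 :* z :+ x)) :+ (:1 :* y :+ z)) :- z :- z)) ≈-refl (R u v) (R v u) 0# ⟩
      - R u v + (((1# * (1# * 0# + R u v)) + (1# * R v u + 0#)) - 0# - 0#)
                                ≈⟨ +-congˡ (+-congʳ (+-congʳ total≈0)) ⟩
      - R u v + (0# - 0# - 0#)  ≈⟨ solve 1 (λ x → :- x :+ (:0 :- :0 :- :0) := :- x) ≈-refl (R u v) ⟩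
      - R u v                   ≈⟨ -‿cong (cong M≋R) ⟨
      - D M                     ∎
      where
      u v w : Vector ℝ n
      u = M i
      v = M k
      w j = 1# * u j + v j
      R : Vector ℝ n → Vector ℝ n → ℝ
      R x y = D (M [ i ≔ x ] [ k ≔ y ])
      R-same : ∀ {x y} → x ≐ y → R x y ≈ 0#
      R-same {x} {y} x≐y = alternating _ i≢k λ j → ≈-trans (row-old _ k y i i≢k j)
        (≈-trans (row-new M i x j) (≈-trans (x≐y j) (≈-sym (row-new _ k y j))))
      R-linearˡ : ∀ y → R w y ≈ 1# * R u y + R v y
      R-linearˡ y = linear i 1#
        (λ j → ≈-trans (row-old _ k y i i≢k j) (≈-trans (row-new M i w j)
          (+-cong (*-congˡ (≈-sym (≈-trans (row-old _ k y i i≢k j) (row-new M i u j))))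
                  (≈-sym (≈-trans (row-old _ k y i i≢k j) (row-new M i v j))))))
        (λ l l≢i → other l l≢i) (λ l l≢i → other l l≢i)
        where
        other : ∀ {x x′} l → l ≢ i → (M [ i ≔ x ] [ k ≔ y ]) l ≐ (M [ i ≔ x′ ] [ k ≔ y ]) l
        other {x} {x′} l l≢i j with l ≟ k
        ... | yes ≡.refl = ≈-trans (row-new _ l y j) (≈-sym (row-new _ l y j))
        ... | no  l≢k = ≈-trans (≈-trans (row-old _ k y l l≢k j) (row-old M i x l l≢i j))
                          (≈-sym (≈-trans (row-old _ k y l l≢k j) (row-old M i x′ l l≢i j)))
      total≈0 : 1# * (1# * 0# + R u v) + (1# * R v u + 0#) ≈ 0#
      total≈0 = begin-equality
        1# * (1# * 0# + R u v) + (1# * R v u + 0#)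
          ≈⟨ +-cong (*-congˡ (+-congʳ (*-congˡ (R-same {u} (λ _ → ≈-refl))))) (+-congˡ (R-same {v} (λ _ → ≈-refl))) ⟨
        1# * (1# * R u u + R u v) + (1# * R v u + R v v)
          ≈⟨ +-cong (*-congˡ (linear-update _ k 1# u v)) (linear-update _ k 1# u v) ⟨
        1# * R u w + R v w   ≈⟨ R-linearˡ w ⟨
        R w w                ≈⟨ R-same {w} (λ _ → ≈-refl) ⟩
        0#                   ∎
      N≋R : N ≋ M [ i ≔ v ] [ k ≔ u ]
      N≋R l j with l ≟ k
      ... | yes ≡.refl = ≈-trans (Nk≐Mi j) (≈-sym (row-new _ l u j))
      ... | no  l≢k with l ≟ i
      ...   | yes ≡.refl = ≈-trans (Ni≐Mk j) (≈-sym (≈-trans (row-old _ k u l l≢k j) (row-new M l v j)))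
      ...   | no  l≢i = ≈-trans (Nl≐Ml l l≢i l≢k j) (≈-sym (≈-trans (row-old _ k u l l≢k j) (row-old M i v l l≢i j)))
      M≋R : M ≋ M [ i ≔ u ] [ k ≔ v ]
      M≋R l j with l ≟ k
      ... | yes ≡.refl = ≈-sym (row-new _ l v j)
      ... | no  l≢k with l ≟ i
      ...   | yes ≡.refl = ≈-sym (≈-trans (row-old _ k v l l≢k j) (row-new M l u j))
      ...   | no  l≢i = ≈-sym (≈-trans (row-old _ k v l l≢k j) (row-old M i u l l≢i j))

  -- The Laplace expansion is alternating

  minor : ∀ {n} → Matrix (suc n) → Fin (suc n) → Matrix n
  minor M j a b = M (suc a) (punchIn j b)

  sign : ∀ {n} → Fin n → ℝ
  sign j = (- 1#) ^ toℕ j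

  sign-inject₁ : ∀ {n} (j : Fin n) → sign (inject₁ j) ≈ sign j
  sign-inject₁ j = ≈-reflexive (≡.cong ((- 1#) ^_) (Fin.toℕ-inject₁ j))

  det-cong : ∀ {n} {M N : Matrix n} → M ≋ N → det M ≈ det N
  det-cong {zero}  M≋N = ≈-refl
  det-cong {suc n} M≋N = sum-cong λ j →
    *-cong (*-congˡ {sign j} (M≋N zero j)) (det-cong λ a b → M≋N (suc a) (punchIn j b))

  det-linear : ∀ {n} i c {M N P : Matrix n} → P i ≐ (λ j → c * M i j + N i j) →
               (∀ k → k ≢ i → M k ≐ P k) → (∀ k → k ≢ i → N k ≐ P k) →
               det P ≈ c * det M + det N
  det-linear {suc n} i c {M} {N} {P} Pi M≐P N≐P = begin-equality
    sum (term P)                                    ≈⟨ sum-cong (term-linear i Pi M≐P N≐P) ⟩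
    sum (λ j → c * term M j + term N j)             ≈⟨ ∑-distrib-+ (λ j → c * term M j) (term N) ⟩
    sum (λ j → c * term M j) + sum (term N)         ≈⟨ +-congʳ (sum-*ˡ c (term M)) ⟩
    c * det M + det N                               ∎
    where
    term : Matrix (suc n) → Vector ℝ (suc n)
    term M j = sign j * M zero j * det (minor M j)
    term-linear : ∀ i → P i ≐ (λ j → c * M i j + N i j) →
               (∀ k → k ≢ i → M k ≐ P k) → (∀ k → k ≢ i → N k ≐ P k) →
               ∀ j → term P j ≈ c * term M j + term N j
    term-linear zero Pi M≐P N≐P j = begin-equality
      sign j * P zero j * det (minor P j)
        ≈⟨ *-congʳ (*-congˡ (Pi j)) ⟩
      sign j * (c * M zero j + N zero j) * det (minor P j)
        ≈⟨ solve 5 (λ s c m n d → s :* (c :* m :+ n) :* d := c :* (s :* m :* d) :+ s :* n :* d) ≈-refl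
             (sign j) c (M zero j) (N zero j) (det (minor P j)) ⟩
      c * (sign j * M zero j * det (minor P j)) + sign j * N zero j * det (minor P j)
        ≈⟨ +-cong (*-congˡ (*-congˡ (det-cong λ a b → M≐P (suc a) (λ ()) (punchIn j b))))
                  (*-congˡ (det-cong λ a b → N≐P (suc a) (λ ()) (punchIn j b))) ⟨
      c * term M j + term N j   ∎
    term-linear (suc i) Pi M≐P N≐P j = begin-equality
      sign j * P zero j * det (minor P j)
        ≈⟨ *-congˡ (det-linear i c {minor M j} {minor N j} (λ b → Pi (punchIn j b))
             (λ k k≢i b → M≐P (suc k) (k≢i ∘ Fin.suc-injective) (punchIn j b))
             (λ k k≢i b → N≐P (suc k) (k≢i ∘ Fin.suc-injective) (punchIn j b))) ⟩
      sign j * P zero j * (c * det (minor M j) + det (minor N j))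
        ≈⟨ solve 5 (λ s p c x y → s :* p :* (c :* x :+ y) := c :* (s :* p :* x) :+ s :* p :* y) ≈-refl
             (sign j) (P zero j) c (det (minor M j)) (det (minor N j)) ⟩
      c * (sign j * P zero j * det (minor M j)) + sign j * P zero j * det (minor N j)
        ≈⟨ +-cong (*-congˡ (*-congʳ (*-congˡ (M≐P zero (λ ()) j)))) (*-congʳ (*-congˡ (N≐P zero (λ ()) j))) ⟨
      c * term M j + term N j   ∎

  -- The pairs (j , punchIn j k) of distinct indices are matched by transposition:
  -- for j ≤ k, (inject₁ j , suc k) corresponds to (suc k , inject₁ j).
  sum-antisymmetric : ∀ {m} (F : Fin (suc m) → Fin m → ℝ) →
    (∀ j k → toℕ j ℕ.≤ toℕ k → F (inject₁ j) k + F (suc k) j ≈ 0#) →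
    sum (λ j → sum (F j)) ≈ 0#
  sum-antisymmetric {zero}  F cancel = +-identityʳ 0#
  sum-antisymmetric {suc m} F cancel = begin-equality
    sum (F zero) + sum (λ j → F (suc j) zero + sum (λ k → F (suc j) (suc k)))
      ≈⟨ +-congˡ (∑-distrib-+ (λ j → F (suc j) zero) (λ j → sum (λ k → F (suc j) (suc k)))) ⟩
    sum (F zero) + (sum (λ j → F (suc j) zero) + sum (λ j → sum (λ k → F (suc j) (suc k))))
      ≈⟨ +-assoc _ _ _ ⟨
    sum (F zero) + sum (λ j → F (suc j) zero) + sum (λ j → sum (λ k → F (suc j) (suc k)))
      ≈⟨ +-cong (≈-trans (≈-sym (∑-distrib-+ (F zero) (λ j → F (suc j) zero))) (sum-zero λ k → cancel zero k ℕ.z≤n))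
                (sum-antisymmetric (λ j k → F (suc j) (suc k)) (λ j k j≤k → cancel (suc j) (suc k) (ℕ.s≤s j≤k))) ⟩
    0# + 0#   ≈⟨ +-identityʳ 0# ⟩
    0#        ∎

  punchIn-inject₁ : ∀ {m} (j k : Fin m) → toℕ j ℕ.≤ toℕ k → punchIn (inject₁ j) k ≡ suc k
  punchIn-inject₁ zero    k       j≤k         = ≡.refl
  punchIn-inject₁ (suc j) (suc k) (ℕ.s≤s j≤k) = ≡.cong suc (punchIn-inject₁ j k j≤k)

  punchIn-suc : ∀ {m} (j k : Fin m) → toℕ j ℕ.≤ toℕ k → punchIn (suc k) j ≡ inject₁ j
  punchIn-suc zero    k       j≤k         = ≡.refl
  punchIn-suc (suc j) (suc k) (ℕ.s≤s j≤k) = ≡.cong suc (punchIn-suc j k j≤k)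

  -- Ensures that the two matched column pairs have the same double minor.
  punchIn-punchIn : ∀ {m} (j k : Fin (suc m)) (b : Fin m) → toℕ j ℕ.≤ toℕ k →
                    punchIn (inject₁ j) (punchIn k b) ≡ punchIn (suc k) (punchIn j b)
  punchIn-punchIn zero    k       b       j≤k         = ≡.refl
  punchIn-punchIn (suc j) (suc k) zero    (ℕ.s≤s j≤k) = ≡.refl
  punchIn-punchIn (suc j) (suc k) (suc b) (ℕ.s≤s j≤k) = ≡.cong suc (punchIn-punchIn j k b j≤k)

  -- Expanding along the first two rows gives a sum over ordered pairs of distinct columns.
  -- Transposing a pair preserves the product of entries and the double minor but flips the sign.
  det-equal-rows₀₁ : ∀ {n} (M : Matrix (suc (suc n))) → M zero ≐ M (suc zero) → det M ≈ 0#
  det-equal-rows₀₁ {n} M M₀≐M₁ = begin-equality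
    det M                          ≈⟨ sum-cong (λ j → ≈-sym (sum-*ˡ (sign j * M zero j) (λ k → sign k * M (suc zero) (punchIn j k) * det (E j k)))) ⟩
    sum (λ j → sum (F j))          ≈⟨ sum-antisymmetric F cancel ⟩
    0#                             ∎
    where
    E : Fin (suc (suc n)) → Fin (suc n) → Matrix n
    E j k = minor (minor M j) k
    F : Fin (suc (suc n)) → Fin (suc n) → ℝ
    F j k = sign j * M zero j * (sign k * M (suc zero) (punchIn j k) * det (E j k))
    cancel : ∀ j k → toℕ j ℕ.≤ toℕ k → F (inject₁ j) k + F (suc k) j ≈ 0#
    cancel j k j≤k = begin-equality
      F (inject₁ j) k + F (suc k) j
        ≈⟨ +-cong
             (*-cong (*-congʳ (sign-inject₁ j)) (*-congʳ (*-congˡ (≈-trans (≈-sym (M₀≐M₁ _)) (≈-reflexive (≡.cong (M zero) (punchIn-inject₁ j k j≤k)))))))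
             (*-congˡ (*-cong (*-congˡ (≈-trans (≈-sym (M₀≐M₁ _)) (≈-reflexive (≡.cong (M zero) (punchIn-suc j k j≤k)))))
               (det-cong λ a b → ≈-reflexive (≡.cong (M (suc (suc a))) (≡.sym (punchIn-punchIn j k b j≤k)))))) ⟩
      sign j * x * (sign k * y * d) + - 1# * sign k * y * (sign j * x * d)
        ≈⟨ solve 5 (λ s t x y d → s :* x :* (t :* y :* d) :+ :- :1 :* t :* y :* (s :* x :* d) := :0) ≈-refl
             (sign j) (sign k) x y d ⟩
      0#   ∎
      where
      x = M zero (inject₁ j)
      y = M zero (suc k)
      d = det (E (inject₁ j) k)

  private
    -- Exchanging row 1 with the row equal to row 0 changes the sign of every minor of the first-row
    -- expansion, which reduces to the case of equal rows 0 and 1.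
    det-equal-row₀ : ∀ {n} → Alternating (det {n}) → ∀ (k : Fin n) (M : Matrix (suc n)) → M zero ≐ M (suc k) → det M ≈ 0#
    det-equal-row₀ {suc n} alt zero    M M₀≐M₁ = det-equal-rows₀₁ M M₀≐M₁
    det-equal-row₀ {suc n} alt (suc k) M M₀≐Mₖ = begin-equality
      det M                ≈⟨ sum-cong (λ j → ≈-trans (*-congˡ {sign j * M zero j} (≈-trans (≈-sym (-‿involutive _)) (-‿cong (≈-sym (minors j)))))
                                (≈-sym (-‿distribʳ-* (sign j * M zero j) (det (minor N j))))) ⟩
      sum (λ j → - (sign j * M zero j * det (minor N j)))
                           ≈⟨ sum-neg (λ j → sign j * M zero j * det (minor N j)) ⟩
      - det N              ≈⟨ -‿cong (det-equal-rows₀₁ N M₀≐Mₖ) ⟩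
      - 0#                 ≈⟨ -0#≈0# ⟩
      0#                   ∎
      where
      N : Matrix (suc (suc n))
      N zero          = M zero
      N (suc zero)    = M (suc (suc k))
      N (suc (suc a)) = updateAt (λ b → M (suc (suc b))) k (λ _ → M (suc zero)) a
      minors : ∀ j → det (minor N j) ≈ - det (minor M j)
      minors j = AlternatingProperties.swap-rows alt {minor M j} {minor N j} {zero} {suc k} (λ ())
        (λ b → ≈-refl)
        (λ b → ≈-reflexive (≡.cong (λ f → f (punchIn j b)) (updateAt-updates k (λ b → M (suc (suc b))))))
        λ { zero l≢0 _ → contradiction ≡.refl l≢0
          ; (suc l) _ l≢k b → ≈-reflexive (≡.cong (λ f → f (punchIn j b))
              (updateAt-minimal l k (λ b → M (suc (suc b))) (l≢k ∘ ≡.cong suc))) }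

  det-Alternating : ∀ {n} → Alternating (det {n})
  det-Alternating {zero} = record
    { cong = det-cong ; linear = det-linear ; alternating = λ _ {i} _ _ → contradiction i λ () }
  det-Alternating {suc n} = record
    { cong = det-cong ; linear = det-linear ; alternating = alternating }
    where
    alt = det-Alternating {n}
    alternating : ∀ (M : Matrix (suc n)) {i k} → i ≢ k → M i ≐ M k → det M ≈ 0#
    alternating M {zero}  {zero}  i≢k _     = contradiction ≡.refl i≢k
    alternating M {zero}  {suc k} _   Mi≐Mk = det-equal-row₀ alt k M Mi≐Mk
    alternating M {suc i} {zero}  _   Mi≐Mk = det-equal-row₀ alt i M (λ j → ≈-sym (Mi≐Mk j))
    alternating M {suc i} {suc k} i≢k Mi≐Mk = sum-zero λ j →
      ≈-trans (*-congˡ {sign j * M zero j} (Alternating.alternating alt (minor M j) (i≢k ∘ ≡.cong suc) (λ b → Mi≐Mk (punchIn j b))))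
              (zeroʳ (sign j * M zero j))

  -- Uniqueness of the determinant and multiplicativity

  module Uniqueness {n} {D : Matrix (suc n) → ℝ} (alt : Alternating D) where
    open Alternating alt
    open AlternatingProperties alt

    -- The first row is e_j; below it, column j is zero and the other columns hold `N`. The sum over
    -- k places entry k of a row of `N` in column `punchIn j k`.
    border : Fin (suc n) → Matrix n → Matrix (suc n)
    border j N zero    = I j
    border j N (suc a) = λ b → sum λ k → N a k * I (punchIn j k) b

    -- Lowers the size by one, so that the uniqueness theorem can be proved by induction.
    border-Alternating : ∀ j → Alternating (D ∘ border j)
    border-Alternating j = record
      { cong = λ M≋N → cong λ { zero _ → ≈-refl ; (suc a) b → sum-cong λ k → *-congʳ (M≋N a k) }
      ; linear = λ i c {M} {N} {P} Pi M≐P N≐P → linear (suc i) c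
          (λ b → begin-equality
            sum (λ k → P i k * I (punchIn j k) b)
              ≈⟨ sum-cong (λ k → ≈-trans (*-congʳ (Pi k)) (solve 4 (λ c m n e → (c :* m :+ n) :* e := c :* (m :* e) :+ n :* e) ≈-refl c (M i k) (N i k) (I (punchIn j k) b))) ⟩
            sum (λ k → c * (M i k * I (punchIn j k) b) + N i k * I (punchIn j k) b)
              ≈⟨ ∑-distrib-+ (λ k → c * (M i k * I (punchIn j k) b)) (λ k → N i k * I (punchIn j k) b) ⟩
            sum (λ k → c * (M i k * I (punchIn j k) b)) + sum (λ k → N i k * I (punchIn j k) b)
              ≈⟨ +-congʳ (sum-*ˡ c (λ k → M i k * I (punchIn j k) b)) ⟩
            c * sum (λ k → M i k * I (punchIn j k) b) + sum (λ k → N i k * I (punchIn j k) b)   ∎)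
          (λ { zero _ _ → ≈-refl ; (suc k) k≢i b → sum-cong λ l → *-congʳ (M≐P k (k≢i ∘ ≡.cong suc) l) })
          (λ { zero _ _ → ≈-refl ; (suc k) k≢i b → sum-cong λ l → *-congʳ (N≐P k (k≢i ∘ ≡.cong suc) l) })
      ; alternating = λ M i≢k Mi≐Mk → alternating (border j M) (i≢k ∘ Fin.suc-injective) λ b → sum-cong λ l → *-congʳ (Mi≐Mk l)
      }

    -- Row operations act on one row at a time. Induction on a bound t beyond which all coefficients
    -- vanish clears the coefficient at position t in each step.
    add-row₀-below : ∀ t (M N : Matrix (suc n)) (c : Vector ℝ n) →
                     (∀ a → t ℕ.≤ toℕ a → c a ≈ 0#) → M zero ≐ N zero →
                     (∀ a → M (suc a) ≐ (λ j → c a * N zero j + N (suc a) j)) → D M ≈ D N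
    add-row₀-below zero M N c c≈0 M₀ Mₐ = cong λ
      { zero    → M₀
      ; (suc a) j → ≈-trans (Mₐ a j) (≈-trans (+-congʳ (≈-trans (*-congʳ (c≈0 a ℕ.z≤n)) (zeroˡ _))) (+-identityˡ _)) }
    add-row₀-below (suc t) M N c c≈0 M₀ Mₐ with t ℕ.<? n
    ... | no t≮n = add-row₀-below t M N c (λ a t≤a → contradiction (ℕ.≤-<-trans t≤a (Fin.toℕ<n a)) t≮n) M₀ Mₐ
    ... | yes t<n = ≈-trans
      (add-row {M} {M′} {zero} {suc p} (c p) (λ ())
        (λ j → ≈-trans (Mₐ p j) (≈-sym (+-cong (*-congˡ (M₀ j)) (≈-trans (+-congʳ (≈-trans (*-congʳ c′-new) (zeroˡ _))) (+-identityˡ _)))))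
        λ { zero _ _ → ≈-refl
          ; (suc a) a≢p j → ≈-trans (Mₐ a j) (+-congʳ (*-congʳ (≈-sym (c′-old (a≢p ∘ ≡.cong suc))))) })
      (add-row₀-below t M′ N c′ c′≈0 M₀ (λ _ _ → ≈-refl))
      where
      p = fromℕ< t<n
      c′ : Vector ℝ n
      c′ a = if does (a ≟ p) then 0# else c a
      M′ : Matrix (suc n)
      M′ zero    = M zero
      M′ (suc a) = λ j → c′ a * N zero j + N (suc a) j
      c′-new : c′ p ≈ 0#
      c′-new with p ≟ p
      ... | yes _   = ≈-refl
      ... | no  p≢p = contradiction ≡.refl p≢p
      c′-old : ∀ {a} → a ≢ p → c′ a ≈ c a
      c′-old {a} a≢p with a ≟ p
      ... | yes a≡p = contradiction a≡p a≢p
      ... | no  _   = ≈-refl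
      c′≈0 : ∀ a → t ℕ.≤ toℕ a → c′ a ≈ 0#
      c′≈0 a t≤a with a ≟ p
      ... | yes _   = ≈-refl
      ... | no  a≢p = c≈0 a (ℕ.≤∧≢⇒< t≤a λ t≡a → a≢p (Fin.toℕ-injective (≡.trans (≡.sym t≡a) (≡.sym (Fin.toℕ-fromℕ< t<n)))))

    add-row₀ : ∀ (M N : Matrix (suc n)) (c : Vector ℝ n) → M zero ≐ N zero →
               (∀ a → M (suc a) ≐ (λ j → c a * N zero j + N (suc a) j)) → D M ≈ D N
    add-row₀ M N c = add-row₀-below n M N c λ a n≤a → contradiction (ℕ.<-≤-trans (Fin.toℕ<n a) n≤a) (ℕ.<-irrefl ≡.refl)

    -- Once row 0 is e_j, subtracting multiples of it clears column j in all other rows.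
    D-border : ∀ j M → D (M [ zero ≔ I j ]) ≈ D (border j (minor M j))
    D-border j M = add-row₀ (M [ zero ≔ I j ]) (border j (minor M j)) (λ a → M (suc a) j) (λ _ → ≈-refl) λ a b → begin-equality
      M (suc a) b                                ≈⟨ sum-Iʳ b (M (suc a)) ⟨
      sum (λ k → M (suc a) k * I k b)            ≈⟨ sum-remove {i = j} (λ k → M (suc a) k * I k b) ⟩
      M (suc a) j * I j b + sum (λ k → M (suc a) (punchIn j k) * I (punchIn j k) b)   ∎

    -- The bordered identities for `inject₁ j` and `suc j` differ by exchanging row 0 with row
    -- `suc j`, which contributes one factor - 1 per step.
    D-border-I : ∀ j → D (border j I) ≈ sign j * D I
    D-border-I = Fin.<-weakInduction (λ j → D (border j I) ≈ sign j * D I) base step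
      where
      rows : ∀ j a → border j I (suc a) ≐ I (punchIn j a)
      rows j a b = sum-Iˡ a (λ k → I (punchIn j k) b)
      base : D (border zero I) ≈ 1# * D I
      base = ≈-trans (cong λ { zero _ → ≈-refl ; (suc a) → rows zero a }) (≈-sym (*-identityˡ _))
      I-cong : ∀ {i j : Fin (suc n)} → i ≡ j → I i ≐ I j
      I-cong ≡.refl _ = ≈-refl
      punchIn-other : ∀ {n} (j l : Fin n) → l ≢ j → punchIn (suc j) l ≡ punchIn (inject₁ j) l
      punchIn-other zero    zero    l≢j = contradiction ≡.refl l≢j
      punchIn-other zero    (suc l) l≢j = ≡.refl
      punchIn-other (suc j) zero    l≢j = ≡.refl
      punchIn-other (suc j) (suc l) l≢j = ≡.cong suc (punchIn-other j l (l≢j ∘ ≡.cong suc))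
      step : ∀ j → D (border (inject₁ j) I) ≈ sign (inject₁ j) * D I → D (border (suc j) I) ≈ sign (suc j) * D I
      step j IH = begin-equality
        D (border (suc j) I)         ≈⟨ swap-rows {border (inject₁ j) I} {border (suc j) I} {zero} {suc j} (λ ())
          (λ b → ≈-trans (I-cong (≡.sym (punchIn-inject₁ j j ℕ.≤-refl)) b) (≈-sym (rows (inject₁ j) j b)))
          (λ b → ≈-trans (rows (suc j) j b) (I-cong (punchIn-suc j j ℕ.≤-refl) b))
          (λ { zero 0≢0 _ → contradiction ≡.refl 0≢0
             ; (suc l) _ l≢j b → ≈-trans (rows (suc j) l b) (≈-trans (I-cong (punchIn-other j l (l≢j ∘ ≡.cong suc)) b) (≈-sym (rows (inject₁ j) l b))) }) ⟩
        - D (border (inject₁ j) I)   ≈⟨ -‿cong (≈-trans IH (*-congʳ (sign-inject₁ j))) ⟩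
        - (sign j * D I)             ≈⟨ solve 2 (λ s d → :- (s :* d) := :- :1 :* s :* d) ≈-refl (sign j) (D I) ⟩
        sign (suc j) * D I           ∎

  -- An alternating function satisfies the Laplace recursion up to the factor `D I`: expand row 0 in
  -- unit vectors, clear the column below each of them, and apply the induction hypothesis to the
  -- bordered minors.
  det-unique : ∀ {n} {D : Matrix n → ℝ} → Alternating D → ∀ M → D M ≈ det M * D I
  det-unique {zero}  {D} alt M = ≈-trans (Alternating.cong alt λ ()) (≈-sym (*-identityˡ _))
  det-unique {suc n} {D} alt M = begin-equality
    D M                                                      ≈⟨ cong (λ { zero j → ≈-sym (sum-Iʳ j (M zero)) ; (suc a) _ → ≈-refl }) ⟩
    D (M [ zero ≔ (λ j → sum λ l → M zero l * I l j) ])      ≈⟨ expand-row M zero (M zero) I ⟩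
    sum (λ l → M zero l * D (M [ zero ≔ I l ]))              ≈⟨ sum-cong (λ l → ≈-trans (*-congˡ (begin-equality
      D (M [ zero ≔ I l ])                  ≈⟨ D-border l M ⟩
      D (border l (minor M l))              ≈⟨ det-unique (border-Alternating l) (minor M l) ⟩
      det (minor M l) * D (border l I)      ≈⟨ *-congˡ (D-border-I l) ⟩
      det (minor M l) * (sign l * D I)      ∎))
      (solve 4 (λ m d s i → m :* (d :* (s :* i)) := s :* m :* d :* i) ≈-refl (M zero l) (det (minor M l)) (sign l) (D I))) ⟩
    sum (λ l → sign l * M zero l * det (minor M l) * D I)    ≈⟨ sum-*ʳ (D I) (λ l → sign l * M zero l * det (minor M l)) ⟩
    det M * D I                                              ∎
    where
    open Alternating alt
    open AlternatingProperties alt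
    open Uniqueness alt

  -- For fixed `N` the left side is alternating in the rows of `M` and takes the value det N at the
  -- identity, so `det-unique` applies.
  det-⊗ : ∀ {n} (M N : Matrix n) → det (M ⊗ N) ≈ det M * det N
  det-⊗ M N = ≈-trans (det-unique alt M) (*-congˡ (det-cong λ i j → sum-Iˡ i (λ k → N k j)))
    where
    open Alternating det-Alternating
    alt : Alternating (λ M → det (M ⊗ N))
    alt = record
      { cong = λ M≋M′ → cong λ i j → sum-cong λ k → *-congʳ (M≋M′ i k)
      ; linear = λ i c {A} {B} {P} Pi A≐P B≐P → linear i c
          (λ j → begin-equality
            sum (λ k → P i k * N k j)
              ≈⟨ sum-cong (λ k → ≈-trans (*-congʳ (Pi k)) (solve 4 (λ c m n e → (c :* m :+ n) :* e := c :* (m :* e) :+ n :* e) ≈-refl c (A i k) (B i k) (N k j))) ⟩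
            sum (λ k → c * (A i k * N k j) + B i k * N k j)
              ≈⟨ ∑-distrib-+ (λ k → c * (A i k * N k j)) (λ k → B i k * N k j) ⟩
            sum (λ k → c * (A i k * N k j)) + sum (λ k → B i k * N k j)
              ≈⟨ +-congʳ (sum-*ˡ c (λ k → A i k * N k j)) ⟩
            c * (A ⊗ N) i j + (B ⊗ N) i j   ∎)
          (λ l l≢i j → sum-cong λ k → *-congʳ (A≐P l l≢i k))
          (λ l l≢i j → sum-cong λ k → *-congʳ (B≐P l l≢i k))
      ; alternating = λ M i≢k Mi≐Mk → alternating (M ⊗ N) i≢k λ j → sum-cong λ l → *-congʳ (Mi≐Mk l)
      }

  det-I : ∀ {n} → det (I {n}) ≈ 1#
  det-I {zero}  = ≈-refl
  det-I {suc n} = begin-equality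
    1# * 1# * det (minor J zero) + sum (λ j → sign (suc j) * 0# * det (minor J (suc j)))
      ≈⟨ +-cong (≈-trans (*-congˡ (≈-trans (det-cong {n} {minor J zero} {I} λ a b → I-suc a b) (det-I {n}))) (≈-trans (*-identityʳ _) (*-identityʳ 1#)))
                (sum-zero λ j → ≈-trans (*-congʳ {det (minor J (suc j))} (zeroʳ (sign (suc j)))) (zeroˡ _)) ⟩
    1# + 0#   ≈⟨ +-identityʳ 1# ⟩
    1#        ∎
    where
    J : Matrix (suc n)
    J = I

  inverse⇒det≉0 : ∀ {n} (M N : Matrix n) → M ⊗ N ≋ I → ¬ det M ≈ 0# × ¬ det N ≈ 0#
  inverse⇒det≉0 {n} M N MN≋I =
    (λ detM≈0 → 0≉1 (≈-trans (≈-sym (zeroˡ (det N))) (≈-trans (*-congʳ (≈-sym detM≈0)) detM*detN≈1))) ,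
    (λ detN≈0 → 0≉1 (≈-trans (≈-sym (zeroʳ (det M))) (≈-trans (*-congˡ (≈-sym detN≈0)) detM*detN≈1)))
    where
    detM*detN≈1 : det M * det N ≈ 1#
    detM*detN≈1 = ≈-trans (≈-sym (det-⊗ M N)) (≈-trans (det-cong {n} {M ⊗ N} {I} MN≋I) (det-I {n}))

  det≈0⇒Kernel : ∀ {n} (M : Matrix n) → det M ≈ 0# → Kernel M
  det≈0⇒Kernel M detM≈0 with kernel-or-rightInverse M
  ... | inj₁ kernel      = kernel
  ... | inj₂ (N , MN≋I) = contradiction detM≈0 (proj₁ (inverse⇒det≉0 M N MN≋I))

  -- Bilinear forms

  form : ∀ {n} → Matrix n → Vector ℝ n → Vector ℝ n → ℝ
  form M f g = dot f (λ i → dot (M i) g)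

  lin : ∀ {m n} → (Fin m → Vector ℝ n) → Vector ℝ m → Vector ℝ n
  lin W y i = dot (λ k → W k i) y

  gram : ∀ {m n} → Matrix n → (Fin m → Vector ℝ n) → Matrix m
  gram M W i j = form M (W i) (W j)

  Symmetric : ∀ {n} → Matrix n → Set
  Symmetric M = ∀ i j → M i j ≈ M j i

  PositiveDefinite : ∀ {n} → Matrix n → Set
  PositiveDefinite M = ∀ f → Nonzero f → 0# < form M f f

  dot-cong : ∀ {n} {f f′ g g′ : Vector ℝ n} → f ≐ f′ → g ≐ g′ → dot f g ≈ dot f′ g′
  dot-cong f≐f′ g≐g′ = sum-cong λ i → *-cong (f≐f′ i) (g≐g′ i)

  dot-zeroʳ : ∀ {n} (f : Vector ℝ n) {g} → (∀ i → g i ≈ 0#) → dot f g ≈ 0#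
  dot-zeroʳ f g≈0 = sum-zero λ i → ≈-trans (*-congˡ (g≈0 i)) (zeroʳ (f i))

  dot-zeroˡ : ∀ {n} {f : Vector ℝ n} g → (∀ i → f i ≈ 0#) → dot f g ≈ 0#
  dot-zeroˡ g f≈0 = sum-zero λ i → ≈-trans (*-congʳ (f≈0 i)) (zeroˡ (g i))

  dot-comm : ∀ {n} (f g : Vector ℝ n) → dot f g ≈ dot g f
  dot-comm f g = sum-cong λ i → *-comm (f i) (g i)

  dot-*ʳ : ∀ {n} (f g : Vector ℝ n) c → dot f (λ i → c * g i) ≈ c * dot f g
  dot-*ʳ f g c = ≈-trans
    (sum-cong λ i → solve 3 (λ f c g → f :* (c :* g) := c :* (f :* g)) ≈-refl (f i) c (g i))
    (sum-*ˡ c (λ i → f i * g i))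

  dot-+ʳ : ∀ {n} (f g h : Vector ℝ n) → dot f (λ i → g i + h i) ≈ dot f g + dot f h
  dot-+ʳ f g h = ≈-trans (sum-cong λ i → distribˡ (f i) (g i) (h i))
    (∑-distrib-+ (λ i → f i * g i) (λ i → f i * h i))

  dot--ʳ : ∀ {n} (f g h : Vector ℝ n) → dot f (λ i → g i - h i) ≈ dot f g - dot f h
  dot--ʳ f g h = ≈-trans
    (sum-cong λ i → solve 3 (λ f g h → f :* (g :- h) := f :* g :- f :* h) ≈-refl (f i) (g i) (h i))
    (sum-- (λ i → f i * g i) (λ i → f i * h i))

  dot-assoc : ∀ {m n} (f : Vector ℝ m) (M : Fin m → Vector ℝ n) (g : Vector ℝ n) →
              dot f (λ i → dot (M i) g) ≈ dot (λ j → dot f (λ i → M i j)) g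
  dot-assoc f M g = begin-equality
    sum (λ i → f i * dot (M i) g)                   ≈⟨ sum-cong (λ i → sum-*ˡ (f i) (λ j → M i j * g j)) ⟨
    sum (λ i → sum λ j → f i * (M i j * g j))       ≈⟨ ∑-comm (λ i j → f i * (M i j * g j)) ⟩
    sum (λ j → sum λ i → f i * (M i j * g j))       ≈⟨ sum-cong (λ j → ≈-trans
                                                         (sum-cong λ i → ≈-sym (*-assoc (f i) (M i j) (g j)))
                                                         (sum-*ʳ (g j) (λ i → f i * M i j))) ⟩
    sum (λ j → dot f (λ i → M i j) * g j)           ∎

  form-cong : ∀ {n} (M : Matrix n) {f f′ g g′} → f ≐ f′ → g ≐ g′ → form M f g ≈ form M f′ g′
  form-cong M f≐f′ g≐g′ = dot-cong f≐f′ λ i → dot-cong {f = M i} (λ _ → ≈-refl) g≐g′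

  form-sym : ∀ {n} {M : Matrix n} → Symmetric M → ∀ f g → form M f g ≈ form M g f
  form-sym {M = M} M-sym f g = begin-equality
    dot f (λ i → dot (M i) g)              ≈⟨ dot-assoc f M g ⟩
    dot (λ j → dot f (λ i → M i j)) g      ≈⟨ dot-comm (λ j → dot f (λ i → M i j)) g ⟩
    dot g (λ j → dot f (λ i → M i j))      ≈⟨ dot-cong {f = g} (λ _ → ≈-refl) (λ j → ≈-trans (dot-comm f (λ i → M i j))
                                                (dot-cong {g = f} (λ i → M-sym i j) (λ _ → ≈-refl))) ⟩
    dot g (λ j → dot (M j) f)              ∎

  form-linʳ : ∀ {m n} (M : Matrix n) f (W : Fin m → Vector ℝ n) y →
              form M f (lin W y) ≈ dot (λ k → form M f (W k)) y
  form-linʳ M f W y = begin-equality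
    dot f (λ i → dot (M i) (lin W y))                     ≈⟨ dot-cong {f = f} (λ _ → ≈-refl) (λ i → dot-assoc (M i) (λ j k → W k j) y) ⟩
    dot f (λ i → dot (λ k → dot (M i) (W k)) y)           ≈⟨ dot-assoc f (λ i k → dot (M i) (W k)) y ⟩
    dot (λ k → form M f (W k)) y                          ∎

  form-linˡ : ∀ {m n} (M : Matrix n) (W : Fin m → Vector ℝ n) y g →
              form M (lin W y) g ≈ dot y (λ k → form M (W k) g)
  form-linˡ M W y g = begin-equality
    dot (λ i → dot (λ k → W k i) y) (λ i → dot (M i) g)   ≈⟨ dot-cong {g = λ i → dot (M i) g} (λ i → dot-comm (λ k → W k i) y) (λ _ → ≈-refl) ⟩
    dot (λ i → dot y (λ k → W k i)) (λ i → dot (M i) g)   ≈⟨ dot-assoc y W (λ i → dot (M i) g) ⟨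
    dot y (λ k → form M (W k) g)                          ∎

  form-lin : ∀ {m n} (M : Matrix n) (W : Fin m → Vector ℝ n) y z →
             form M (lin W y) (lin W z) ≈ form (gram M W) y z
  form-lin M W y z = ≈-trans (form-linˡ M W y (lin W z))
    (dot-cong {f = y} (λ _ → ≈-refl) λ k → form-linʳ M (W k) W z)

  pencil : ∀ {n} → Matrix n → Matrix n → ℝ → Matrix n
  pencil a b x i j = x * b i j - a i j

  dot-pencil : ∀ {n} (a b : Matrix n) x i g → dot (pencil a b x i) g ≈ x * dot (b i) g - dot (a i) g
  dot-pencil a b x i g = begin-equality
    sum (λ j → (x * b i j - a i j) * g j)             ≈⟨ sum-cong (λ j → solve 4 (λ x b a g → (x :* b :- a) :* g := x :* (b :* g) :- a :* g) ≈-refl x (b i j) (a i j) (g j)) ⟩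
    sum (λ j → x * (b i j * g j) - a i j * g j)       ≈⟨ sum-- (λ j → x * (b i j * g j)) (λ j → a i j * g j) ⟩
    sum (λ j → x * (b i j * g j)) - dot (a i) g       ≈⟨ +-congʳ (sum-*ˡ x (λ j → b i j * g j)) ⟩
    x * dot (b i) g - dot (a i) g                     ∎

  form-pencil : ∀ {n} (a b : Matrix n) x f g → form (pencil a b x) f g ≈ x * form b f g - form a f g
  form-pencil a b x f g = begin-equality
    dot f (λ i → dot (pencil a b x i) g)                             ≈⟨ dot-cong {f = f} (λ _ → ≈-refl) (λ i → dot-pencil a b x i g) ⟩
    dot f (λ i → x * dot (b i) g - dot (a i) g)                      ≈⟨ dot--ʳ f (λ i → x * dot (b i) g) (λ i → dot (a i) g) ⟩
    dot f (λ i → x * dot (b i) g) - form a f g                       ≈⟨ +-congʳ (dot-*ʳ f (λ i → dot (b i) g) x) ⟩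
    x * form b f g - form a f g                                      ∎

  nonzero? : ∀ {n} (f : Vector ℝ n) → Nonzero f ⊎ (∀ i → f i ≈ 0#)
  nonzero? f with Fin.any? (λ i → ¬? (f i ≈? 0#))
  ... | yes f≉0 = inj₁ f≉0
  ... | no  f≈0 = inj₂ λ i → decidable-stable (f i ≈? 0#) (λ fi≉0 → f≈0 (i , fi≉0))

  -- Continuity of polynomial functions

  -- Squares replace absolute values: this is a Lipschitz bound with constant √M on the unit
  -- neighbourhood of p. It makes polynomial functions continuous without representing them as
  -- polynomials.
  LipschitzAt : ℝ → (ℝ → ℝ) → Set
  LipschitzAt p f = ∃ λ M → 0# ≤ M × (∀ x → (x - p) * (x - p) ≤ 1# →
    (f x - f p) * (f x - f p) ≤ M * ((x - p) * (x - p)))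

  square-+ : ∀ x y → (x + y) * (x + y) ≤ (1# + 1#) * (x * x + y * y)
  square-+ x y = nonneg-diff ((x - y) * (x - y)) (square-nonneg (x - y))
    (solve 2 (λ x y → (:1 :+ :1) :* (x :* x :+ y :* y) :- (x :+ y) :* (x :+ y) := (x :- y) :* (x :- y)) ≈-refl x y)

  0≤2 : 0# ≤ 1# + 1#
  0≤2 = +-nonneg 0≤1 0≤1

  const-Lipschitz : ∀ {p} c → LipschitzAt p (λ _ → c)
  const-Lipschitz {p} c = 0# , ≤-refl , λ x _ → ≤-reflexive
    (solve 2 (λ c t → (c :- c) :* (c :- c) := :0 :* t) ≈-refl c ((x - p) * (x - p)))

  id-Lipschitz : ∀ {p} → LipschitzAt p (λ x → x)
  id-Lipschitz = 1# , 0≤1 , λ x _ → ≤-reflexive (≈-sym (*-identityˡ _))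

  +-Lipschitz : ∀ {p f g} → LipschitzAt p f → LipschitzAt p g → LipschitzAt p (λ x → f x + g x)
  +-Lipschitz {p} {f} {g} (M , 0≤M , Mf) (N , 0≤N , Ng) = (1# + 1#) * (M + N) , *-nonneg 0≤2 (+-nonneg 0≤M 0≤N) , λ x x≤1 → begin
    (f x + g x - (f p + g p)) * (f x + g x - (f p + g p))
      ≈⟨ solve 4 (λ a b c d → (a :+ b :- (c :+ d)) :* (a :+ b :- (c :+ d)) := ((a :- c) :+ (b :- d)) :* ((a :- c) :+ (b :- d))) ≈-refl (f x) (g x) (f p) (g p) ⟩
    ((f x - f p) + (g x - g p)) * ((f x - f p) + (g x - g p))
      ≤⟨ square-+ (f x - f p) (g x - g p) ⟩
    (1# + 1#) * ((f x - f p) * (f x - f p) + (g x - g p) * (g x - g p))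
      ≤⟨ *-monoʳ-≤ 0≤2 (+-mono-≤ (Mf x x≤1) (Ng x x≤1)) ⟩
    (1# + 1#) * (M * ((x - p) * (x - p)) + N * ((x - p) * (x - p)))
      ≈⟨ solve 4 (λ t m n d → t :* (m :* d :+ n :* d) := t :* (m :+ n) :* d) ≈-refl (1# + 1#) M N ((x - p) * (x - p)) ⟩
    (1# + 1#) * (M + N) * ((x - p) * (x - p))   ∎

  *-Lipschitz : ∀ {p f g} → LipschitzAt p f → LipschitzAt p g → LipschitzAt p (λ x → f x * g x)
  *-Lipschitz {p} {f} {g} (M , 0≤M , Mf) (N , 0≤N , Ng) = two * (M * B + f p * f p * N) ,
    *-nonneg 0≤2 (+-nonneg (*-nonneg 0≤M 0≤B) (*-nonneg (square-nonneg (f p)) 0≤N)) , λ x x≤1 → begin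
      (f x * g x - f p * g p) * (f x * g x - f p * g p)
        ≈⟨ solve 4 (λ a b c d → (a :* b :- c :* d) :* (a :* b :- c :* d) := ((a :- c) :* b :+ c :* (b :- d)) :* ((a :- c) :* b :+ c :* (b :- d))) ≈-refl (f x) (g x) (f p) (g p) ⟩
      ((f x - f p) * g x + f p * (g x - g p)) * ((f x - f p) * g x + f p * (g x - g p))
        ≤⟨ square-+ ((f x - f p) * g x) (f p * (g x - g p)) ⟩
      two * ((f x - f p) * g x * ((f x - f p) * g x) + f p * (g x - g p) * (f p * (g x - g p)))
        ≈⟨ *-congˡ (solve 4 (λ u b c v → u :* b :* (u :* b) :+ c :* v :* (c :* v) := (u :* u) :* (b :* b) :+ c :* c :* (v :* v)) ≈-refl (f x - f p) (g x) (f p) (g x - g p)) ⟩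
      two * ((f x - f p) * (f x - f p) * (g x * g x) + f p * f p * ((g x - g p) * (g x - g p)))
        ≤⟨ *-monoʳ-≤ 0≤2 (+-mono-≤ (*-mono-≤ (*-nonneg 0≤M (square-nonneg (x - p))) (square-nonneg (g x)) (Mf x x≤1) (g-bound x x≤1))
                                   (*-monoʳ-≤ (square-nonneg (f p)) (Ng x x≤1))) ⟩
      two * (M * t x * B + f p * f p * (N * t x))
        ≈⟨ solve 6 (λ two m t b c n → two :* (m :* t :* b :+ c :* (n :* t)) := two :* (m :* b :+ c :* n) :* t) ≈-refl two M (t x) B (f p * f p) N ⟩
      two * (M * B + f p * f p * N) * t x   ∎
    where
    two B : ℝ
    two = 1# + 1#
    -- Bounds (g x)² near p, by (g x)² ≤ 2 ((g p)² + (g x - g p)²). It is needed for the first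
    -- summand of f x g x - f p g p = (f x - f p) g x + f p (g x - g p).
    B = two * (g p * g p + N)
    t : ℝ → ℝ
    t x = (x - p) * (x - p)
    0≤B : 0# ≤ B
    0≤B = *-nonneg 0≤2 (+-nonneg (square-nonneg (g p)) 0≤N)
    g-bound : ∀ x → t x ≤ 1# → g x * g x ≤ B
    g-bound x x≤1 = begin
      g x * g x                                               ≈⟨ solve 2 (λ a b → a :* a := (b :+ (a :- b)) :* (b :+ (a :- b))) ≈-refl (g x) (g p) ⟩
      (g p + (g x - g p)) * (g p + (g x - g p))               ≤⟨ square-+ (g p) (g x - g p) ⟩
      two * (g p * g p + (g x - g p) * (g x - g p))           ≤⟨ *-monoʳ-≤ 0≤2 (+-monoʳ-≤ _ (≤-trans (Ng x x≤1)
                                                                   (≤-respʳ-≈ (*-identityʳ N) (*-monoʳ-≤ 0≤N x≤1)))) ⟩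
      B                                                       ∎

  sum-Lipschitz : ∀ {p n} {F : ℝ → Vector ℝ n} → (∀ j → LipschitzAt p (λ x → F x j)) → LipschitzAt p (λ x → sum (F x))
  sum-Lipschitz {n = zero}  lip = const-Lipschitz 0#
  sum-Lipschitz {n = suc n} {F} lip = +-Lipschitz (lip zero) (sum-Lipschitz {F = λ x → tail (F x)} (lip ∘ suc))

  product-Lipschitz : ∀ {p n} {F : ℝ → Vector ℝ n} → (∀ j → LipschitzAt p (λ x → F x j)) → LipschitzAt p (λ x → product (F x))
  product-Lipschitz {n = zero}  lip = const-Lipschitz 1#
  product-Lipschitz {n = suc n} {F} lip = *-Lipschitz (lip zero) (product-Lipschitz {F = λ x → tail (F x)} (lip ∘ suc))

  det-Lipschitz : ∀ {p n} {F : ℝ → Matrix n} → (∀ i j → LipschitzAt p (λ x → F x i j)) → LipschitzAt p (λ x → det (F x))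
  det-Lipschitz {n = zero}  lip = const-Lipschitz 1#
  det-Lipschitz {n = suc n} {F} lip = sum-Lipschitz {F = λ x j → sign j * F x zero j * det (minor (F x) j)} λ j →
    *-Lipschitz (*-Lipschitz (const-Lipschitz (sign j)) (lip zero j))
                (det-Lipschitz {F = λ x → minor (F x) j} λ a b → lip (suc a) (punchIn j b))

  -- The difference h = f - g vanishes at p + δ, so the Lipschitz bound gives (h p)² ≤ M δ² for
  -- every δ in (0 , 1].
  agree-at : ∀ {p f g} → LipschitzAt p f → LipschitzAt p g → (∀ x → ¬ x ≈ p → f x ≈ g x) → f p ≈ g p
  agree-at {p} {f} {g} lf lg agree = begin-equality
    f p               ≈⟨ solve 2 (λ a b → a := (a :+ :- :1 :* b) :+ b) ≈-refl (f p) (g p) ⟩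
    h p + g p         ≈⟨ +-congʳ (square-zero (vanishing (square-nonneg (h p)) (proj₁ (proj₂ lh)) bound)) ⟩
    0# + g p          ≈⟨ +-identityˡ _ ⟩
    g p               ∎
    where
    h : ℝ → ℝ
    h x = f x + - 1# * g x
    lh : LipschitzAt p h
    lh = +-Lipschitz lf (*-Lipschitz (const-Lipschitz (- 1#)) lg)
    bound : ∀ δ → 0# < δ → δ ≤ 1# → h p * h p ≤ proj₁ lh * (δ * δ)
    bound δ 0<δ δ≤1 = begin
      h p * h p                                  ≈⟨ solve 1 (λ a → a :* a := (:0 :- a) :* (:0 :- a)) ≈-refl (h p) ⟩
      (0# - h p) * (0# - h p)                    ≈⟨ *-cong (+-congʳ hx≈0) (+-congʳ hx≈0) ⟨
      (h x - h p) * (h x - h p)                  ≤⟨ proj₂ (proj₂ lh) x (≤-respˡ-≈ (≈-sym [x-p]²) δδ≤1) ⟩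
      proj₁ lh * ((x - p) * (x - p))             ≈⟨ *-congˡ [x-p]² ⟩
      proj₁ lh * (δ * δ)                         ∎
      where
      x = p + δ
      [x-p]² : (x - p) * (x - p) ≈ δ * δ
      [x-p]² = solve 2 (λ p δ → (p :+ δ :- p) :* (p :+ δ :- p) := δ :* δ) ≈-refl p δ
      δδ≤1 : δ * δ ≤ 1#
      δδ≤1 = ≤-respʳ-≈ (*-identityˡ 1#) (*-mono-≤ 0≤1 (proj₁ 0<δ) δ≤1 δ≤1)
      hx≈0 : h x ≈ 0#
      hx≈0 = ≈-trans (+-congʳ (agree x λ x≈p → x+δ≰x 0<δ (≤-reflexive x≈p)))
        (solve 1 (λ b → b :+ :- :1 :* b := :0) ≈-refl (g x))

  -- Simultaneous diagonalisation

  record Diagonalisation {n} (a b : Matrix n) (λs : Vector ℝ n) : Set where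
    field
      basis       : Fin n → Vector ℝ n
      orthonormal : ∀ i j → form b (basis i) (basis j) ≈ I i j
      diagonal    : ∀ i j → form a (basis i) (basis j) ≈ λs i * I i j

  I-punchIn : ∀ {n} (p : Fin (suc n)) i j → I (punchIn p i) (punchIn p j) ≈ I i j
  I-punchIn p i j with i ≟ j
  ... | yes ≡.refl = I-diag (punchIn p i)
  ... | no  i≢j    = I-off (i≢j ∘ Fin.punchIn-injective p i j)

  dot-Iʳ : ∀ {n} (f : Vector ℝ n) i → dot f (I i) ≈ f i
  dot-Iʳ f i = ≈-trans (dot-comm f (I i)) (sum-Iˡ i f)

  -- Split off a b-unit vector v with a v = p b v: the remaining basis vectors are
  -- the b-orthogonal projections of the standard ones, leaving out a coordinate
  -- where v does not vanish.
  module Deflation {n} {a b : Matrix (suc n)} (a-sym : Symmetric a) (b-sym : Symmetric b)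
                   {v : Vector ℝ (suc n)} (unit : form b v v ≈ 1#)
                   {p : ℝ} (eigen : ∀ i → dot (a i) v ≈ p * dot (b i) v)
                   (q : Fin (suc n)) (vq≉0 : ¬ v q ≈ 0#) where

    c : Vector ℝ n
    c k = form b (I (punchIn q k)) v

    W : Fin n → Vector ℝ (suc n)
    W k i = I (punchIn q k) i - c k * v i

    B : Fin (suc n) → Vector ℝ (suc n)
    B = v ∷ W

    a′ b′ : Matrix n
    a′ = gram a W
    b′ = gram b W

    form-a-v : ∀ f → form a f v ≈ p * form b f v
    form-a-v f = ≈-trans (dot-cong {f = f} (λ _ → ≈-refl) eigen) (dot-*ʳ f (λ i → dot (b i) v) p)

    W⊥v : ∀ k → form b (W k) v ≈ 0#
    W⊥v k = begin-equality
      dot (W k) bv                                       ≈⟨ dot-comm (W k) bv ⟩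
      dot bv (W k)                                       ≈⟨ dot--ʳ bv (I (punchIn q k)) (λ i → c k * v i) ⟩
      dot bv (I (punchIn q k)) - dot bv (λ i → c k * v i)   ≈⟨ +-cong (dot-comm bv (I (punchIn q k))) (-‿cong (≈-trans (dot-*ʳ bv v (c k)) (*-congˡ (≈-trans (dot-comm bv v) unit)))) ⟩
      c k - c k * 1#                                     ≈⟨ solve 1 (λ c → c :- c :* :1 := :0) ≈-refl (c k) ⟩
      0#                                                 ∎
      where bv = λ i → dot (b i) v

    v⊥W : ∀ k → form b v (W k) ≈ 0#
    v⊥W k = ≈-trans (form-sym b-sym v (W k)) (W⊥v k)

    aWv : ∀ k → form a (W k) v ≈ 0#
    aWv k = ≈-trans (form-a-v (W k)) (≈-trans (*-congˡ (W⊥v k)) (zeroʳ p))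

    avW : ∀ k → form a v (W k) ≈ 0#
    avW k = ≈-trans (form-sym a-sym v (W k)) (aWv k)

    -- The combination equals t v + Σ y_{k+1} e_{punchIn q k} with t = y₀ - Σ c_k y_{k+1}.
    -- Coordinate q sees only t v, and v q is nonzero, so t = 0; the other coordinates then read off
    -- the remaining coefficients.
    independent : ∀ y → (∀ i → lin B y i ≈ 0#) → ∀ k → y k ≈ 0#
    independent y zeros = λ { zero → y₀≈0 ; (suc l) → tail≈0 l }
      where
      t : ℝ
      t = y zero - dot c (tail y)
      expand : ∀ i → lin B y i ≈ v i * t + dot (λ k → I (punchIn q k) i) (tail y)
      expand i = begin-equality
        v i * y zero + sum (λ k → (I (punchIn q k) i - c k * v i) * y (suc k))
          ≈⟨ +-congˡ (sum-cong λ k → solve 4 (λ e c v y → (e :- c :* v) :* y := e :* y :- v :* (c :* y)) ≈-refl (I (punchIn q k) i) (c k) (v i) (y (suc k))) ⟩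
        v i * y zero + sum (λ k → I (punchIn q k) i * y (suc k) - v i * (c k * y (suc k)))
          ≈⟨ +-congˡ (≈-trans (sum-- (λ k → I (punchIn q k) i * y (suc k)) (λ k → v i * (c k * y (suc k)))) (+-congˡ (-‿cong (sum-*ˡ (v i) (λ k → c k * y (suc k)))))) ⟩
        v i * y zero + (dot (λ k → I (punchIn q k) i) (tail y) - v i * dot c (tail y))
          ≈⟨ solve 4 (λ v y s d → v :* y :+ (s :- v :* d) := v :* (y :- d) :+ s) ≈-refl (v i) (y zero) (dot (λ k → I (punchIn q k) i) (tail y)) (dot c (tail y)) ⟩
        v i * t + dot (λ k → I (punchIn q k) i) (tail y)   ∎
      t≈0 : t ≈ 0#
      t≈0 = product-zero {v q} {t} (begin-equality
        v q * t            ≈⟨ +-identityʳ _ ⟨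
        v q * t + 0#       ≈⟨ +-congˡ (dot-zeroˡ (tail y) λ k → I-off (Fin.punchInᵢ≢i q k)) ⟨
        v q * t + dot (λ k → I (punchIn q k) q) (tail y)   ≈⟨ expand q ⟨
        lin B y q          ≈⟨ zeros q ⟩
        0#                 ∎) vq≉0
      tail≈0 : ∀ l → y (suc l) ≈ 0#
      tail≈0 l = begin-equality
        y (suc l)                                        ≈⟨ sum-Iˡ l (tail y) ⟨
        dot (I l) (tail y)                               ≈⟨ dot-cong {g = tail y} (λ k → ≈-trans (I-sym l k) (≈-sym (I-punchIn q k l))) (λ _ → ≈-refl) ⟩
        dot (λ k → I (punchIn q k) i) (tail y)           ≈⟨ +-identityˡ _ ⟨
        0# + dot (λ k → I (punchIn q k) i) (tail y)      ≈⟨ +-congʳ (≈-trans (*-congˡ t≈0) (zeroʳ (v i))) ⟨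
        v i * t + dot (λ k → I (punchIn q k) i) (tail y) ≈⟨ expand i ⟨
        lin B y i                                        ≈⟨ zeros i ⟩
        0#                                               ∎
        where i = punchIn q l
      y₀≈0 : y zero ≈ 0#
      y₀≈0 = begin-equality
        y zero                                ≈⟨ solve 2 (λ y d → y := y :- d :+ d) ≈-refl (y zero) (dot c (tail y)) ⟩
        t + dot c (tail y)                    ≈⟨ +-cong t≈0 (dot-zeroʳ c tail≈0) ⟩
        0# + 0#                               ≈⟨ +-identityʳ 0# ⟩
        0#                                    ∎

    lin-W : ∀ y → lin W y ≐ lin B (0# ∷ y)
    lin-W y i = ≈-sym (≈-trans (+-congʳ (zeroʳ (v i))) (+-identityˡ _))

    b′-positive : PositiveDefinite b → PositiveDefinite b′
    b′-positive b-pos y (l , yl≉0) with nonzero? (lin W y)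
    ... | inj₁ nz    = let (0≤ , 0≉) = b-pos (lin W y) nz in
      ≤-respʳ-≈ (form-lin b W y y) 0≤ , λ 0≈ → 0≉ (≈-trans 0≈ (≈-sym (form-lin b W y y)))
    ... | inj₂ zeros = contradiction (independent (0# ∷ y) (λ i → ≈-trans (≈-sym (lin-W y i)) (zeros i)) (suc l)) yl≉0

    transpose : Matrix (suc n) → Matrix (suc n)
    transpose M i j = M j i

    -- The Gram matrix is the product B (pencil) Bᵀ. Independence of the rows of `B` excludes a
    -- kernel of Bᵀ, and a right inverse of Bᵀ makes both determinants nonzero, the one of `B` after
    -- transposing the identity.
    det-B : ∃ λ d → ¬ d ≈ 0# × (∀ x → det (gram (pencil a b x) B) ≈ d * det (pencil a b x))
    det-B with kernel-or-rightInverse (transpose B)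
    ... | inj₁ (y , (l , yl≉0) , zeros) = contradiction (independent y zeros l) yl≉0
    ... | inj₂ (N , BᵀN≋I) = det B * det (transpose B) ,
      *-nonzero (proj₂ (inverse⇒det≉0 (transpose N) B λ i j →
                  ≈-trans (sum-cong λ k → *-comm (N k i) (B k j)) (≈-trans (BᵀN≋I j i) (I-sym j i))))
                (proj₁ (inverse⇒det≉0 (transpose B) N BᵀN≋I)) ,
      λ x → begin-equality
        det (B ⊗ (pencil a b x ⊗ transpose B))                 ≈⟨ det-⊗ B (pencil a b x ⊗ transpose B) ⟩
        det B * det (pencil a b x ⊗ transpose B)               ≈⟨ *-congˡ (det-⊗ (pencil a b x) (transpose B)) ⟩
        det B * (det (pencil a b x) * det (transpose B))       ≈⟨ solve 3 (λ s x t → s :* (x :* t) := s :* t :* x) ≈-refl (det B) (det (pencil a b x)) (det (transpose B)) ⟩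
        det B * det (transpose B) * det (pencil a b x)         ∎

    -- Both forms pair v to zero with every `W k`, so the first row of the Gram matrix is (x - p , 0
    -- , ... , 0).
    det-gram : ∀ x → det (gram (pencil a b x) B) ≈ (x - p) * det (pencil a′ b′ x)
    det-gram x = begin-equality
      1# * G zero zero * det (minor G zero) + sum (λ j → sign (suc j) * G zero (suc j) * det (minor G (suc j)))
        ≈⟨ +-cong (*-cong (≈-trans (*-identityˡ _) corner) (det-cong {M = minor G zero} {N = pencil a′ b′ x} λ i j → form-pencil a b x (W i) (W j)))
                  (sum-zero λ j → ≈-trans (*-congʳ {det (minor G (suc j))} (≈-trans (*-congˡ {sign (suc j)} (border j)) (zeroʳ (sign (suc j))))) (zeroˡ (det (minor G (suc j))))) ⟩
      (x - p) * det (pencil a′ b′ x) + 0#   ≈⟨ +-identityʳ _ ⟩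
      (x - p) * det (pencil a′ b′ x)        ∎
      where
      G : Matrix (suc n)
      G = gram (pencil a b x) B
      corner : G zero zero ≈ x - p
      corner = begin-equality
        form (pencil a b x) v v          ≈⟨ form-pencil a b x v v ⟩
        x * form b v v - form a v v      ≈⟨ +-cong (*-congˡ unit) (-‿cong (≈-trans (form-a-v v) (*-congˡ unit))) ⟩
        x * 1# - p * 1#                  ≈⟨ +-cong (*-identityʳ x) (-‿cong (*-identityʳ p)) ⟩
        x - p                            ∎
      border : ∀ j → G zero (suc j) ≈ 0#
      border j = begin-equality
        form (pencil a b x) v (W j)              ≈⟨ form-pencil a b x v (W j) ⟩
        x * form b v (W j) - form a v (W j)      ≈⟨ +-cong (*-congˡ (v⊥W j)) (-‿cong (avW j)) ⟩
        x * 0# - 0#                              ≈⟨ solve 1 (λ x → x :* :0 :- :0 := :0) ≈-refl x ⟩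
        0#                                       ∎

    det-deflated : ∀ {c} (λs : Vector ℝ n) → ¬ c ≈ 0# →
                   (∀ x → det (pencil a b x) ≈ c * ((x - p) * product (λ j → x - λs j))) →
                   ∃ λ d → ¬ d ≈ 0# × (∀ x → det (pencil a′ b′ x) ≈ d * product (λ j → x - λs j))
    det-deflated {c} λs c≉0 charpoly = d * c , *-nonzero d≉0 c≉0 , everywhere
      where
      d = proj₁ det-B
      d≉0 = proj₁ (proj₂ det-B)
      P : ℝ → ℝ
      P x = product (λ j → x - λs j)
      off : ∀ x → ¬ x ≈ p → det (pencil a′ b′ x) ≈ d * c * P x
      off x x≉p = *-cancelˡ {x - p} (λ x-p≈0 → x≉p (begin-equality
          x           ≈⟨ solve 2 (λ x p → x := x :- p :+ p) ≈-refl x p ⟩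
          x - p + p   ≈⟨ +-congʳ x-p≈0 ⟩
          0# + p      ≈⟨ +-identityˡ p ⟩
          p           ∎)) (begin-equality
        (x - p) * det (pencil a′ b′ x)   ≈⟨ det-gram x ⟨
        det (gram (pencil a b x) B)      ≈⟨ proj₂ (proj₂ det-B) x ⟩
        d * det (pencil a b x)           ≈⟨ *-congˡ (charpoly x) ⟩
        d * (c * ((x - p) * P x))        ≈⟨ solve 4 (λ d c y z → d :* (c :* (y :* z)) := y :* (d :* c :* z)) ≈-refl d c (x - p) (P x) ⟩
        (x - p) * (d * c * P x)          ∎)
      everywhere : ∀ x → det (pencil a′ b′ x) ≈ d * c * P x
      everywhere x with x ≈? p
      ... | no  x≉p = off x x≉p
      -- Nothing can be cancelled at the root. Both sides are built from x by sums and products, so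
      -- the equality extends to it by continuity.
      ... | yes x≈p = agree-at {x}
        (det-Lipschitz {F = pencil a′ b′} λ i j → +-Lipschitz (*-Lipschitz id-Lipschitz (const-Lipschitz (b′ i j))) (const-Lipschitz (- a′ i j)))
        (*-Lipschitz (const-Lipschitz (d * c)) (product-Lipschitz {F = λ x j → x - λs j} λ j → +-Lipschitz id-Lipschitz (const-Lipschitz (- λs j))))
        (λ y y≉x → off y λ y≈p → y≉x (≈-trans y≈p (≈-sym x≈p)))

    gram-symmetric : ∀ {M} → Symmetric M → Symmetric (gram M W)
    gram-symmetric M-sym i j = form-sym M-sym (W i) (W j)

    inflate : ∀ {λs} → Diagonalisation a′ b′ λs → Diagonalisation a b (p ∷ λs)
    inflate {λs} diag = record { basis = U ; orthonormal = orthonormal ; diagonal = diagonal }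
      where
      module D = Diagonalisation diag
      U : Fin (suc n) → Vector ℝ (suc n)
      U = v ∷ λ j → lin W (D.basis j)
      orthonormal : ∀ i j → form b (U i) (U j) ≈ I i j
      orthonormal zero    zero    = unit
      orthonormal zero    (suc j) = ≈-trans (form-linʳ b v W (D.basis j)) (dot-zeroˡ (D.basis j) v⊥W)
      orthonormal (suc i) zero    = ≈-trans (form-linˡ b W (D.basis i) v) (dot-zeroʳ (D.basis i) W⊥v)
      orthonormal (suc i) (suc j) = ≈-trans (form-lin b W (D.basis i) (D.basis j)) (≈-trans (D.orthonormal i j) (≈-sym (I-suc i j)))
      diagonal : ∀ i j → form a (U i) (U j) ≈ (p ∷ λs) i * I i j
      diagonal zero    zero    = ≈-trans (form-a-v v) (*-congˡ unit)
      diagonal zero    (suc j) = ≈-trans (form-linʳ a v W (D.basis j)) (≈-trans (dot-zeroˡ (D.basis j) avW) (≈-sym (zeroʳ p)))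
      diagonal (suc i) zero    = ≈-trans (form-linˡ a W (D.basis i) v) (≈-trans (dot-zeroʳ (D.basis i) aWv) (≈-sym (zeroʳ (λs i))))
      diagonal (suc i) (suc j) = ≈-trans (form-lin a W (D.basis i) (D.basis j)) (≈-trans (D.diagonal i j) (*-congˡ (≈-sym (I-suc i j))))

  normalise : ∀ {n} {b : Matrix n} → PositiveDefinite b → ∀ y → Nonzero y →
              ∃ λ s → ¬ s ≈ 0# × form b (λ i → s * y i) (λ i → s * y i) ≈ 1#
  normalise {b = b} b-pos y nz = s , s≉0 , (begin-equality
    dot (λ i → s * y i) (λ i → dot (b i) (λ j → s * y j))
      ≈⟨ dot-cong {f = λ i → s * y i} (λ _ → ≈-refl) (λ i → dot-*ʳ (b i) y s) ⟩
    dot (λ i → s * y i) (λ i → s * dot (b i) y)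
      ≈⟨ dot-*ʳ (λ i → s * y i) (λ i → dot (b i) y) s ⟩
    s * dot (λ i → s * y i) (λ i → dot (b i) y)
      ≈⟨ *-congˡ (≈-trans (dot-comm (λ i → s * y i) (λ i → dot (b i) y)) (≈-trans (dot-*ʳ (λ i → dot (b i) y) y s) (*-congˡ (dot-comm (λ i → dot (b i) y) y)))) ⟩
    s * (s * β)           ≈⟨ *-congˡ (*-congˡ (√-square (proj₁ 0<β))) ⟨
    s * (s * (√ β * √ β)) ≈⟨ solve 2 (λ s r → s :* (s :* (r :* r)) := (r :* s) :* (r :* s)) ≈-refl s (√ β) ⟩
    (√ β * s) * (√ β * s) ≈⟨ *-cong (*-inverseʳ √β≉0) (*-inverseʳ √β≉0) ⟩
    1# * 1#               ≈⟨ *-identityˡ 1# ⟩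
    1#                    ∎)
    where
    β s : ℝ
    β = form b y y
    0<β : 0# < β
    0<β = b-pos y nz
    √β≉0 : ¬ √ β ≈ 0#
    √β≉0 √β≈0 = pos⇒≉0 0<β (≈-trans (≈-sym (√-square (proj₁ 0<β))) (≈-trans (*-congʳ √β≈0) (zeroˡ (√ β))))
    s = (√ β) ⁻¹
    s≉0 : ¬ s ≈ 0#
    s≉0 s≈0 = 0≉1 (≈-trans (≈-sym (zeroʳ (√ β))) (≈-trans (*-congˡ (≈-sym s≈0)) (*-inverseʳ √β≉0)))

  -- Induction on the dimension. The constant c absorbs the determinants of the changes of basis,
  -- since a deflated pencil has in general no monic determinant.
  diagonalise : ∀ {n} (a b : Matrix n) → Symmetric a → Symmetric b → PositiveDefinite b →
                ∀ (λs : Vector ℝ n) {c} → ¬ c ≈ 0# →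
                (∀ x → det (pencil a b x) ≈ c * product (λ j → x - λs j)) → Diagonalisation a b λs
  diagonalise {zero} a b _ _ _ λs _ _ = record { basis = λ () ; orthonormal = λ () ; diagonal = λ () }
  diagonalise {suc n} a b a-sym b-sym b-pos λs {c} c≉0 charpoly = record
    -- Splitting on the index lets `p ∷ tail λs` reduce to `λs`.
    { basis = E.basis ; orthonormal = E.orthonormal ; diagonal = λ { zero j → E.diagonal zero j ; (suc i) j → E.diagonal (suc i) j } }
    where
    p = λs zero
    singular : det (pencil a b p) ≈ 0#
    singular = ≈-trans (charpoly p) (≈-trans
      (*-congˡ (≈-trans (*-congʳ (-‿inverseʳ p)) (zeroˡ (product λ j → p - λs (suc j))))) (zeroʳ c))
    kernel = det≈0⇒Kernel (pencil a b p) singular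
    y = proj₁ kernel
    nz = proj₁ (proj₂ kernel)
    scaling = normalise {b = b} b-pos y nz
    s = proj₁ scaling
    eigen-y : ∀ i → dot (a i) y ≈ p * dot (b i) y
    eigen-y i = begin-equality
      dot (a i) y                                        ≈⟨ solve 2 (λ u w → u := w :- (w :- u)) ≈-refl (dot (a i) y) (p * dot (b i) y) ⟩
      p * dot (b i) y - (p * dot (b i) y - dot (a i) y)  ≈⟨ +-congˡ (-‿cong (≈-trans (≈-sym (dot-pencil a b p i y)) (proj₂ (proj₂ kernel) i))) ⟩
      p * dot (b i) y - 0#                               ≈⟨ solve 1 (λ w → w :- :0 := w) ≈-refl (p * dot (b i) y) ⟩
      p * dot (b i) y                                    ∎
    v : Vector ℝ (suc n)
    v j = s * y j
    eigen : ∀ i → dot (a i) v ≈ p * dot (b i) v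
    eigen i = begin-equality
      dot (a i) (λ j → s * y j)        ≈⟨ dot-*ʳ (a i) y s ⟩
      s * dot (a i) y                  ≈⟨ *-congˡ (eigen-y i) ⟩
      s * (p * dot (b i) y)            ≈⟨ solve 3 (λ s p d → s :* (p :* d) := p :* (s :* d)) ≈-refl s p (dot (b i) y) ⟩
      p * (s * dot (b i) y)            ≈⟨ *-congˡ (dot-*ʳ (b i) y s) ⟨
      p * dot (b i) (λ j → s * y j)    ∎
    open Deflation {n} {a} {b} a-sym b-sym {v} (proj₂ (proj₂ scaling)) eigen (proj₁ nz) (*-nonzero (proj₁ (proj₂ scaling)) (proj₂ nz))
    deflated = det-deflated (tail λs) c≉0 charpoly
    module E = Diagonalisation (inflate (diagonalise a′ b′ (gram-symmetric a-sym) (gram-symmetric b-sym) (b′-positive b-pos)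
      (tail λs) (proj₁ (proj₂ deflated)) (proj₂ (proj₂ deflated))))

  -- Courant–Fischer comparison

  -- Stated for m vectors in dimension n so as to serve both a full eigenbasis and the initial
  -- segment of one used in the comparison.
  module Orthonormal {m n} {a b : Matrix n} (W : Fin m → Vector ℝ n) (ν : Vector ℝ m)
                     (orthonormal : ∀ i j → form b (W i) (W j) ≈ I i j)
                     (diagonal : ∀ i j → form a (W i) (W j) ≈ ν i * I i j) where

    form-b-lin : ∀ y → form b (lin W y) (lin W y) ≈ sum (λ i → y i * y i)
    form-b-lin y = ≈-trans (form-lin b W y y) (sum-cong λ i → *-congˡ (≈-trans
      (dot-cong {g = y} (orthonormal i) (λ _ → ≈-refl)) (sum-Iˡ i y)))

    form-a-lin : ∀ y → form a (lin W y) (lin W y) ≈ sum (λ i → ν i * (y i * y i))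
    form-a-lin y = ≈-trans (form-lin a W y y) (sum-cong λ i → begin-equality
      y i * dot (gram a W i) y                 ≈⟨ *-congˡ (sum-cong λ j → ≈-trans (*-congʳ (diagonal i j)) (*-assoc (ν i) (I i j) (y j))) ⟩
      y i * sum (λ j → ν i * (I i j * y j))    ≈⟨ *-congˡ (≈-trans (sum-*ˡ (ν i) (λ j → I i j * y j)) (*-congˡ (sum-Iˡ i y))) ⟩
      y i * (ν i * y i)                        ≈⟨ solve 2 (λ y v → y :* (v :* y) := v :* (y :* y)) ≈-refl (y i) (ν i) ⟩
      ν i * (y i * y i)                        ∎)

  module DiagonalisationProperties {n} {a b : Matrix n} {λs : Vector ℝ n} (diag : Diagonalisation a b λs) where
    open Diagonalisation diag public
    open Orthonormal {a = a} {b} basis λs orthonormal diagonal public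

    coordinate : Vector ℝ n → Vector ℝ n
    coordinate f k = form b (basis k) f

    form-b-basis-lin : ∀ l y → form b (basis l) (lin basis y) ≈ y l
    form-b-basis-lin l y = ≈-trans (form-linʳ b (basis l) basis y)
      (≈-trans (dot-cong {g = y} (orthonormal l) (λ _ → ≈-refl)) (sum-Iˡ l y))

    -- The n + 1 vectors f, basis 0, …, basis (n - 1) are linearly dependent.
    expansion : ∀ f → f ≐ lin basis (coordinate f)
    expansion f i = *-cancelˡ {t} t≉0 (begin-equality
      t * f i                                        ≈⟨ solve 2 (λ u v → u := (u :+ v) :+ :- v) ≈-refl (t * f i) (lin basis y i) ⟩
      (t * f i + lin basis y i) - lin basis y i      ≈⟨ +-cong (relation i) (-‿cong (sum-cong λ k → *-congˡ (y≈ k))) ⟩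
      0# - dot (λ k → basis k i) (λ k → - t * z k)   ≈⟨ +-congˡ (-‿cong (dot-*ʳ (λ k → basis k i) z (- t))) ⟩
      0# - - t * lin basis z i                       ≈⟨ solve 2 (λ t l → :0 :- (:- t) :* l := t :* l) ≈-refl t (lin basis z i) ⟩
      t * lin basis z i                              ∎)
      where
      z = coordinate f
      solution = homogeneous-system n (λ i → f i ∷ λ k → basis k i)
      t : ℝ
      t = proj₁ solution zero
      y : Vector ℝ n
      y = tail (proj₁ solution)
      relation : ∀ i → t * f i + lin basis y i ≈ 0#
      relation i = ≈-trans (+-congʳ (*-comm t (f i))) (proj₂ (proj₂ solution) i)
      y≈ : ∀ l → y l ≈ - t * z l
      y≈ l = begin-equality
        y l                             ≈⟨ solve 3 (λ y t z → y := (t :* z :+ y) :+ (:- t) :* z) ≈-refl (y l) t (z l) ⟩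
        (t * z l + y l) + - t * z l     ≈⟨ +-congʳ (begin-equality
          t * z l + y l
            ≈⟨ +-cong (linear t f) (form-b-basis-lin l y) ⟨
          form b (basis l) (λ i → t * f i) + form b (basis l) (lin basis y)
            ≈⟨ additive (λ i → t * f i) (lin basis y) ⟨
          form b (basis l) (λ i → t * f i + lin basis y i)
            ≈⟨ dot-zeroʳ (basis l) (λ i → dot-zeroʳ (b i) relation) ⟩
          0# ∎) ⟩
        0# + - t * z l                  ≈⟨ +-identityˡ _ ⟩
        - t * z l                       ∎
        where
        linear : ∀ c g → form b (basis l) (λ i → c * g i) ≈ c * form b (basis l) g
        linear c g = ≈-trans (dot-cong {f = basis l} (λ _ → ≈-refl) λ i → dot-*ʳ (b i) g c) (dot-*ʳ (basis l) (λ i → dot (b i) g) c)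
        additive : ∀ g h → form b (basis l) (λ i → g i + h i) ≈ form b (basis l) g + form b (basis l) h
        additive g h = ≈-trans (dot-cong {f = basis l} (λ _ → ≈-refl) λ i → dot-+ʳ (b i) g h) (dot-+ʳ (basis l) (λ i → dot (b i) g) (λ i → dot (b i) h))
      t≉0 : ¬ t ≈ 0#
      t≉0 t≈0 with proj₁ (proj₂ solution)
      ... | zero  , t≉0  = t≉0 t≈0
      ... | suc l , yl≉0 = yl≉0 (≈-trans (y≈ l) (≈-trans (*-congʳ (≈-trans (-‿cong t≈0) -0#≈0#)) (zeroˡ (z l))))

    parseval-b : ∀ f → form b f f ≈ sum (λ k → coordinate f k * coordinate f k)
    parseval-b f = ≈-trans (form-cong b (expansion f) (expansion f)) (form-b-lin (coordinate f))

    parseval-a : ∀ f → form a f f ≈ sum (λ k → λs k * (coordinate f k * coordinate f k))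
    parseval-a f = ≈-trans (form-cong a (expansion f) (expansion f)) (form-a-lin (coordinate f))

  I-injective : ∀ {m n} (ι : Fin m → Fin n) → (∀ {i j} → ι i ≡ ι j → i ≡ j) → ∀ i j → I (ι i) (ι j) ≈ I i j
  I-injective ι inj i j with i ≟ j
  ... | yes ≡.refl = I-diag (ι i)
  ... | no  i≢j    = I-off (i≢j ∘ inj)

  sum-squares-pos : ∀ {n} (y : Vector ℝ n) → Nonzero y → 0# < sum (λ i → y i * y i)
  sum-squares-pos y (i , yi≉0) = ≉0⇒pos (sum-nonneg λ i → square-nonneg (y i)) λ Σ≈0 →
    yi≉0 (square-zero (sum-nonneg-zero (λ i → square-nonneg (y i)) Σ≈0 i))

  module Comparison {n} {a₁ b₁ a₂ b₂ : Matrix n} {λ₁ λ₂ : Vector ℝ n}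
                    (diag₁ : Diagonalisation a₁ b₁ λ₁) (diag₂ : Diagonalisation a₂ b₂ λ₂)
                    (dec₁ : Decreasing λ₁) (dec₂ : Decreasing λ₂)
                    {r} (φ : Fin r → Vector ℝ n) where
    private
      module D₁ = DiagonalisationProperties diag₁
      module D₂ = DiagonalisationProperties diag₂

    -- f lies in the span of the first p + 1 vectors of the first basis and is
    -- orthogonal to the first q vectors of the second one.
    compare : ∀ p q → toℕ p ≡ toℕ q ℕ.+ r → ∃ λ f → 0# < form b₁ f f × (∀ t → dot (φ t) f ≈ 0#) ×
              λ₁ p * form b₁ f f ≤ form a₁ f f × form a₂ f f ≤ λ₂ q * form b₂ f f
    compare p q p≡q+r = f ,
      (≤-respʳ-≈ (≈-sym (S.form-b-lin y)) (proj₁ Σ>0) , λ 0≈ → proj₂ Σ>0 (≈-trans 0≈ (S.form-b-lin y))) ,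
      φ≈0 , lower , upper
      where
      m = toℕ q ℕ.+ r
      m<n : m ℕ.< n
      m<n = ≡.subst (ℕ._< n) p≡q+r (Fin.toℕ<n p)
      ι : Fin (suc m) → Fin n
      ι k = inject≤ k m<n
      W : Fin (suc m) → Vector ℝ n
      W k = D₁.basis (ι k)
      ιq : Fin (toℕ q) → Fin n
      ιq s = inject≤ s (ℕ.<⇒≤ (Fin.toℕ<n q))
      constraint : Fin (toℕ q) ⊎ Fin r → Vector ℝ (suc m)
      constraint = [ (λ s k → form b₂ (D₂.basis (ιq s)) (W k)) , (λ t k → dot (φ t) (W k)) ]′
      -- Orthogonality to q eigenvectors and the r side conditions are m = q + r equations in the m
      -- + 1 coefficients of the initial segment, so a nonzero solution exists.
      solution = homogeneous-system m (λ i → constraint (splitAt (toℕ q) i))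
      y : Vector ℝ (suc m)
      y = proj₁ solution
      Σ>0 = sum-squares-pos y (proj₁ (proj₂ solution))
      f : Vector ℝ n
      f = lin W y
      module S = Orthonormal {a = a₁} {b₁} W (λ k → λ₁ (ι k))
        (λ i j → ≈-trans (D₁.orthonormal (ι i) (ι j)) (I-injective ι (Fin.inject≤-injective m<n m<n _ _) i j))
        (λ i j → ≈-trans (D₁.diagonal (ι i) (ι j)) (*-congˡ (I-injective ι (Fin.inject≤-injective m<n m<n _ _) i j)))
      φ≈0 : ∀ t → dot (φ t) f ≈ 0#
      φ≈0 t = ≈-trans (dot-assoc (φ t) (λ j k → W k j) y) (≈-trans
        (≈-reflexive (≡.cong (λ c → dot (constraint c) y) (≡.sym (Fin.splitAt-↑ʳ (toℕ q) r t))))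
        (proj₂ (proj₂ solution) (toℕ q ↑ʳ t)))
      orthogonal : ∀ s → form b₂ (D₂.basis (ιq s)) f ≈ 0#
      orthogonal s = ≈-trans (form-linʳ b₂ (D₂.basis (ιq s)) W y) (≈-trans
        (≈-reflexive (≡.cong (λ c → dot (constraint c) y) (≡.sym (Fin.splitAt-↑ˡ (toℕ q) s r))))
        (proj₂ (proj₂ solution) (s ↑ˡ r)))
      lower : λ₁ p * form b₁ f f ≤ form a₁ f f
      lower = begin
        λ₁ p * form b₁ f f                          ≈⟨ *-congˡ (S.form-b-lin y) ⟩
        λ₁ p * sum (λ k → y k * y k)                ≈⟨ sum-*ˡ (λ₁ p) (λ k → y k * y k) ⟨
        sum (λ k → λ₁ p * (y k * y k))              ≤⟨ sum-mono (λ k → *-monoˡ-≤ (square-nonneg (y k)) (dec₁ (ι k) p (ι≤p k))) ⟩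
        sum (λ k → λ₁ (ι k) * (y k * y k))          ≈⟨ S.form-a-lin y ⟨
        form a₁ f f                                 ∎
        where
        ι≤p : ∀ k → toℕ (ι k) ℕ.≤ toℕ p
        ι≤p k = ≡.subst₂ ℕ._≤_ (≡.sym (Fin.toℕ-inject≤ k m<n)) (≡.sym p≡q+r) (ℕ.s≤s⁻¹ (Fin.toℕ<n k))
      z = D₂.coordinate f
      upper : form a₂ f f ≤ λ₂ q * form b₂ f f
      upper = begin
        form a₂ f f                                 ≈⟨ D₂.parseval-a f ⟩
        sum (λ k → λ₂ k * (z k * z k))              ≤⟨ sum-mono term ⟩
        sum (λ k → λ₂ q * (z k * z k))              ≈⟨ sum-*ˡ (λ₂ q) (λ k → z k * z k) ⟩
        λ₂ q * sum (λ k → z k * z k)                ≈⟨ *-congˡ (D₂.parseval-b f) ⟨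
        λ₂ q * form b₂ f f                          ∎
        where
        term : ∀ k → λ₂ k * (z k * z k) ≤ λ₂ q * (z k * z k)
        -- Below q the coordinate vanishes by orthogonality; from q on the eigenvalues are at most
        -- λ₂ q.
        term k with toℕ k ℕ.<? toℕ q
        ... | no  k≮q = *-monoˡ-≤ (square-nonneg (z k)) (dec₂ q k (ℕ.≮⇒≥ k≮q))
        ... | yes k<q = ≤-reflexive (≈-trans (zero-term (λ₂ k)) (≈-sym (zero-term (λ₂ q))))
          where
          ιqk≡k : ιq (fromℕ< k<q) ≡ k
          ιqk≡k = Fin.toℕ-injective (≡.trans (Fin.toℕ-inject≤ (fromℕ< k<q) _) (Fin.toℕ-fromℕ< k<q))
          zk≈0 : z k ≈ 0#
          zk≈0 = ≈-trans (≈-reflexive (≡.cong z (≡.sym ιqk≡k))) (orthogonal (fromℕ< k<q))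
          zero-term : ∀ c → c * (z k * z k) ≈ 0#
          zero-term c = ≈-trans (*-congˡ (≈-trans (*-congʳ zk≈0) (zeroˡ (z k)))) (zeroʳ c)

  -- The pencil of the Laplacian and the degree matrix

  degreeMatrix laplacian : ∀ {n} → Graph n → Matrix n
  degreeMatrix G i j = degree G i * I i j
  laplacian G i j = degreeMatrix G i j - adjacency G i j

  volume : ∀ {n} → Graph n → ℝ
  volume G = sum (degree G)

  form-matrix-- : ∀ {n} (M N : Matrix n) f g → form (λ i j → M i j - N i j) f g ≈ form M f g - form N f g
  form-matrix-- M N f g = begin-equality
    dot f (λ i → dot (λ j → M i j - N i j) g)          ≈⟨ dot-cong {f = f} (λ _ → ≈-refl) (λ i → ≈-trans (dot-comm (λ j → M i j - N i j) g)
                                                            (≈-trans (dot--ʳ g (M i) (N i)) (+-cong (dot-comm g (M i)) (-‿cong (dot-comm g (N i)))))) ⟩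
    dot f (λ i → dot (M i) g - dot (N i) g)            ≈⟨ dot--ʳ f (λ i → dot (M i) g) (λ i → dot (N i) g) ⟩
    form M f g - form N f g                            ∎

  0<2 : 0# < 1# + 1#
  0<2 = +-pos 0<1 0≤1

  half-nonneg : ∀ {x} → 0# ≤ (1# + 1#) * x → 0# ≤ x
  half-nonneg 0≤2x = *-cancelˡ-≤ 0<2 (≤-respˡ-≈ (≈-sym (zeroʳ _)) 0≤2x)

  module _ {n} (G : Graph n) where
    private
      A = adjacency G
      d = degree G

    adjacency-edge : ∀ {i j} → T (adj G i j) → A i j ≈ 1#
    adjacency-edge {i} {j} e with adj G i j
    ... | true = ≈-refl

    adjacency-nonneg : ∀ i j → 0# ≤ A i j
    adjacency-nonneg i j with adj G i j
    ... | true  = 0≤1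
    ... | false = ≤-refl

    adjacency-sym : Symmetric A
    adjacency-sym i j = ≈-reflexive (≡.cong (if_then 1# else 0#) (Graph.symmetric G i j))

    degree-nonneg : ∀ i → 0# ≤ d i
    degree-nonneg i = sum-nonneg (adjacency-nonneg i)

    dot-degreeMatrix : ∀ i g → dot (degreeMatrix G i) g ≈ d i * g i
    dot-degreeMatrix i g = begin-equality
      sum (λ j → d i * I i j * g j)      ≈⟨ sum-cong (λ j → *-assoc (d i) (I i j) (g j)) ⟩
      sum (λ j → d i * (I i j * g j))    ≈⟨ sum-*ˡ (d i) (λ j → I i j * g j) ⟩
      d i * sum (λ j → I i j * g j)      ≈⟨ *-congˡ (sum-Iˡ i g) ⟩
      d i * g i                          ∎

    form-degreeMatrix : ∀ f g → form (degreeMatrix G) f g ≈ sum (λ i → d i * (f i * g i))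
    form-degreeMatrix f g = sum-cong λ i → ≈-trans (*-congˡ (dot-degreeMatrix i g))
      (solve 3 (λ f d g → f :* (d :* g) := d :* (f :* g)) ≈-refl (f i) (d i) (g i))

    form-laplacian : ∀ f g → form (laplacian G) f g ≈ form (degreeMatrix G) f g - form A f g
    form-laplacian = form-matrix-- (degreeMatrix G) A

    degreeMatrix-sym : Symmetric (degreeMatrix G)
    degreeMatrix-sym i j with i ≟ j | j ≟ i
    ... | yes ≡.refl | yes _ = ≈-refl
    ... | yes i≡j | no j≢i = contradiction (≡.sym i≡j) j≢i
    ... | no i≢j | yes j≡i = contradiction (≡.sym j≡i) i≢j
    ... | no _ | no _ = ≈-trans (zeroʳ _) (≈-sym (zeroʳ _))

    laplacian-sym : Symmetric (laplacian G)
    laplacian-sym i j = +-cong (degreeMatrix-sym i j) (-‿cong (adjacency-sym i j))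

    -- With σ = ± 1, twice the quadratic form of D ∓ A.
    energy : ℝ → Vector ℝ n → ℝ
    energy σ f = sum λ i → sum λ j → A i j * ((f i - σ * f j) * (f i - σ * f j))

    energy-nonneg : ∀ σ f → 0# ≤ energy σ f
    energy-nonneg σ f = sum-nonneg λ i → sum-nonneg λ j → *-nonneg (adjacency-nonneg i j) (square-nonneg (f i - σ * f j))

    -- Expand the square. Since σ² = 1 and the adjacency matrix is symmetric, the two square terms
    -- both sum to the degree form.
    energy-form : ∀ {σ} → σ * σ ≈ 1# → ∀ f →
                  energy σ f ≈ (1# + 1#) * (form (degreeMatrix G) f f - σ * form A f f)
    energy-form {σ} σσ≈1 f = begin-equality
      sum (λ i → sum λ j → A i j * ((f i - σ * f j) * (f i - σ * f j)))
        ≈⟨ sum-cong (λ i → ≈-trans (sum-cong λ j → ≈-trans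
             (solve 4 (λ a x σ y → a :* ((x :- σ :* y) :* (x :- σ :* y)) := a :* (x :* x) :+ ((σ :* σ) :* (a :* (y :* y)) :- (:1 :+ :1) :* σ :* (x :* (a :* y)))) ≈-refl (A i j) (f i) σ (f j))
             (+-congˡ (+-congʳ (≈-trans (*-congʳ σσ≈1) (*-identityˡ _)))))
             (≈-trans (∑-distrib-+ (λ j → A i j * (f i * f i)) (λ j → A i j * (f j * f j) - (1# + 1#) * σ * (f i * (A i j * f j))))
               (+-cong (sum-*ʳ (f i * f i) (A i))
                 (≈-trans (sum-- (λ j → A i j * (f j * f j)) (λ j → (1# + 1#) * σ * (f i * (A i j * f j))))
                   (+-congˡ (-‿cong (≈-trans (sum-*ˡ ((1# + 1#) * σ) (λ j → f i * (A i j * f j))) (*-congˡ (sum-*ˡ (f i) (λ j → A i j * f j)))))))))) ⟩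
      sum (λ i → d i * (f i * f i) + (sum (λ j → A i j * (f j * f j)) - (1# + 1#) * σ * (f i * dot (A i) f)))
        ≈⟨ ≈-trans (∑-distrib-+ (λ i → d i * (f i * f i)) (λ i → sum (λ j → A i j * (f j * f j)) - (1# + 1#) * σ * (f i * dot (A i) f)))
             (+-congˡ (≈-trans (sum-- (λ i → sum (λ j → A i j * (f j * f j))) (λ i → (1# + 1#) * σ * (f i * dot (A i) f)))
               (+-congˡ (-‿cong (sum-*ˡ ((1# + 1#) * σ) (λ i → f i * dot (A i) f)))))) ⟩
      sum (λ i → d i * (f i * f i)) + (sum (λ i → sum λ j → A i j * (f j * f j)) - (1# + 1#) * σ * form A f f)
        ≈⟨ +-cong (≈-sym (form-degreeMatrix f f)) (+-congʳ (≈-trans (∑-comm (λ i j → A i j * (f j * f j)))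
             (≈-trans (sum-cong λ j → ≈-trans (sum-*ʳ (f j * f j) (λ i → A i j)) (*-congʳ (sum-cong λ i → adjacency-sym i j)))
               (≈-sym (form-degreeMatrix f f))))) ⟩
      form (degreeMatrix G) f f + (form (degreeMatrix G) f f - (1# + 1#) * σ * form A f f)
        ≈⟨ solve 3 (λ b σ a → b :+ (b :- (:1 :+ :1) :* σ :* a) := (:1 :+ :1) :* (b :- σ :* a)) ≈-refl (form (degreeMatrix G) f f) σ (form A f f) ⟩
      (1# + 1#) * (form (degreeMatrix G) f f - σ * form A f f)   ∎

    energy-laplacian : ∀ f → energy 1# f ≈ (1# + 1#) * form (laplacian G) f f
    energy-laplacian f = ≈-trans (energy-form (*-identityˡ 1#) f)
      (*-congˡ (≈-trans (+-congˡ (-‿cong (*-identityˡ _))) (≈-sym (form-laplacian f f))))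

    -- Writes the signless form D + A as 2 D - L. Its nonnegativity is the source of the upper bound
    -- 2 for the eigenvalues.
    energy-signless : ∀ f → energy (- 1#) f ≈ (1# + 1#) * ((1# + 1#) * form (degreeMatrix G) f f - form (laplacian G) f f)
    energy-signless f = ≈-trans (energy-form (solve 0 ((:- :1) :* (:- :1) := :1) ≈-refl) f) (*-congˡ (begin-equality
      b - - 1# * form A f f             ≈⟨ solve 2 (λ b a → b :- (:- :1) :* a := (:1 :+ :1) :* b :- (b :- a)) ≈-refl b (form A f f) ⟩
      (1# + 1#) * b - (b - form A f f)  ≈⟨ +-congˡ (-‿cong (form-laplacian f f)) ⟨
      (1# + 1#) * b - form (laplacian G) f f   ∎))
      where b = form (degreeMatrix G) f f

    laplacian-nonneg : ∀ f → 0# ≤ form (laplacian G) f f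
    laplacian-nonneg f = half-nonneg (≤-respʳ-≈ (energy-laplacian f) (energy-nonneg 1# f))

    laplacian≤2degree : ∀ f → form (laplacian G) f f ≤ (1# + 1#) * form (degreeMatrix G) f f
    laplacian≤2degree f = 0≤y-x⇒x≤y (half-nonneg (≤-respʳ-≈ (energy-signless f) (energy-nonneg (- 1#) f)))

    module _ (connected : Connected G) where

      -- The energy is a sum of nonnegative terms, so each edge term vanishes; equality then
      -- propagates along walks.
      laplacian-zero⇒constant : ∀ f → form (laplacian G) f f ≈ 0# → ∀ i j → f i ≈ f j
      laplacian-zero⇒constant f Lff≈0 i j = walk (connected i j)
        where
        energy≈0 : energy 1# f ≈ 0#
        energy≈0 = ≈-trans (energy-laplacian f) (≈-trans (*-congˡ Lff≈0) (zeroʳ _))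
        term≈0 : ∀ i j → A i j * ((f i - 1# * f j) * (f i - 1# * f j)) ≈ 0#
        term≈0 i = sum-nonneg-zero (λ j → *-nonneg (adjacency-nonneg i j) (square-nonneg (f i - 1# * f j)))
          (sum-nonneg-zero (λ i → sum-nonneg λ j → *-nonneg (adjacency-nonneg i j) (square-nonneg (f i - 1# * f j))) energy≈0 i)
        edge : ∀ {i j} → T (adj G i j) → f i ≈ f j
        edge {i} {j} e = begin-equality
          f i                        ≈⟨ solve 2 (λ x y → x := (x :- :1 :* y) :+ y) ≈-refl (f i) (f j) ⟩
          (f i - 1# * f j) + f j     ≈⟨ +-congʳ (square-zero (≈-trans (≈-sym (≈-trans (*-congʳ (adjacency-edge e)) (*-identityˡ _))) (term≈0 i j))) ⟩
          0# + f j                   ≈⟨ +-identityˡ _ ⟩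
          f j                        ∎
        walk : ∀ {i j} → Star (Graph._~_ G) i j → f i ≈ f j
        walk ε        = ≈-refl
        walk (e ◅ es) = ≈-trans (edge e) (walk es)

  -- With at least two vertices there is a walk from i to a different vertex, and its first edge is
  -- incident to i.
  degree-positive : ∀ {k} (G : Graph (suc (suc k))) → Connected G → ∀ i → 0# < degree G i
  degree-positive G connected i = from-walk (connected i (other i)) (other≢ i)
    where
    other : ∀ {k} → Fin (suc (suc k)) → Fin (suc (suc k))
    other zero    = suc zero
    other (suc i) = zero
    other≢ : ∀ {k} (i : Fin (suc (suc k))) → i ≢ other i
    other≢ zero    ()
    other≢ (suc i) ()
    from-walk : ∀ {i j} → Star (Graph._~_ G) i j → i ≢ j → 0# < degree G i
    from-walk ε i≢i = contradiction ≡.refl i≢i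
    from-walk {i} (_◅_ {j = j} e _) _ = ≉0⇒pos (degree-nonneg G i) λ d≈0 → 1≉0 (begin-equality
      1#                ≈⟨ adjacency-edge G e ⟨
      adjacency G i j   ≈⟨ sum-nonneg-zero (adjacency-nonneg G i) d≈0 j ⟩
      0#                ∎)

  -- Spectrum of the normalized Laplacian

  degreeMatrix-positive : ∀ {n} (G : Graph n) → (∀ i → 0# < degree G i) → PositiveDefinite (degreeMatrix G)
  degreeMatrix-positive G degree-pos f (l , fl≉0) = ≉0⇒pos
    (≤-respʳ-≈ (≈-sym (form-degreeMatrix G f f)) (sum-nonneg nonneg))
    λ form≈0 → fl≉0 (square-zero (product-zero
      (sum-nonneg-zero nonneg (≈-trans (≈-sym (form-degreeMatrix G f f)) form≈0) l)
      (pos⇒≉0 (degree-pos l))))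
    where
    nonneg : ∀ i → 0# ≤ degree G i * (f i * f i)
    nonneg i = *-nonneg (degree-nonneg G i) (square-nonneg (f i))

  -- x D - L = √D (x I - 𝓛) √D
  pencil-determinant : ∀ {n} (G : Graph n) → (∀ i → 0# < degree G i) → ∃ λ c → ¬ c ≈ 0# ×
    (∀ x → det (pencil (laplacian G) (degreeMatrix G) x) ≈ c * det (λ i j → x * I i j - normalizedLaplacian G i j))
  pencil-determinant {n} G degree-pos = det S * det S , *-nonzero detS≉0 detS≉0 , λ x → begin-equality
    det (pencil (laplacian G) (degreeMatrix G) x)      ≈⟨ det-cong (λ i j → ≈-sym (scaled x i j)) ⟩
    det (S ⊗ (N x ⊗ S))                                ≈⟨ ≈-trans (det-⊗ S (N x ⊗ S)) (*-congˡ (det-⊗ (N x) S)) ⟩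
    det S * (det (N x) * det S)                        ≈⟨ solve 2 (λ s n → s :* (n :* s) := s :* s :* n) ≈-refl (det S) (det (N x)) ⟩
    det S * det S * det (N x)                          ∎
    where
    d s : Vector ℝ n
    d = degree G
    s i = √ (d i)
    A S S⁻¹ : Matrix n
    A = adjacency G
    S i j = s i * I i j
    S⁻¹ i j = s i ⁻¹ * I i j
    N : ℝ → Matrix n
    N x i j = x * I i j - normalizedLaplacian G i j
    ss≈d : ∀ i → s i * s i ≈ d i
    ss≈d i = √-square (degree-nonneg G i)
    s≉0 : ∀ i → ¬ s i ≈ 0#
    s≉0 i s≈0 = pos⇒≉0 (degree-pos i) (≈-trans (≈-sym (ss≈d i)) (≈-trans (*-congʳ s≈0) (zeroˡ (s i))))
    row-scale : ∀ i (M : Matrix n) j → (S ⊗ M) i j ≈ s i * M i j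
    row-scale i M j = ≈-trans (sum-cong λ l → *-assoc (s i) (I i l) (M l j))
      (≈-trans (sum-*ˡ (s i) (λ l → I i l * M l j)) (*-congˡ (sum-Iˡ i (λ l → M l j))))
    column-scale : ∀ (M : Matrix n) i j → (M ⊗ S) i j ≈ M i j * s j
    column-scale M i j = ≈-trans (sum-cong λ l → ≈-sym (*-assoc (M i l) (s l) (I l j))) (sum-Iʳ j (λ l → M i l * s l))
    detS≉0 : ¬ det S ≈ 0#
    detS≉0 = proj₁ (inverse⇒det≉0 S S⁻¹ λ i j → ≈-trans (row-scale i S⁻¹ j)
      (≈-trans (≈-sym (*-assoc (s i) (s i ⁻¹) (I i j))) (≈-trans (*-congʳ (*-inverseʳ (s≉0 i))) (*-identityˡ _))))
    diagonal-entry : ∀ i j → s i * I i j * s j ≈ d i * I i j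
    diagonal-entry i j with i ≟ j
    ... | yes ≡.refl = ≈-trans (*-congʳ (*-identityʳ (s i))) (≈-trans (ss≈d i) (≈-sym (*-identityʳ (d i))))
    ... | no  _      = solve 3 (λ s t d → s :* :0 :* t := d :* :0) ≈-refl (s i) (s j) (d i)
    scaled : ∀ x i j → (S ⊗ (N x ⊗ S)) i j ≈ pencil (laplacian G) (degreeMatrix G) x i j
    scaled x i j = begin-equality
      (S ⊗ (N x ⊗ S)) i j        ≈⟨ ≈-trans (row-scale i (N x ⊗ S) j) (*-congˡ (column-scale (N x) i j)) ⟩
      s i * (N x i j * s j)      ≈⟨ solve 5 (λ s e w t x → s :* ((x :* e :- (e :- w)) :* t) := x :* (s :* e :* t) :- (s :* e :* t :- s :* w :* t)) ≈-refl
                                      (s i) (I i j) (s i ⁻¹ * A i j * s j ⁻¹) (s j) x ⟩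
      x * (s i * I i j * s j) - (s i * I i j * s j - s i * (s i ⁻¹ * A i j * s j ⁻¹) * s j)
        ≈⟨ +-congˡ (-‿cong (+-congˡ (-‿cong (solve 5 (λ s u a v t → s :* (u :* a :* v) :* t := s :* u :* a :* (t :* v)) ≈-refl (s i) (s i ⁻¹) (A i j) (s j ⁻¹) (s j))))) ⟩
      x * (s i * I i j * s j) - (s i * I i j * s j - s i * s i ⁻¹ * A i j * (s j * s j ⁻¹))
        ≈⟨ +-cong (*-congˡ (diagonal-entry i j)) (-‿cong (+-cong (diagonal-entry i j) (-‿cong
             (≈-trans (*-cong (≈-trans (*-congʳ (*-inverseʳ (s≉0 i))) (*-identityˡ _)) (*-inverseʳ (s≉0 j))) (*-identityʳ _))))) ⟩
      x * (d i * I i j) - (d i * I i j - A i j)   ∎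

  diagonalisation : ∀ {n} (G : Graph n) → (∀ i → 0# < degree G i) → ∀ {λs} →
                    AreEigenvalues (normalizedLaplacian G) λs → Diagonalisation (laplacian G) (degreeMatrix G) λs
  diagonalisation G degree-pos {λs} eigenvalues = let c , c≉0 , pencil-det = pencil-determinant G degree-pos in
    diagonalise (laplacian G) (degreeMatrix G) (laplacian-sym G) (degreeMatrix-sym G) (degreeMatrix-positive G degree-pos)
      λs c≉0 λ x → ≈-trans (pencil-det x) (*-congˡ (eigenvalues x))

  module Spectrum {n} (G : Graph n) (connected : Connected G) {λs : Vector ℝ n}
                  (diag : Diagonalisation (laplacian G) (degreeMatrix G) λs) where

    open DiagonalisationProperties diag public

    form-basis : ∀ i → form (degreeMatrix G) (basis i) (basis i) ≈ 1#
    form-basis i = ≈-trans (orthonormal i i) (I-diag i)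

    eigenvalue-form : ∀ i → form (laplacian G) (basis i) (basis i) ≈ λs i
    eigenvalue-form i = ≈-trans (diagonal i i) (≈-trans (*-congˡ (I-diag i)) (*-identityʳ (λs i)))

    eigenvalue-nonneg : ∀ i → 0# ≤ λs i
    eigenvalue-nonneg i = ≤-respʳ-≈ (eigenvalue-form i) (laplacian-nonneg G (basis i))

    eigenvalue≤2 : ∀ i → λs i ≤ 1# + 1#
    eigenvalue≤2 i = ≤-respˡ-≈ (eigenvalue-form i) (≤-respʳ-≈ (≈-trans (*-congˡ (form-basis i)) (*-identityʳ _))
      (laplacian≤2degree G (basis i)))

    kernel-constant : ∀ {i} → λs i ≈ 0# → ∀ u v → basis i u ≈ basis i v
    kernel-constant {i} λ≈0 = laplacian-zero⇒constant G connected (basis i) (≈-trans (eigenvalue-form i) λ≈0)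

    form-constants : ∀ w {f g : Vector ℝ n} → (∀ u v → f u ≈ f v) → (∀ u v → g u ≈ g v) →
                     form (degreeMatrix G) f g ≈ f w * g w * volume G
    form-constants w {f} {g} cf cg = ≈-trans (form-degreeMatrix G f g) (≈-trans
      (sum-cong λ i → ≈-trans (*-congˡ (*-cong (cf i w) (cg i w))) (*-comm (degree G i) (f w * g w)))
      (sum-*ˡ (f w * g w) (degree G)))

    -- A second zero eigenvalue would give two constant basis vectors with values x and y.
    -- Orthonormality requires x² V = y² V = 1 and x y V = 0 for the volume V, and squaring the last
    -- equation yields 0 = 1.
    eigenvalue-positive : ∀ {last} → λs last ≈ 0# → ∀ {i} → i ≢ last → 0# < λs i
    eigenvalue-positive {last} last≈0 {i} i≢last = ≉0⇒pos (eigenvalue-nonneg i) λ λi≈0 →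
      let
        cᵢ = kernel-constant λi≈0
        cₗ = kernel-constant last≈0
        unit : ∀ l → (∀ u v → basis l u ≈ basis l v) → basis l last * basis l last * volume G ≈ 1#
        unit l c = ≈-trans (≈-sym (form-constants last c c)) (form-basis l)
        x = basis i last
        y = basis last last
      in 0≉1 (begin-equality
        0#                                                  ≈⟨ zeroˡ _ ⟨
        0# * (x * y * volume G)                             ≈⟨ *-congʳ (≈-trans (≈-sym (form-constants last cᵢ cₗ)) (≈-trans (orthonormal i last) (I-off i≢last))) ⟨
        x * y * volume G * (x * y * volume G)               ≈⟨ solve 3 (λ x y v → x :* y :* v :* (x :* y :* v) := (x :* x :* v) :* (y :* y :* v)) ≈-refl x y (volume G) ⟩
        (x * x * volume G) * (y * y * volume G)             ≈⟨ *-cong (unit i cᵢ) (unit last cₗ) ⟩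
        1# * 1#                                             ≈⟨ *-identityˡ 1# ⟩
        1#                                                  ∎)

  -- Interlacing

  module EdgeDeletion {n} (G H : Graph n) (subgraph : SpanningSubgraph H G) where

    deleted : List (Fin n × Fin n)
    deleted = deletedEdges G H

    -- Represents the functional f ↦ f u - σ f v of a deleted edge uv. Indexing by list positions
    -- makes the number of constraints equal to the length that `ObtainedByDeleting` counts.
    constraint : ℝ → Fin (length deleted) → Vector ℝ n
    constraint σ t i = I (proj₁ (lookup deleted t)) i - σ * I (proj₂ (lookup deleted t)) i

    dot-constraint : ∀ σ t f → dot (constraint σ t) f ≈ f (proj₁ (lookup deleted t)) - σ * f (proj₂ (lookup deleted t))
    dot-constraint σ t f = ≈-trans (dot-comm (constraint σ t) f) (≈-trans
      (dot--ʳ f (I u) (λ i → σ * I v i))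
      (+-cong (dot-Iʳ f u) (-‿cong (≈-trans (dot-*ʳ f (I v) σ) (*-congˡ (dot-Iʳ f v))))))
      where
      u = proj₁ (lookup deleted t)
      v = proj₂ (lookup deleted t)

    deleted-edge : ∀ {u v} → toℕ u ℕ.< toℕ v → T (adj G u v) → ¬ T (adj H u v) → (u , v) ∈ deleted
    deleted-edge {u} {v} u<v uv∈G uv∉H = ∈-filter⁺ _ (∈-cartesianProduct⁺ (∈-allFin u) (∈-allFin v))
      (Equivalence.from T-∧ (ℕ.<⇒<ᵇ u<v , Equivalence.from T-∧ (uv∈G , not-T uv∉H)))
      where
      not-T : ∀ {x} → ¬ T x → T (not x)
      not-T {true}  ¬Tx = ¬Tx tt
      not-T {false} ¬Tx = tt

    module _ {σ} (σσ≈1 : σ * σ ≈ 1#) {f : Vector ℝ n} (constrained : ∀ t → dot (constraint σ t) f ≈ 0#) where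

      vanishes-on-listed : ∀ {u v} → toℕ u ℕ.< toℕ v → T (adj G u v) → ¬ T (adj H u v) → f u - σ * f v ≈ 0#
      vanishes-on-listed u<v uv∈G uv∉H = ≈-trans
        (≈-reflexive (≡.cong (λ e → f (proj₁ e) - σ * f (proj₂ e)) (lookup-index uv∈deleted)))
        (≈-trans (≈-sym (dot-constraint σ (index uv∈deleted) f)) (constrained (index uv∈deleted)))
        where uv∈deleted = deleted-edge u<v uv∈G uv∉H

      -- The list holds only the orientation u < v. Because σ² = 1, the condition for the reversed
      -- pair is - σ times the listed one.
      vanishes-on-deleted : ∀ u v → T (adj G u v) → ¬ T (adj H u v) → f u - σ * f v ≈ 0#
      vanishes-on-deleted u v uv∈G uv∉H with ℕ.<-cmp (toℕ u) (toℕ v)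
      ... | tri< u<v _ _ = vanishes-on-listed u<v uv∈G uv∉H
      ... | tri≈ _ u≡v _ = contradiction (≡.subst T (Graph.loopless G v) (≡.subst (λ w → T (adj G w v)) (Fin.toℕ-injective u≡v) uv∈G)) λ ()
      ... | tri> _ _ v<u = begin-equality
        f u - σ * f v               ≈⟨ +-congʳ (≈-trans (*-congʳ σσ≈1) (*-identityˡ (f u))) ⟨
        σ * σ * f u - σ * f v       ≈⟨ solve 3 (λ σ u v → σ :* σ :* u :- σ :* v := (:- σ) :* (v :- σ :* u)) ≈-refl σ (f u) (f v) ⟩
        - σ * (f v - σ * f u)       ≈⟨ *-congˡ (vanishes-on-listed v<u (≡.subst T (Graph.symmetric G u v) uv∈G) (uv∉H ∘ ≡.subst T (Graph.symmetric H v u))) ⟩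
        - σ * 0#                    ≈⟨ zeroʳ _ ⟩
        0#                          ∎

      -- Common edges contribute equally to both sides, and on a deleted edge the squared factor is
      -- zero.
      energy-constrained : energy G σ f ≈ energy H σ f
      energy-constrained = sum-cong λ i → sum-cong λ j → edge i j
        where
        edge : ∀ i j → adjacency G i j * ((f i - σ * f j) * (f i - σ * f j)) ≈ adjacency H i j * ((f i - σ * f j) * (f i - σ * f j))
        edge i j with adj G i j in ijG | adj H i j in ijH
        ... | true  | true  = ≈-refl
        ... | false | false = ≈-refl
        ... | false | true  = contradiction (≡.subst T ijG (subgraph i j (≡.subst T (≡.sym ijH) tt))) λ ()
        ... | true  | false = ≈-trans (*-congˡ x²≈0) (≈-trans (zeroʳ 1#) (≈-sym (≈-trans (*-congˡ x²≈0) (zeroʳ 0#))))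
          where
          x≈0 : f i - σ * f j ≈ 0#
          x≈0 = vanishes-on-deleted i j (≡.subst T (≡.sym ijG) tt) λ ij∈H → ≡.subst T ijH ij∈H
          x²≈0 : (f i - σ * f j) * (f i - σ * f j) ≈ 0#
          x²≈0 = ≈-trans (*-congʳ x≈0) (zeroˡ _)

    adjacency-mono : ∀ i j → adjacency H i j ≤ adjacency G i j
    adjacency-mono i j with adj G i j in ijG | adj H i j in ijH
    ... | true  | true  = ≤-refl
    ... | true  | false = 0≤1
    ... | false | false = ≤-refl
    ... | false | true  = contradiction (≡.subst T ijG (subgraph i j (≡.subst T (≡.sym ijH) tt))) λ ()

    form-degreeMatrix-mono : ∀ f → form (degreeMatrix H) f f ≤ form (degreeMatrix G) f f
    form-degreeMatrix-mono f = ≤-respˡ-≈ (≈-sym (form-degreeMatrix H f f)) (≤-respʳ-≈ (≈-sym (form-degreeMatrix G f f))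
      (sum-mono λ i → *-monoˡ-≤ (square-nonneg (f i)) (sum-mono (adjacency-mono i))))

  module Interlacing {n} (G H : Graph n) (connectedG : Connected G) (connectedH : Connected H)
                     (subgraph : SpanningSubgraph H G) {μ θ : Vector ℝ n}
                     (diagG : Diagonalisation (laplacian G) (degreeMatrix G) μ) (μ-decreasing : Decreasing μ)
                     (diagH : Diagonalisation (laplacian H) (degreeMatrix H) θ) (θ-decreasing : Decreasing θ) where
    open EdgeDeletion G H subgraph
    private
      module SG = Spectrum G connectedG diagG
      module SH = Spectrum H connectedH diagH
      bG = form (degreeMatrix G)
      bH = form (degreeMatrix H)
      aG = form (laplacian G)
      aH = form (laplacian H)

    -- On vectors with f u = f v along deleted edges the two Laplacians agree.
    interlacing-upper : ∀ p q → toℕ p ≡ toℕ q ℕ.+ length deleted → μ p ≤ θ q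
    interlacing-upper p q p≡q+r =
      let f , 0<b , φ≈0 , lower , upper = Comparison.compare diagG diagH μ-decreasing θ-decreasing (constraint 1#) p q p≡q+r
      in bound f 0<b φ≈0 lower upper
      where
      bound : ∀ f → 0# < bG f f → (∀ t → dot (constraint 1# t) f ≈ 0#) →
              μ p * bG f f ≤ aG f f → aH f f ≤ θ q * bH f f → μ p ≤ θ q
      bound f 0<b φ≈0 lower upper = *-cancelˡ-≤ 0<b (begin
        bG f f * μ p          ≈⟨ *-comm (bG f f) (μ p) ⟩
        μ p * bG f f          ≤⟨ lower ⟩
        aG f f                ≈⟨ *-cancelˡ (pos⇒≉0 0<2) (≈-trans (≈-sym (energy-laplacian G f)) (≈-trans (energy-constrained (*-identityˡ 1#) {f} φ≈0) (energy-laplacian H f))) ⟩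
        aH f f                ≤⟨ upper ⟩
        θ q * bH f f          ≤⟨ *-monoʳ-≤ (SH.eigenvalue-nonneg q) (form-degreeMatrix-mono f) ⟩
        θ q * bG f f          ≈⟨ *-comm (θ q) (bG f f) ⟩
        bG f f * θ q          ∎)

    -- On vectors with f u = - f v along deleted edges, passing from H to G adds
    -- 2 s to the Laplacian form and s to the degree form.
    interlacing-lower : ∀ p q → toℕ p ≡ toℕ q ℕ.+ length deleted → θ p ≤ μ q
    interlacing-lower p q p≡q+r =
      let f , 0<b , φ≈0 , lower , upper = Comparison.compare diagH diagG θ-decreasing μ-decreasing (constraint (- 1#)) p q p≡q+r
      in bound f 0<b φ≈0 lower upper
      where
      bound : ∀ f → 0# < bH f f → (∀ t → dot (constraint (- 1#) t) f ≈ 0#) →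
              θ p * bH f f ≤ aH f f → aG f f ≤ μ q * bG f f → θ p ≤ μ q
      bound f 0<b φ≈0 lower upper = *-cancelˡ-≤ (pos-≤-trans 0<b (form-degreeMatrix-mono f)) (begin
        bG f f * θ p                        ≈⟨ solve 3 (λ g h t → g :* t := t :* h :+ t :* (g :- h)) ≈-refl (bG f f) (bH f f) (θ p) ⟩
        θ p * bH f f + θ p * s              ≤⟨ +-mono-≤ lower (*-monoˡ-≤ (x≤y⇒0≤y-x (form-degreeMatrix-mono f)) (SH.eigenvalue≤2 p)) ⟩
        aH f f + (1# + 1#) * s              ≈⟨ solve 3 (λ a g h → a :+ (:1 :+ :1) :* (g :- h) := (:1 :+ :1) :* g :- ((:1 :+ :1) :* h :- a)) ≈-refl (aH f f) (bG f f) (bH f f) ⟩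
        (1# + 1#) * bG f f - ((1# + 1#) * bH f f - aH f f)   ≈⟨ +-congˡ (-‿cong signless) ⟨
        (1# + 1#) * bG f f - ((1# + 1#) * bG f f - aG f f)   ≈⟨ solve 2 (λ x a → x :- (x :- a) := a) ≈-refl ((1# + 1#) * bG f f) (aG f f) ⟩
        aG f f                              ≤⟨ upper ⟩
        μ q * bG f f                        ≈⟨ *-comm (μ q) (bG f f) ⟩
        bG f f * μ q                        ∎)
        where
        s : ℝ
        s = bG f f - bH f f
        -- Each side is half the energy for σ = - 1, which the deletion leaves unchanged on
        -- constrained vectors.
        signless : (1# + 1#) * bG f f - aG f f ≈ (1# + 1#) * bH f f - aH f f
        signless = *-cancelˡ (pos⇒≉0 0<2) (≈-trans (≈-sym (energy-signless G f))
          (≈-trans (energy-constrained (solve 0 ((:- :1) :* (:- :1) := :1) ≈-refl) {f} φ≈0) (energy-signless H f)))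

  open import Algebra.Properties.Semiring.Mult semiring using (×-assoc-*; ×-congʳ)

  -- Limits

  -- Convergence with weak inequalities, which add and scale directly by the monotonicity laws.
  Limit : (ℕ → ℝ) → ℝ → Set
  Limit s l = ∀ ϵ → 0# < ϵ → ∃ λ N → ∀ k → N ℕ.≤ k → l - ϵ ≤ s k × s k ≤ l + ϵ

  convergesTo⇒Limit : ∀ {s l} → ConvergesTo s l → Limit s l
  convergesTo⇒Limit conv ϵ 0<ϵ = let N , near = conv ϵ 0<ϵ in
    N , λ k N≤k → proj₁ (proj₁ (near k N≤k)) , proj₁ (proj₂ (near k N≤k))

  divide : ∀ ϵ {c} → 0# < ϵ → 0# < c → ∃ λ δ → 0# < δ × c * δ ≈ ϵ
  divide ϵ {c} 0<ϵ 0<c = ϵ * c ⁻¹ , *-pos 0<ϵ (⁻¹-pos 0<c) , (begin-equality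
    c * (ϵ * c ⁻¹)   ≈⟨ solve 3 (λ c ϵ i → c :* (ϵ :* i) := c :* i :* ϵ) ≈-refl c ϵ (c ⁻¹) ⟩
    c * c ⁻¹ * ϵ     ≈⟨ *-congʳ (*-inverseʳ (pos⇒≉0 0<c)) ⟩
    1# * ϵ           ≈⟨ *-identityˡ ϵ ⟩
    ϵ                ∎)

  0<1+ : ∀ {c} → 0# ≤ c → 0# < 1# + c
  0<1+ 0≤c = +-pos 0<1 0≤c

  Limit-cong : ∀ {s t l m} → (∀ k → s k ≈ t k) → l ≈ m → Limit s l → Limit t m
  Limit-cong s≈t l≈m lim ϵ 0<ϵ = let N , near = lim ϵ 0<ϵ in N , λ k N≤k →
    ≤-respʳ-≈ (s≈t k) (≤-respˡ-≈ (+-congʳ l≈m) (proj₁ (near k N≤k))) ,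
    ≤-respˡ-≈ (s≈t k) (≤-respʳ-≈ (+-congʳ l≈m) (proj₂ (near k N≤k)))

  Limit-const : ∀ c → Limit (λ _ → c) c
  Limit-const c ϵ (0≤ϵ , _) = 0 , λ _ _ →
    nonneg-diff ϵ 0≤ϵ (solve 2 (λ c ϵ → c :- (c :- ϵ) := ϵ) ≈-refl c ϵ) ,
    nonneg-diff ϵ 0≤ϵ (solve 2 (λ c ϵ → (c :+ ϵ) :- c := ϵ) ≈-refl c ϵ)

  Limit-shift : ∀ {s l} → Limit s l → Limit (λ k → s (suc k)) l
  Limit-shift lim ϵ 0<ϵ = let N , near = lim ϵ 0<ϵ in N , λ k N≤k → near (suc k) (ℕ.m≤n⇒m≤1+n N≤k)

  Limit-+ : ∀ {s t l m} → Limit s l → Limit t m → Limit (λ k → s k + t k) (l + m)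
  Limit-+ {s} {t} {l} {m} lim₁ lim₂ ϵ 0<ϵ with divide ϵ 0<ϵ (0<1+ 0≤1)
  ... | δ , 0<δ , 2δ≈ϵ with lim₁ δ 0<δ | lim₂ δ 0<δ
  ...   | N₁ , near₁ | N₂ , near₂ = N₁ ℕ.⊔ N₂ , λ k N≤k →
    let N₁≤k = ℕ.≤-trans (ℕ.m≤m⊔n N₁ N₂) N≤k
        N₂≤k = ℕ.≤-trans (ℕ.m≤n⊔m N₁ N₂) N≤k
    in ≤-respˡ-≈ (≈-trans (solve 3 (λ l m δ → (l :- δ) :+ (m :- δ) := (l :+ m) :- (:1 :+ :1) :* δ) ≈-refl l m δ) (+-congˡ (-‿cong 2δ≈ϵ)))
         (+-mono-≤ (proj₁ (near₁ k N₁≤k)) (proj₁ (near₂ k N₂≤k))) ,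
       ≤-respʳ-≈ (≈-trans (solve 3 (λ l m δ → (l :+ δ) :+ (m :+ δ) := (l :+ m) :+ (:1 :+ :1) :* δ) ≈-refl l m δ) (+-congˡ 2δ≈ϵ))
         (+-mono-≤ (proj₂ (near₁ k N₁≤k)) (proj₂ (near₂ k N₂≤k)))

  neg-antitone : ∀ {x y} → x ≤ y → - y ≤ - x
  neg-antitone {x} {y} x≤y = nonneg-diff (y - x) (x≤y⇒0≤y-x x≤y) (solve 2 (λ x y → (:- x) :- (:- y) := y :- x) ≈-refl x y)

  Limit-neg : ∀ {s l} → Limit s l → Limit (λ k → - s k) (- l)
  Limit-neg {s} {l} lim ϵ 0<ϵ = let N , near = lim ϵ 0<ϵ in N , λ k N≤k →
    ≤-respˡ-≈ (solve 2 (λ l ϵ → :- (l :+ ϵ) := (:- l) :- ϵ) ≈-refl l ϵ) (neg-antitone (proj₂ (near k N≤k))) ,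
    ≤-respʳ-≈ (solve 2 (λ l ϵ → :- (l :- ϵ) := (:- l) :+ ϵ) ≈-refl l ϵ) (neg-antitone (proj₁ (near k N≤k)))

  -- The tolerance is δ = ϵ / (1 + c) rather than ϵ / c, which covers c = 0; both estimates then
  -- hold with δ to spare.
  Limit-* : ∀ {s l c} → 0# ≤ c → Limit s l → Limit (λ k → c * s k) (c * l)
  Limit-* {s} {l} {c} 0≤c lim ϵ 0<ϵ with divide ϵ 0<ϵ (0<1+ 0≤c)
  ... | δ , 0<δ , [1+c]δ≈ϵ with lim δ 0<δ
  ...   | N , near = N , λ k N≤k →
    ≤-trans (nonneg-diff δ (proj₁ 0<δ) (≈-trans (+-congˡ (-‿cong (+-congˡ (-‿cong (≈-sym [1+c]δ≈ϵ)))))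
              (solve 3 (λ c l δ → c :* (l :- δ) :- (c :* l :- (:1 :+ c) :* δ) := δ) ≈-refl c l δ)))
            (*-monoʳ-≤ 0≤c (proj₁ (near k N≤k))) ,
    ≤-trans (*-monoʳ-≤ 0≤c (proj₂ (near k N≤k)))
            (nonneg-diff δ (proj₁ 0<δ) (≈-trans (+-congʳ (+-congˡ (≈-sym [1+c]δ≈ϵ)))
              (solve 3 (λ c l δ → (c :* l :+ (:1 :+ c) :* δ) :- c :* (l :+ δ) := δ) ≈-refl c l δ)))

  Limit-sum : ∀ {n} {s : Fin n → ℕ → ℝ} {l : Vector ℝ n} → (∀ i → Limit (s i) (l i)) →
              Limit (λ k → sum λ i → s i k) (sum l)
  Limit-sum {zero}  lim = Limit-const 0#
  Limit-sum {suc n} lim = Limit-+ (lim zero) (Limit-sum (lim ∘ suc))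

  Limit-unique : ∀ {s l m} → Limit s l → Limit s m → l ≈ m
  Limit-unique lim₁ lim₂ = antisym (below lim₁ lim₂) (below lim₂ lim₁)
    where
    below : ∀ {s l m} → Limit s l → Limit s m → l ≤ m
    below {s} {l} {m} lim₁ lim₂ with total l m
    ... | inj₁ l≤m = l≤m
    ... | inj₂ m≤l with l ≈? m
    ...   | yes l≈m = ≤-reflexive l≈m
    -- A third of the gap: l - δ exceeds m + δ by δ, so no term of the sequence can be δ-close to
    -- both.
    ...   | no  l≉m with divide (l - m) (≉0⇒pos (x≤y⇒0≤y-x m≤l) λ l-m≈0 → l≉m (begin-equality
                      l          ≈⟨ solve 2 (λ l m → l := (l :- m) :+ m) ≈-refl l m ⟩
                      l - m + m  ≈⟨ +-congʳ l-m≈0 ⟩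
                      0# + m     ≈⟨ +-identityˡ m ⟩
                      m          ∎)) (0<1+ 0≤2)
    ...     | δ , 0<δ , 3δ≈l-m with lim₁ δ 0<δ | lim₂ δ 0<δ
    ...       | N₁ , near₁ | N₂ , near₂ = contradiction
      (≤-respˡ-≈ (≈-trans (+-congʳ (≈-trans (solve 2 (λ l m → l := (l :- m) :+ m) ≈-refl l m) (+-congʳ (≈-sym 3δ≈l-m))))
                          (solve 2 (λ m δ → ((:1 :+ (:1 :+ :1)) :* δ :+ m) :- δ := (m :+ δ) :+ δ) ≈-refl m δ))
        (≤-trans (proj₁ (near₁ (N₁ ℕ.⊔ N₂) (ℕ.m≤m⊔n N₁ N₂))) (proj₂ (near₂ (N₁ ℕ.⊔ N₂) (ℕ.m≤n⊔m N₁ N₂)))))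
      (x+δ≰x 0<δ)

  -- Mean first passage times

  kill : ∀ {n} → Fin n → Vector ℝ n → Vector ℝ n
  kill i u k = if does (k ≟ i) then 0# else u k

  kill-new : ∀ {n} (i : Fin n) u → kill i u i ≈ 0#
  kill-new i u with i ≟ i
  ... | yes _   = ≈-refl
  ... | no  i≢i = contradiction ≡.refl i≢i

  kill-old : ∀ {n} {i k : Fin n} u → k ≢ i → kill i u k ≈ u k
  kill-old {i = i} {k} u k≢i with k ≟ i
  ... | yes k≡i = contradiction k≡i k≢i
  ... | no  _   = ≈-refl

  dot-kill : ∀ {n} (i : Fin n) p u → dot (kill i p) u ≈ dot p (kill i u)
  dot-kill i p u = sum-cong entry
    where
    entry : ∀ k → kill i p k * u k ≈ p k * kill i u k
    entry k with k ≟ i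
    ... | yes _ = ≈-trans (zeroˡ (u k)) (≈-sym (zeroʳ (p k)))
    ... | no  _ = ≈-refl

  sum-kill : ∀ {n} (i : Fin n) p → sum p ≈ p i + sum (kill i p)
  sum-kill i p = begin-equality
    sum p                                                  ≈⟨ sum-cong (λ k → entry k) ⟩
    sum (λ k → I i k * p k + kill i p k)                   ≈⟨ ∑-distrib-+ (λ k → I i k * p k) (kill i p) ⟩
    sum (λ k → I i k * p k) + sum (kill i p)               ≈⟨ +-congʳ (sum-Iˡ i p) ⟩
    p i + sum (kill i p)                                   ∎
    where
    entry : ∀ k → p k ≈ I i k * p k + kill i p k
    entry k with k ≟ i
    ... | yes ≡.refl = ≈-sym (≈-trans (+-identityʳ _) (≈-trans (*-congʳ (I-diag k)) (*-identityˡ (p k))))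
    ... | no  k≢i = ≈-sym (≈-trans (+-congʳ (≈-trans (*-congʳ (I-off (k≢i ∘ ≡.sym))) (zeroˡ (p k)))) (+-identityˡ (p k)))

  module RandomWalk {n} (G : Graph n) (connected : Connected G) (degree-pos : ∀ i → 0# < degree G i) where
    private
      A P L : Matrix n
      A = adjacency G
      P = transition G
      L = laplacian G
      d : Vector ℝ n
      d = degree G
      one : Vector ℝ n
      one _ = 1#

    d≉0 : ∀ i → ¬ d i ≈ 0#
    d≉0 i = pos⇒≉0 (degree-pos i)

    transition-nonneg : ∀ i j → 0# ≤ P i j
    transition-nonneg i j = *-nonneg (proj₁ (⁻¹-pos (degree-pos i))) (adjacency-nonneg G i j)

    degree-transition : ∀ i j → d i * P i j ≈ A i j
    degree-transition i j = ≈-trans (≈-sym (*-assoc (d i) (d i ⁻¹) (A i j)))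
      (≈-trans (*-congʳ (*-inverseʳ (d≉0 i))) (*-identityˡ (A i j)))

    degree-dot-transition : ∀ i u → d i * dot (P i) u ≈ dot (A i) u
    degree-dot-transition i u = ≈-trans (≈-sym (sum-*ˡ (d i) (λ k → P i k * u k)))
      (sum-cong λ k → ≈-trans (≈-sym (*-assoc (d i) (P i k) (u k))) (*-congʳ (degree-transition i k)))

    transition-stochastic : ∀ i → sum (P i) ≈ 1#
    transition-stochastic i = *-cancelˡ (d≉0 i) (begin-equality
      d i * sum (P i)              ≈⟨ sum-*ˡ (d i) (P i) ⟨
      sum (λ j → d i * P i j)      ≈⟨ sum-cong (degree-transition i) ⟩
      d i                          ≈⟨ *-identityʳ (d i) ⟨
      d i * 1#                     ∎)

    dot-laplacian : ∀ i u → dot (L i) u ≈ d i * u i - dot (A i) u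
    dot-laplacian i u = ≈-trans (dot-comm (L i) u) (≈-trans (dot--ʳ u (degreeMatrix G i) (A i))
      (+-cong (≈-trans (dot-comm u (degreeMatrix G i)) (dot-degreeMatrix G i u)) (-‿cong (dot-comm u (A i)))))

    form-laplacian-oneʳ : ∀ f → form L f one ≈ 0#
    form-laplacian-oneʳ f = dot-zeroʳ f λ i → ≈-trans (dot-laplacian i one)
      (≈-trans (+-cong (*-identityʳ (d i)) (-‿cong (sum-cong λ j → *-identityʳ (A i j)))) (-‿inverseʳ (d i)))

    -- A function that is harmonic off i and vanishes at i has zero energy.
    harmonic-zero : ∀ i u → (∀ j → u j ≈ dot (kill i (P j)) u) → ∀ j → u j ≈ 0#
    harmonic-zero i u harmonic j = ≈-trans (harmonic j) (≈-trans (dot-kill i (P j) u) (dot-zeroʳ (P j) λ k →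
      ≈-trans (laplacian-zero⇒constant G connected v (sum-zero term≈0) k i) (kill-new i u)))
      where
      v : Vector ℝ n
      v = kill i u
      term≈0 : ∀ l → v l * dot (L l) v ≈ 0#
      term≈0 l with l ≟ i in eq
      ... | yes _ = zeroˡ (dot (L l) v)
      ... | no l≢i = ≈-trans (*-congˡ (begin-equality
        dot (L l) v                         ≈⟨ dot-laplacian l v ⟩
        d l * v l - dot (A l) v             ≈⟨ +-cong (*-congˡ (≈-trans (kill-old u l≢i) (≈-trans (harmonic l) (dot-kill i (P l) u)))) (-‿cong (≈-sym (degree-dot-transition l v))) ⟩
        d l * dot (P l) v - d l * dot (P l) v ≈⟨ -‿inverseʳ _ ⟩
        0#                                  ∎)) (zeroʳ (u l))

    module FirstPassage (i : Fin n) {m : Vector ℝ n}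
      (passage : ∀ j → ConvergesTo (λ N → ∑[ t < N ] (suc (toℕ t) · firstPassage G i (toℕ t) j)) (m j)) where

      fp : ℕ → Vector ℝ n
      fp = firstPassage G i

      -- The substochastic matrix of steps that avoid i.
      Q : Matrix n
      Q j = kill i (P j)

      Q-nonneg : ∀ j k → 0# ≤ Q j k
      Q-nonneg j k with k ≟ i
      ... | yes _ = ≤-refl
      ... | no  _ = transition-nonneg j k

      fp-suc : ∀ t j → fp (suc t) j ≈ dot (Q j) (fp t)
      fp-suc t j = sum-cong entry
        where
        entry : ∀ k → (if does (k ≟ i) then 0# else P j k * fp t k) ≈ Q j k * fp t k
        entry k with k ≟ i
        ... | yes _ = ≈-sym (zeroˡ (fp t k))
        ... | no  _ = ≈-refl

      weight : ℕ → ℝ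
      weight t = suc t · 1#

      S F : ℕ → Vector ℝ n
      S N j = ∑[ t < N ] (weight (toℕ t) * fp (toℕ t) j)
      F N j = ∑[ t < N ] fp (toℕ t) j

      ·-weight : ∀ t x → suc t · x ≈ weight t * x
      ·-weight t x = ≈-sym (≈-trans (×-assoc-* (suc t) 1# x) (×-congʳ (suc t) (*-identityˡ x)))

      sum-dot-Q : ∀ N j (f : ℕ → Vector ℝ n) → ∑[ t < N ] dot (Q j) (f (toℕ t)) ≈ dot (Q j) (λ k → ∑[ t < N ] f (toℕ t) k)
      sum-dot-Q N j f = ≈-trans (∑-comm {N} {n} (λ t k → Q j k * f (toℕ t) k)) (sum-cong λ k → sum-*ˡ {N} (Q j k) (λ t → f (toℕ t) k))

      F-suc : ∀ N j → F (suc N) j ≈ P j i + dot (Q j) (F N)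
      F-suc N j = +-congˡ (≈-trans (sum-cong {N} λ t → fp-suc (toℕ t) j) (sum-dot-Q N j fp))

      -- The weight t + 2 splits into 1 and t + 1. The first part adds up to a partial sum of
      -- probabilities, the second is the weighted series after one step avoiding i.
      S-suc : ∀ N j → S (suc N) j ≈ F (suc N) j + dot (Q j) (S N)
      S-suc N j = begin-equality
        (1# + 0#) * P j i + ∑[ t < N ] (weight (suc (toℕ t)) * fp (suc (toℕ t)) j)
          ≈⟨ +-cong (≈-trans (*-congʳ (+-identityʳ 1#)) (*-identityˡ (P j i)))
                    (≈-trans (sum-cong {N} λ t → ≈-trans (distribʳ (fp (suc (toℕ t)) j) 1# (weight (toℕ t)))
                               (+-cong (*-identityˡ (fp (suc (toℕ t)) j)) (term (toℕ t))))
                             (∑-distrib-+ {N} (λ t → fp (suc (toℕ t)) j) (λ t → dot (Q j) (λ k → weight (toℕ t) * fp (toℕ t) k)))) ⟩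
        P j i + (∑[ t < N ] fp (suc (toℕ t)) j + ∑[ t < N ] dot (Q j) (λ k → weight (toℕ t) * fp (toℕ t) k))
          ≈⟨ +-assoc _ _ _ ⟨
        F (suc N) j + ∑[ t < N ] dot (Q j) (λ k → weight (toℕ t) * fp (toℕ t) k)
          ≈⟨ +-congˡ (sum-dot-Q N j (λ t k → weight t * fp t k)) ⟩
        F (suc N) j + dot (Q j) (S N)   ∎
        where
        term : ∀ t → weight t * fp (suc t) j ≈ dot (Q j) (λ k → weight t * fp t k)
        term t = ≈-trans (*-congˡ (fp-suc t j)) (≈-sym (dot-*ʳ (Q j) (fp t) (weight t)))

      S-limit : ∀ j → Limit (λ N → S N j) (m j)
      S-limit j = Limit-cong (λ N → sum-cong {N} λ t → ·-weight (toℕ t) (fp (toℕ t) j)) ≈-refl (convergesTo⇒Limit (passage j))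

      -- The probability of ever reaching i from j, at positive time. By `S-suc`, F (N + 1) = S (N +
      -- 1) - Q S N, so convergence of the probability series and its limit m - Q m are inherited
      -- from the weighted series.
      f : Vector ℝ n
      f j = m j - dot (Q j) m

      dot-Q-limit : ∀ j {s : ℕ → Vector ℝ n} {l} → (∀ k → Limit (λ N → s N k) (l k)) → Limit (λ N → dot (Q j) (s N)) (dot (Q j) l)
      dot-Q-limit j lim = Limit-sum λ k → Limit-* (Q-nonneg j k) (lim k)

      F-limit : ∀ j → Limit (λ N → F (suc N) j) (f j)
      F-limit j = Limit-cong
        (λ N → ≈-trans (+-congʳ (S-suc N j)) (solve 2 (λ a b → (a :+ b) :- b := a) ≈-refl (F (suc N) j) (dot (Q j) (S N))))
        ≈-refl
        (Limit-+ (Limit-shift (S-limit j)) (Limit-neg (dot-Q-limit j S-limit)))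

      f-recursion : ∀ j → f j ≈ P j i + dot (Q j) f
      f-recursion j = Limit-unique (Limit-shift (F-limit j))
        (Limit-cong (λ N → ≈-sym (F-suc (suc N) j)) ≈-refl (Limit-+ (Limit-const (P j i)) (dot-Q-limit j F-limit)))

      -- The rows of the transition matrix sum to 1, so subtracting `f-recursion` from that identity
      -- gives 1 - f = Q (1 - f), and `harmonic-zero` applies.
      recurrent : ∀ j → f j ≈ 1#
      recurrent j = begin-equality
        f j                      ≈⟨ solve 1 (λ x → x := :1 :- (:1 :- x)) ≈-refl (f j) ⟩
        1# - (1# - f j)          ≈⟨ +-congˡ (-‿cong (harmonic-zero i (λ k → 1# - f k) harmonic j)) ⟩
        1# - 0#                  ≈⟨ solve 0 (:1 :- :0 := :1) ≈-refl ⟩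
        1#                       ∎
        where
        harmonic : ∀ j → 1# - f j ≈ dot (Q j) (λ k → 1# - f k)
        harmonic j = begin-equality
          1# - f j                               ≈⟨ +-cong (≈-trans (≈-sym (transition-stochastic j)) (sum-kill i (P j))) (-‿cong (f-recursion j)) ⟩
          P j i + sum (Q j) - (P j i + dot (Q j) f)   ≈⟨ x+y-[x+z] (P j i) (sum (Q j)) (dot (Q j) f) ⟩
          sum (Q j) - dot (Q j) f                ≈⟨ +-congʳ (sum-cong λ k → *-identityʳ (Q j k)) ⟨
          dot (Q j) one - dot (Q j) f            ≈⟨ dot--ʳ (Q j) one f ⟨
          dot (Q j) (λ k → 1# - f k)             ∎

      -- Hitting times of i: they agree with the passage times except at i, where the mean return
      -- time is replaced by 0.
      h : Vector ℝ n
      h = kill i m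

      first-step : ∀ j → m j ≈ 1# + dot (P j) h
      first-step j = begin-equality
        m j                        ≈⟨ solve 2 (λ x y → x := (x :- y) :+ y) ≈-refl (m j) (dot (Q j) m) ⟩
        f j + dot (Q j) m          ≈⟨ +-cong (recurrent j) (dot-kill i (P j) m) ⟩
        1# + dot (P j) h           ∎

      degree-mean : ∀ j → d j * m j ≈ d j + dot (A j) h
      degree-mean j = ≈-trans (*-congˡ (first-step j)) (≈-trans (distribˡ (d j) 1# (dot (P j) h))
        (+-cong (*-identityʳ (d j)) (degree-dot-transition j h)))

      -- The first-step equation multiplied by the degree. At i, where h vanishes, the correction
      -- d_i m_i appears; `mean-return-time` identifies it with the volume.
      laplacian-h-at : ∀ j → dot (L j) h ≈ d j - I i j * (d j * m j)
      laplacian-h-at j with j ≟ i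
      ... | yes ≡.refl = begin-equality
        dot (L j) h                           ≈⟨ dot-laplacian j h ⟩
        d j * h j - dot (A j) h               ≈⟨ +-congʳ (*-congˡ (kill-new j m)) ⟩
        d j * 0# - dot (A j) h                ≈⟨ solve 2 (λ d a → d :* :0 :- a := d :- :1 :* (d :+ a)) ≈-refl (d j) (dot (A j) h) ⟩
        d j - 1# * (d j + dot (A j) h)        ≈⟨ +-congˡ (-‿cong (*-cong (I-diag j) (degree-mean j))) ⟨
        d j - I j j * (d j * m j)             ∎
      ... | no j≢i = begin-equality
        dot (L j) h                           ≈⟨ dot-laplacian j h ⟩
        d j * h j - dot (A j) h               ≈⟨ +-congʳ (≈-trans (*-congˡ (kill-old m j≢i)) (degree-mean j)) ⟩
        d j + dot (A j) h - dot (A j) h       ≈⟨ solve 3 (λ d a w → d :+ a :- a := d :- :0 :* w) ≈-refl (d j) (dot (A j) h) (d j * m j) ⟩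
        d j - 0# * (d j * m j)                ≈⟨ +-congˡ (-‿cong (*-congʳ (I-off (j≢i ∘ ≡.sym)))) ⟨
        d j - I i j * (d j * m j)             ∎

      dot-laplacian-h : ∀ g → form L g h ≈ dot g d - g i * (d i * m i)
      dot-laplacian-h g = begin-equality
        form L g h                                             ≈⟨ dot-cong {f = g} (λ _ → ≈-refl) laplacian-h-at ⟩
        dot g (λ j → d j - I i j * (d j * m j))                ≈⟨ dot--ʳ g d (λ j → I i j * (d j * m j)) ⟩
        dot g d - dot g (λ j → I i j * (d j * m j))            ≈⟨ +-congˡ (-‿cong (≈-trans (sum-cong λ j → solve 3 (λ g e x → g :* (e :* x) := e :* (g :* x)) ≈-refl (g j) (I i j) (d j * m j))
                                                                    (sum-Iˡ i (λ j → g j * (d j * m j))))) ⟩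
        dot g d - g i * (d i * m i)                            ∎

      -- Pair L h with the constant function 1. The result is 0 by symmetry of L, and by
      -- `dot-laplacian-h` it is vol(G) - d_i m_i.
      mean-return-time : d i * m i ≈ volume G
      mean-return-time = begin-equality
        d i * m i                                 ≈⟨ solve 2 (λ v x → x := v :- (v :- :1 :* x)) ≈-refl (volume G) (d i * m i) ⟩
        volume G - (volume G - 1# * (d i * m i))  ≈⟨ +-congˡ (-‿cong (begin-equality
          volume G - 1# * (d i * m i)     ≈⟨ +-congʳ (sum-cong λ j → *-identityˡ (d j)) ⟨
          dot one d - 1# * (d i * m i)    ≈⟨ dot-laplacian-h one ⟨
          form L one h                    ≈⟨ form-sym (laplacian-sym G) one h ⟩
          form L h one                    ≈⟨ form-laplacian-oneʳ h ⟩
          0#                              ∎)) ⟩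
        volume G - 0#                             ≈⟨ solve 1 (λ v → v :- :0 := v) ≈-refl (volume G) ⟩
        volume G                                  ∎

  -- Kemeny's constant

  module Kemeny {n} (G : Graph n) (connected : Connected G) (degree-pos : ∀ i → 0# < degree G i)
                {λs : Vector ℝ n} (diag : Diagonalisation (laplacian G) (degreeMatrix G) λs) where
    open RandomWalk G connected degree-pos
    open Spectrum G connected diag
    private
      A P L : Matrix n
      A = adjacency G
      P = transition G
      L = laplacian G
      d one : Vector ℝ n
      d = degree G
      one _ = 1#
      U : Fin n → Vector ℝ n
      U = basis
      V : ℝ
      V = volume G

    -- Invariance of π says that g = π / d satisfies L g = 0, so g is constant by connectedness; c
    -- is its value at `s`.
    stationary⇒degree : ∀ {π} → IsStationary G π → Fin n → ∃ λ c → (∀ i → π i ≈ c * d i) × c * V ≈ 1#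
    stationary⇒degree {π} stationary s = g s , π≈ , (begin-equality
      g s * V                      ≈⟨ sum-*ˡ (g s) d ⟨
      sum (λ i → g s * d i)        ≈⟨ sum-cong π≈ ⟨
      sum π                        ≈⟨ total-mass ⟩
      1#                           ∎)
      where
      open IsStationary stationary
      g : Vector ℝ n
      g i = π i * d i ⁻¹
      dg≈π : ∀ i → d i * g i ≈ π i
      dg≈π i = ≈-trans (solve 3 (λ d p v → d :* (p :* v) := d :* v :* p) ≈-refl (d i) (π i) (d i ⁻¹))
        (≈-trans (*-congʳ (*-inverseʳ (d≉0 i))) (*-identityˡ (π i)))
      harmonic : ∀ j → dot (L j) g ≈ 0#
      harmonic j = begin-equality
        dot (L j) g                        ≈⟨ dot-laplacian j g ⟩
        d j * g j - dot (A j) g            ≈⟨ +-cong (≈-trans (dg≈π j) (≈-sym (invariant j))) (-‿cong (sum-cong λ i → ≈-trans (*-congʳ (adjacency-sym G j i))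
                                                (solve 3 (λ a p v → a :* (p :* v) := p :* (v :* a)) ≈-refl (A i j) (π i) (d i ⁻¹)))) ⟩
        dot π (λ i → P i j) - dot π (λ i → P i j)   ≈⟨ -‿inverseʳ _ ⟩
        0#                                 ∎
      π≈ : ∀ i → π i ≈ g s * d i
      π≈ i = ≈-trans (≈-sym (dg≈π i)) (≈-trans (*-comm (d i) (g i))
        (*-congʳ (laplacian-zero⇒constant G connected g (dot-zeroʳ g harmonic) i s)))

    eigenform : ∀ k g → form L (U k) g ≈ λs k * coordinate g k
    eigenform k g = begin-equality
      form L (U k) g                                     ≈⟨ form-cong L {f = U k} (λ _ → ≈-refl) (expansion g) ⟩
      form L (U k) (lin U (coordinate g))                ≈⟨ form-linʳ L (U k) U (coordinate g) ⟩
      dot (λ l → form L (U k) (U l)) (coordinate g)      ≈⟨ sum-cong (λ l → ≈-trans (*-congʳ (diagonal k l)) (*-assoc (λs k) (I k l) (coordinate g l))) ⟩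
      sum (λ l → λs k * (I k l * coordinate g l))        ≈⟨ sum-*ˡ (λs k) (λ l → I k l * coordinate g l) ⟩
      λs k * sum (λ l → I k l * coordinate g l)          ≈⟨ *-congˡ (sum-Iˡ k (coordinate g)) ⟩
      λs k * coordinate g k                              ∎

    degree-coordinate : ∀ k → λs k * dot (U k) d ≈ 0#
    degree-coordinate k = begin-equality
      λs k * dot (U k) d             ≈⟨ *-congˡ (≈-trans (form-degreeMatrix G (U k) one) (sum-cong λ i → ≈-trans (*-congˡ (*-identityʳ (U k i))) (*-comm (d i) (U k i)))) ⟨
      λs k * coordinate one k        ≈⟨ eigenform k one ⟨
      form L (U k) one               ≈⟨ form-laplacian-oneʳ (U k) ⟩
      0#                             ∎

    -- The inner product U_k · d is the coordinate of the constant function, so it vanishes for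
    -- nonzero eigenvalues; for eigenvalue 0 the factor vanishes because 0⁻¹ = 0. This removes the
    -- starting vertex from the final average.
    degree-coordinate⁻¹ : ∀ k → λs k ⁻¹ * dot (U k) d ≈ 0#
    degree-coordinate⁻¹ k = case (λs k ≈? 0#)
      where
      case : Dec (λs k ≈ 0#) → λs k ⁻¹ * dot (U k) d ≈ 0#
      case (yes λ≈0) = ≈-trans (*-congʳ (⁻¹-zero λ≈0)) (zeroˡ _)
      case (no  λ≉0) = ≈-trans (*-congˡ (product-zero (degree-coordinate k) λ≉0)) (zeroʳ _)

    module _ (s i : Fin n) {m : Vector ℝ n}
      (passage : ∀ j → ConvergesTo (λ N → ∑[ t < N ] (suc (toℕ t) · firstPassage G i (toℕ t) j)) (m j)) where
      open FirstPassage i passage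

      private
        u : Fin n → ℝ
        u k = λs k ⁻¹ * (V * (U k i * (U k i - U k s)))

      -- For a nonzero eigenvalue, pairing L h = d - V e_i with U_k gives λ_k z = - V U_k(i) for the
      -- coordinate z of h. For eigenvalue 0 the vector U_k is constant and 0⁻¹ = 0, so both sides
      -- vanish.
      mode : ∀ k → (U k s - U k i) * coordinate h k ≈ u k
      mode k = case (λs k ≈? 0#)
        where
        z : ℝ
        z = coordinate h k
        case : Dec (λs k ≈ 0#) → (U k s - U k i) * z ≈ u k
        case (yes λ≈0) = ≈-trans
          (≈-trans (*-congʳ (≈-trans (+-congʳ (kernel-constant λ≈0 s i)) (-‿inverseʳ (U k i)))) (zeroˡ z))
          (≈-sym (≈-trans (*-congʳ (⁻¹-zero λ≈0)) (zeroˡ _)))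
        case (no λ≉0) = *-cancelˡ λ≉0 (begin-equality
          λs k * ((U k s - U k i) * z)            ≈⟨ solve 3 (λ l w z → l :* (w :* z) := w :* (l :* z)) ≈-refl (λs k) (U k s - U k i) z ⟩
          (U k s - U k i) * (λs k * z)            ≈⟨ *-congˡ (begin-equality
            λs k * z                                ≈⟨ eigenform k h ⟨
            form L (U k) h                          ≈⟨ dot-laplacian-h (U k) ⟩
            dot (U k) d - U k i * (d i * m i)       ≈⟨ +-cong (product-zero (degree-coordinate k) λ≉0) (-‿cong (*-congˡ mean-return-time)) ⟩
            0# - U k i * V                          ∎) ⟩
          (U k s - U k i) * (0# - U k i * V)      ≈⟨ solve 3 (λ a b v → (a :- b) :* (:0 :- b :* v) := v :* (b :* (b :- a))) ≈-refl (U k s) (U k i) V ⟩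
          V * (U k i * (U k i - U k s))           ≈⟨ *-identityˡ _ ⟨
          1# * (V * (U k i * (U k i - U k s)))    ≈⟨ *-congʳ (*-inverseʳ λ≉0) ⟨
          λs k * λs k ⁻¹ * (V * (U k i * (U k i - U k s)))   ≈⟨ *-assoc _ _ _ ⟩
          λs k * u k                              ∎)

      passage-spectral : h s ≈ sum u
      passage-spectral = begin-equality
        h s                              ≈⟨ solve 1 (λ x → x := x :- :0) ≈-refl (h s) ⟩
        -- Subtracting h i = 0 cancels the component along the constant eigenvector, which the
        -- equation for L h leaves undetermined.
        h s - 0#                         ≈⟨ +-congˡ (-‿cong (kill-new i m)) ⟨
        h s - h i                        ≈⟨ +-cong (expansion h s) (-‿cong (expansion h i)) ⟩
        lin U (coordinate h) s - lin U (coordinate h) i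
                                         ≈⟨ sum-- (λ k → U k s * coordinate h k) (λ k → U k i * coordinate h k) ⟨
        sum (λ k → U k s * coordinate h k - U k i * coordinate h k)
                                         ≈⟨ sum-cong (λ k → ≈-trans (solve 3 (λ a b z → a :* z :- b :* z := (a :- b) :* z) ≈-refl (U k s) (U k i) (coordinate h k)) (mode k)) ⟩
        sum u                            ∎

    -- The times m s i and the hitting times differ only at i = s, where the return term π_s m_ss =
    -- 1 cancels the - 1 in the definition. The rest is averaged over i one eigenvector at a time.
    kemeny : ∀ {K} → IsKemenyConstant G K → K ≈ sum (λ k → λs k ⁻¹)
    kemeny {K} isKemeny = begin-equality
      K                                                      ≈⟨ value ⟩
      sum (λ i → π i * m s i) - 1#                           ≈⟨ +-congʳ (sum-cong λ i → ≈-trans (*-congˡ (split i))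
                                                                  (solve 4 (λ p h e m → p :* (h :+ e :* m) := p :* h :+ e :* (p :* m)) ≈-refl (π i) (kill i (λ j → m j i) s) (I s i) (m s i))) ⟩
      sum (λ i → π i * kill i (λ j → m j i) s + I s i * (π i * m s i)) - 1#
                                                             ≈⟨ +-congʳ (≈-trans (∑-distrib-+ (λ i → π i * kill i (λ j → m j i) s) (λ i → I s i * (π i * m s i)))
                                                                  (+-congˡ (≈-trans (sum-Iˡ s (λ i → π i * m s i)) return))) ⟩
      sum (λ i → π i * kill i (λ j → m j i) s) + 1# - 1#     ≈⟨ solve 1 (λ x → x :+ :1 :- :1 := x) ≈-refl (sum (λ i → π i * kill i (λ j → m j i) s)) ⟩
      sum (λ i → π i * kill i (λ j → m j i) s)               ≈⟨ sum-cong (λ i → ≈-trans (*-cong (π≈ i) (passage-spectral s i (λ j → passage j i)))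
                                                                  (≈-sym (sum-*ˡ (c * d i) (λ k → λs k ⁻¹ * (V * (U k i * (U k i - U k s))))))) ⟩
      sum (λ i → sum λ k → c * d i * (λs k ⁻¹ * (V * (U k i * (U k i - U k s)))))
                                                             ≈⟨ ∑-comm (λ i k → c * d i * (λs k ⁻¹ * (V * (U k i * (U k i - U k s))))) ⟩
      sum (λ k → sum λ i → c * d i * (λs k ⁻¹ * (V * (U k i * (U k i - U k s)))))
                                                             ≈⟨ sum-cong average ⟩
      sum (λ k → λs k ⁻¹)                                    ∎
      where
      open IsKemenyConstant isKemeny
      s = start
      distribution = stationary⇒degree stationary s
      c : ℝ
      c = proj₁ distribution
      π≈ : ∀ i → π i ≈ c * d i
      π≈ = proj₁ (proj₂ distribution)
      cV≈1 : c * V ≈ 1#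
      cV≈1 = proj₂ (proj₂ distribution)
      split : ∀ i → m s i ≈ kill i (λ j → m j i) s + I s i * m s i
      split i with s ≟ i
      ... | yes ≡.refl = ≈-sym (≈-trans (+-identityˡ _) (*-identityˡ (m s s)))
      ... | no _ = ≈-sym (≈-trans (+-congˡ (zeroˡ (m s i))) (+-identityʳ (m s i)))
      return : π s * m s s ≈ 1#
      return = begin-equality
        π s * m s s          ≈⟨ *-congʳ (π≈ s) ⟩
        c * d s * m s s      ≈⟨ *-assoc c (d s) (m s s) ⟩
        c * (d s * m s s)    ≈⟨ *-congˡ (FirstPassage.mean-return-time s (λ j → passage j s)) ⟩
        c * V                ≈⟨ cV≈1 ⟩
        1#                   ∎
      -- With c V = 1 the square terms sum to the norm of U_k, which is 1; the cross term is a
      -- multiple of λ_k⁻¹ (U_k · d) = 0.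
      average : ∀ k → sum (λ i → c * d i * (λs k ⁻¹ * (V * (U k i * (U k i - U k s))))) ≈ λs k ⁻¹
      average k = begin-equality
        sum (λ i → c * d i * (l * (V * (U k i * (U k i - U k s)))))
          ≈⟨ sum-cong (λ i → ≈-trans
               (solve 5 (λ c d l v x → c :* d :* (l :* (v :* x)) := l :* (c :* v) :* (d :* x)) ≈-refl c (d i) l V (U k i * (U k i - U k s)))
               (*-congˡ (solve 3 (λ d x y → d :* (x :* (x :- y)) := d :* (x :* x) :- x :* d :* y) ≈-refl (d i) (U k i) (U k s)))) ⟩
        sum (λ i → l * (c * V) * (d i * (U k i * U k i) - U k i * d i * U k s))
          ≈⟨ sum-*ˡ (l * (c * V)) (λ i → d i * (U k i * U k i) - U k i * d i * U k s) ⟩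
        l * (c * V) * sum (λ i → d i * (U k i * U k i) - U k i * d i * U k s)
          ≈⟨ *-cong (≈-trans (*-congˡ cV≈1) (*-identityʳ l)) (≈-trans (sum-- (λ i → d i * (U k i * U k i)) (λ i → U k i * d i * U k s))
               (+-cong (≈-trans (≈-sym (form-degreeMatrix G (U k) (U k))) (form-basis k)) (-‿cong (sum-*ʳ (U k s) (λ i → U k i * d i))))) ⟩
        l * (1# - dot (U k) d * U k s)
          ≈⟨ solve 3 (λ l w u → l :* (:1 :- w :* u) := l :- (l :* w) :* u) ≈-refl l (dot (U k) d) (U k s) ⟩
        l - (l * dot (U k) d) * U k s
          ≈⟨ +-congˡ (-‿cong (≈-trans (*-congʳ (degree-coordinate⁻¹ k)) (zeroˡ (U k s)))) ⟩
        l - 0#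
          ≈⟨ solve 1 (λ l → l :- :0 := l) ≈-refl l ⟩
        l   ∎
        where
        l : ℝ
        l = λs k ⁻¹

  open import Algebra.Properties.CommutativeMonoid.Sum +-commutativeMonoid using (sum-replicate)

  -- Shifted sums

  -- Extension by zero lets sums be split and shifted with arithmetic on ℕ instead of casts between
  -- finite index types.
  extend : ∀ {n} → Vector ℝ n → ℕ → ℝ
  extend {zero}  f t       = 0#
  extend {suc n} f zero    = f zero
  extend {suc n} f (suc t) = extend (tail f) t

  extend-toℕ : ∀ {n} (f : Vector ℝ n) i → extend f (toℕ i) ≡ f i
  extend-toℕ f zero    = ≡.refl
  extend-toℕ f (suc i) = extend-toℕ (tail f) i

  extend-fromℕ< : ∀ {n} (f : Vector ℝ n) {t} (t<n : t ℕ.< n) → extend f t ≡ f (fromℕ< t<n)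
  extend-fromℕ< f t<n = ≡.trans (≡.cong (extend f) (≡.sym (Fin.toℕ-fromℕ< t<n))) (extend-toℕ f (fromℕ< t<n))

  sum-split : ∀ a b (F : ℕ → ℝ) → ∑[ t < a ℕ.+ b ] F (toℕ t) ≈ ∑[ t < a ] F (toℕ t) + ∑[ t < b ] F (a ℕ.+ toℕ t)
  sum-split zero    b F = ≈-sym (+-identityˡ _)
  sum-split (suc a) b F = ≈-trans (+-congˡ (sum-split a b (F ∘ suc))) (≈-sym (+-assoc _ _ _))

  sum-split₃ : ∀ {n} a b c → n ≡ a ℕ.+ b ℕ.+ c → (F : ℕ → ℝ) → ∑[ t < n ] F (toℕ t) ≈
               ∑[ t < a ] F (toℕ t) + ∑[ t < b ] F (a ℕ.+ toℕ t) + ∑[ t < c ] F (a ℕ.+ b ℕ.+ toℕ t)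
  sum-split₃ a b c ≡.refl F = ≈-trans (sum-split (a ℕ.+ b) c F) (+-congʳ (sum-split a b F))

  if-true : ∀ {c} {x y : ℝ} → T c → (if c then x else y) ≈ x
  if-true {true} _ = ≈-refl

  if-false : ∀ {c} {x y : ℝ} → ¬ T c → (if c then x else y) ≈ y
  if-false {true}  ¬tt = contradiction tt ¬tt
  if-false {false} _   = ≈-refl

  -- The entries numbered a + 1, ..., a + b from 1 sit at positions a, ..., a + b - 1 from 0, the
  -- middle one of three blocks of lengths a, b, c.
  partial-sum : ∀ {n} a b c → n ≡ a ℕ.+ b ℕ.+ c → (f : Vector ℝ n) →
                ∑[ suc a ⋯ a ℕ.+ b ] f ≈ ∑[ t < b ] extend f (a ℕ.+ toℕ t)
  partial-sum {n} a b c n≡ f = begin-equality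
    ∑[ suc a ⋯ a ℕ.+ b ] f              ≈⟨ sum-cong {n} (λ j → ≈-reflexive (≡.cong (if in-range (toℕ j) then_else 0#) (≡.sym (extend-toℕ f j)))) ⟩
    ∑[ t < n ] H (toℕ t)                ≈⟨ sum-split₃ a b c n≡ H ⟩
    ∑[ t < a ] H (toℕ t) + ∑[ t < b ] H (a ℕ.+ toℕ t) + ∑[ t < c ] H (a ℕ.+ b ℕ.+ toℕ t)
      ≈⟨ +-cong (+-cong (sum-zero {a} λ t → if-false λ p → ℕ.<⇒≱ (Fin.toℕ<n t) (ℕ.s≤s⁻¹ (ℕ.≤ᵇ⇒≤ (suc a) (suc (toℕ t)) (proj₁ (Equivalence.to T-∧ p)))))
                        (sum-cong {b} λ t → if-true (Equivalence.from T-∧ (ℕ.≤⇒≤ᵇ (ℕ.s≤s (ℕ.m≤m+n a (toℕ t))) ,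
                          ℕ.≤⇒≤ᵇ (≡.subst (ℕ._≤ a ℕ.+ b) (ℕ.+-suc a (toℕ t)) (ℕ.+-monoʳ-≤ a (Fin.toℕ<n t)))))))
                (sum-zero {c} λ t → if-false λ p → ℕ.<⇒≱ (ℕ.≤ᵇ⇒≤ (suc (a ℕ.+ b ℕ.+ toℕ t)) (a ℕ.+ b) (proj₂ (Equivalence.to (T-∧ {suc a ℕ.≤ᵇ suc (a ℕ.+ b ℕ.+ toℕ t)}) p)))
                                      (ℕ.m≤m+n (a ℕ.+ b) (toℕ t))) ⟩
    0# + ∑[ t < b ] extend f (a ℕ.+ toℕ t) + 0#   ≈⟨ ≈-trans (+-identityʳ _) (+-identityˡ _) ⟩
    ∑[ t < b ] extend f (a ℕ.+ toℕ t)             ∎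
    where
    in-range : ℕ → Bool
    in-range t = (suc a ℕ.≤ᵇ suc t) ∧ (suc t ℕ.≤ᵇ a ℕ.+ b)
    H : ℕ → ℝ
    H t = if in-range t then extend f t else 0#

  sum-extend : ∀ {n} (f : Vector ℝ n) → sum f ≈ ∑[ t < n ] extend f (toℕ t)
  sum-extend f = sum-cong λ i → ≈-reflexive (≡.sym (extend-toℕ f i))

  module _ {n} (r m : ℕ) (n≡1+r+m : n ≡ suc (r ℕ.+ m)) (f g : Vector ℝ n) {x : ℝ} where
    private
      n≡r+m+1 : n ≡ r ℕ.+ m ℕ.+ 1
      n≡r+m+1 = ≡.trans n≡1+r+m (ℕ.+-comm 1 (r ℕ.+ m))

      <n : ∀ {t} → t ℕ.< r ℕ.+ m → t ℕ.< n
      <n t<r+m = ≡.subst (_ ℕ.<_) (≡.sym n≡1+r+m) (ℕ.m≤n⇒m≤1+n t<r+m)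

      last<n : r ℕ.+ m ℕ.+ 0 ℕ.< n
      last<n = ≡.subst₂ ℕ._<_ (≡.sym (ℕ.+-identityʳ (r ℕ.+ m))) (≡.sym n≡1+r+m) ℕ.≤-refl

      r+t< : ∀ (t : Fin m) → r ℕ.+ toℕ t ℕ.< r ℕ.+ m
      r+t< t = ℕ.+-monoʳ-< r (Fin.toℕ<n t)

      t< : ∀ (t : Fin m) → toℕ t ℕ.< r ℕ.+ m
      t< t = ℕ.<-≤-trans (Fin.toℕ<n t) (ℕ.m≤n+m m r)

      t<′ : ∀ (t : Fin r) → toℕ t ℕ.< r ℕ.+ m
      t<′ t = ℕ.<-≤-trans (Fin.toℕ<n t) (ℕ.m≤m+n r m)

      m+t< : ∀ (t : Fin r) → m ℕ.+ toℕ t ℕ.< r ℕ.+ m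
      m+t< t = ≡.subst (m ℕ.+ toℕ t ℕ.<_) (ℕ.+-comm m r) (ℕ.+-monoʳ-< m (Fin.toℕ<n t))

      shift : ∀ {t} (t<n : t ℕ.< n) (r+t<n : r ℕ.+ t ℕ.< n) → toℕ (fromℕ< r+t<n) ≡ toℕ (fromℕ< t<n) ℕ.+ r
      shift {t} t<n r+t<n = ≡.trans (Fin.toℕ-fromℕ< r+t<n) (≡.trans (ℕ.+-comm r t) (≡.cong (ℕ._+ r) (≡.sym (Fin.toℕ-fromℕ< t<n))))

      below : ∀ {t} (t<r+m : t ℕ.< r ℕ.+ m) → toℕ (fromℕ< (<n t<r+m)) ℕ.< r ℕ.+ m
      below t<r+m = ≡.subst (ℕ._< r ℕ.+ m) (≡.sym (Fin.toℕ-fromℕ< (<n t<r+m))) t<r+m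

      at : ∀ {t} (f : Vector ℝ n) (t<n : t ℕ.< n) → extend f t ≈ f (fromℕ< t<n)
      at f t<n = ≈-reflexive (extend-fromℕ< f t<n)

    -- Cut the positions of f into blocks of lengths r, m and 1: the first block is bounded below by
    -- x, the second by g shifted by r, and the last entry by 0.
    shifted-sum-≤ : (∀ p → toℕ p ℕ.< r ℕ.+ m → x ≤ f p) → (∀ p → toℕ p ≡ r ℕ.+ m → 0# ≤ f p) →
                    (∀ p q → toℕ p ≡ toℕ q ℕ.+ r → toℕ p ℕ.< r ℕ.+ m → g q ≤ f p) →
                    r · x + ∑[ 1 ⋯ m ] g ≤ sum f
    shifted-sum-≤ x≤f 0≤f g≤f = begin
      r · x + ∑[ 1 ⋯ m ] g
        ≈⟨ +-cong (≈-sym (sum-replicate r)) (partial-sum 0 m (suc r) (≡.trans n≡1+r+m (≡.trans (≡.cong suc (ℕ.+-comm r m)) (≡.sym (ℕ.+-suc m r)))) g) ⟩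
      ∑[ t < r ] x + ∑[ t < m ] extend g (toℕ t)
        ≈⟨ +-identityʳ _ ⟨
      ∑[ t < r ] x + ∑[ t < m ] extend g (toℕ t) + 0#
        ≤⟨ +-mono-≤ (+-mono-≤
             (sum-mono {r} λ t → ≤-respʳ-≈ (≈-sym (at f (<n (t<′ t)))) (x≤f _ (below (t<′ t))))
             (sum-mono {m} λ t → ≤-respˡ-≈ (≈-sym (at g (<n (t< t)))) (≤-respʳ-≈ (≈-sym (at f (<n (r+t< t))))
               (g≤f _ _ (shift (<n (t< t)) (<n (r+t< t))) (below (r+t< t))))))
             (≤-respʳ-≈ (≈-sym (≈-trans (+-identityʳ _) (at f last<n))) (0≤f _ (≡.trans (Fin.toℕ-fromℕ< last<n) (ℕ.+-identityʳ _)))) ⟩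
      ∑[ t < r ] extend f (toℕ t) + ∑[ t < m ] extend f (r ℕ.+ toℕ t) + ∑[ t < 1 ] extend f (r ℕ.+ m ℕ.+ toℕ t)
        ≈⟨ sum-split₃ r m 1 n≡r+m+1 (extend f) ⟨
      ∑[ t < n ] extend f (toℕ t)
        ≈⟨ sum-extend f ⟨
      sum f   ∎

    -- Here the blocks of f have lengths m, r and 1: the first is bounded above by the entries of g
    -- from position r on, the second by x, and the last entry by 0.
    sum-≤-shifted : (∀ p → toℕ p ℕ.< r ℕ.+ m → f p ≤ x) → (∀ p → toℕ p ≡ r ℕ.+ m → f p ≤ 0#) →
                    (∀ p q → toℕ p ≡ toℕ q ℕ.+ r → toℕ p ℕ.< r ℕ.+ m → f q ≤ g p) →
                    sum f ≤ ∑[ suc r ⋯ r ℕ.+ m ] g + r · x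
    sum-≤-shifted f≤x f≤0 f≤g = begin
      sum f
        ≈⟨ sum-extend f ⟩
      ∑[ t < n ] extend f (toℕ t)
        ≈⟨ sum-split₃ m r 1 (≡.trans n≡r+m+1 (≡.cong (ℕ._+ 1) (ℕ.+-comm r m))) (extend f) ⟩
      ∑[ t < m ] extend f (toℕ t) + ∑[ t < r ] extend f (m ℕ.+ toℕ t) + ∑[ t < 1 ] extend f (m ℕ.+ r ℕ.+ toℕ t)
        ≤⟨ +-mono-≤ (+-mono-≤
             (sum-mono {m} λ t → ≤-respˡ-≈ (≈-sym (at f (<n (t< t)))) (≤-respʳ-≈ (≈-sym (at g (<n (r+t< t))))
               (f≤g _ _ (shift (<n (t< t)) (<n (r+t< t))) (below (r+t< t)))))
             (sum-mono {r} λ t → ≤-respˡ-≈ (≈-sym (at f (<n (m+t< t)))) (f≤x _ (below (m+t< t)))))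
             (≤-respˡ-≈ (≈-sym (≈-trans (+-identityʳ _) (≈-trans (≈-reflexive (≡.cong (λ s → extend f (s ℕ.+ 0)) (ℕ.+-comm m r))) (at f last<n))))
               (f≤0 _ (≡.trans (Fin.toℕ-fromℕ< last<n) (ℕ.+-identityʳ _)))) ⟩
      ∑[ t < m ] extend g (r ℕ.+ toℕ t) + ∑[ t < r ] x + 0#
        ≈⟨ +-identityʳ _ ⟩
      ∑[ t < m ] extend g (r ℕ.+ toℕ t) + ∑[ t < r ] x
        ≈⟨ +-cong (≈-sym (partial-sum r m 1 n≡r+m+1 g)) (sum-replicate r) ⟩
      ∑[ suc r ⋯ r ℕ.+ m ] g + r · x   ∎

  -- Assembly of the two bounds

  kemeny-bounds : ∀ {n} (G H : Graph n) (r m : ℕ) → n ≡ suc (r ℕ.+ m) → Connected G → Connected H →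
    (∀ i → 0# < degree G i) → (∀ i → 0# < degree H i) → ObtainedByDeleting r G H →
    ∀ {μ θ : Vector ℝ n} → AreEigenvalues (normalizedLaplacian G) μ → Decreasing μ →
    AreEigenvalues (normalizedLaplacian H) θ → Decreasing θ →
    ∀ {i₀ iₚ iₗ : Fin n} → toℕ i₀ ≡ 0 → suc (toℕ iₚ) ≡ r ℕ.+ m → toℕ iₗ ≡ r ℕ.+ m → μ iₗ ≈ 0# → θ iₗ ≈ 0# →
    ∀ {K} → IsKemenyConstant G K →
    (r · (μ i₀) ⁻¹ + ∑[ 1 ⋯ m ] (λ j → (θ j) ⁻¹) ≤ K) × (K ≤ ∑[ suc r ⋯ r ℕ.+ m ] (λ j → (θ j) ⁻¹) + r · (μ iₚ) ⁻¹)
  kemeny-bounds {n} G H r m n≡1+r+m connG connH posG posH del {μ} {θ} μ-eig μ-dec θ-eig θ-dec {i₀} {iₚ} {iₗ} i₀≡0 iₚ≡ iₗ≡ μ≈0 θ≈0 {K} isKemeny =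
    -- Taking reciprocals reverses the interlacing inequalities where the eigenvalues are positive,
    -- that is, before the last index; at the last index the reciprocal is 0 by convention.
    ≤-respʳ-≈ (≈-sym K≈) (shifted-sum-≤ r m n≡1+r+m (λ j → (μ j) ⁻¹) (λ j → (θ j) ⁻¹)
      (λ p p< → ⁻¹-antitone (μ-pos p p<) (μ-dec i₀ p (≡.subst (ℕ._≤ toℕ p) (≡.sym i₀≡0) ℕ.z≤n)))
      (λ p p≡ → ≤-reflexive (≈-sym (μ-last p p≡)))
      (λ p q p≡q+r p< → ⁻¹-antitone (μ-pos p p<) (interlacing-upper p q (count p≡q+r)))) ,
    ≤-respˡ-≈ (≈-sym K≈) (sum-≤-shifted r m n≡1+r+m (λ j → (μ j) ⁻¹) (λ j → (θ j) ⁻¹)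
      (λ p p< → ⁻¹-antitone (μ-pos iₚ (≡.subst (toℕ iₚ ℕ.<_) iₚ≡ ℕ.≤-refl)) (μ-dec p iₚ (ℕ.s≤s⁻¹ (≡.subst (toℕ p ℕ.<_) (≡.sym iₚ≡) p<))))
      (λ p p≡ → ≤-reflexive (μ-last p p≡))
      (λ p q p≡q+r p< → ⁻¹-antitone (θ-pos p p<) (interlacing-lower p q (count p≡q+r))))
    where
    diagG = diagonalisation G posG μ-eig
    diagH = diagonalisation H posH θ-eig
    open Interlacing G H connG connH (ObtainedByDeleting.subgraph del) diagG μ-dec diagH θ-dec
    K≈ : K ≈ sum (λ j → (μ j) ⁻¹)
    K≈ = Kemeny.kemeny G connG posG diagG isKemeny
    count : ∀ {p q} → p ≡ q ℕ.+ r → p ≡ q ℕ.+ length (deletedEdges G H)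
    count {q = q} p≡q+r = ≡.trans p≡q+r (≡.cong (q ℕ.+_) (≡.sym (ObtainedByDeleting.count del)))
    ≢last : ∀ p → toℕ p ℕ.< r ℕ.+ m → p ≢ iₗ
    ≢last p p< ≡.refl = ℕ.<-irrefl iₗ≡ p<
    μ-pos : ∀ p → toℕ p ℕ.< r ℕ.+ m → 0# < μ p
    μ-pos p p< = Spectrum.eigenvalue-positive G connG diagG μ≈0 (≢last p p<)
    θ-pos : ∀ p → toℕ p ℕ.< r ℕ.+ m → 0# < θ p
    θ-pos p p< = Spectrum.eigenvalue-positive H connH diagH θ≈0 (≢last p p<)
    μ-last : ∀ p → toℕ p ≡ r ℕ.+ m → (μ p) ⁻¹ ≈ 0#
    μ-last p p≡ = ⁻¹-zero (≈-trans (≈-reflexive (≡.cong μ (Fin.toℕ-injective (≡.trans p≡ (≡.sym iₗ≡))))) μ≈0)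

theorem5p7 : (ℛ : RealNumbers) → let open OverReals ℛ in
    ∀ (k : ℕ) → let n = suc (suc k) in
    ∀ (G H : Graph n) (r : ℕ) →
    Graph.Connected G →
    Graph.Connected H →
    ObtainedByDeleting r G H →
    r ≤ℕ n ∸ 1 →
    ∀ (μ θ : Vector ℝ n) →
    AreEigenvalues (normalizedLaplacian G) μ →
    Decreasing μ →
    final μ ≈ 0# →
    AreEigenvalues (normalizedLaplacian H) θ →
    Decreasing θ →
    final θ ≈ 0# →
    ∀ (K : ℝ) →
    IsKemenyConstant G K →
    (r · (first μ) ⁻¹ + ∑[ 1 ⋯ n ∸ r ∸ 1 ] (λ j → (θ j) ⁻¹) ≤ K) ×
    (K ≤ ∑[ suc r ⋯ n ∸ 1 ] (λ j → (θ j) ⁻¹) + r · (penultimate μ) ⁻¹)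
theorem5p7 ℛ k G H r connG connH del r≤n-1 μ θ μ-eig μ-dec μ≈0 θ-eig θ-dec θ≈0 K isKemeny =
  ≡.subst (λ m → r · (first μ) ⁻¹ + ∑[ 1 ⋯ m ] (λ j → (θ j) ⁻¹) ≤ K) m≡ (proj₁ bounds) ,
  ≡.subst (λ m → K ≤ ∑[ suc r ⋯ m ] (λ j → (θ j) ⁻¹) + r · (penultimate μ) ⁻¹) r+m≡n-1 (proj₂ bounds)
  where
  open Development ℛ
  -- The identity r + m = n - 1, valid because r ≤ n - 1, replaces truncated subtraction by addition
  -- throughout.
  m = suc k ∸ r
  r+m≡n-1 : r ℕ.+ m ≡ suc k
  r+m≡n-1 = ℕ.m+[n∸m]≡n r≤n-1
  m≡ : m ≡ suc (suc k) ∸ r ∸ 1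
  m≡ = ≡.trans (ℕ.∸-+-assoc (suc (suc k)) 1 r) (≡.trans (≡.cong (suc (suc k) ∸_) (ℕ.+-comm 1 r)) (≡.sym (ℕ.∸-+-assoc (suc (suc k)) r 1)))
  bounds = kemeny-bounds G H r m (≡.cong suc (≡.sym r+m≡n-1)) connG connH (degree-positive G connG) (degree-positive H connH) del
    μ-eig μ-dec θ-eig θ-dec {zero} {inject₁ (fromℕ k)} {fromℕ (suc k)} ≡.refl
    (≡.trans (≡.cong suc (≡.trans (Fin.toℕ-inject₁ (fromℕ k)) (Fin.toℕ-fromℕ k))) (≡.sym r+m≡n-1))
    (≡.trans (Fin.toℕ-fromℕ (suc k)) (≡.sym r+m≡n-1)) μ≈0 θ≈0 isKemeny
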